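{- Let $k$ be an indeterminate and define $$a(k)=10k^2-8k+8,\qquad b(k)=k(k^2-4k+20),\qquad c(k)=(k+2)(k^2-4).$$ Consider the elliptic curve over the rational function field $\mathbb{Q}(k)$ given by $$E:\ y^2=\big(x+a(k)b(k)\big)\big(x+b(k)c(k)\big)\big(x+a(k)c(k)\big).$$ The torsion subgroup of $E(\mathbb{Q}(k))$ is isomorphic to $\mathbb{Z}/2\mathbb{Z}\times\mathbb{Z}/2\mathbb{Z}$.
   Context: When specializing $k$ to a rational number, the values $k=0,\pm2$ are excluded. -}

module Defs where

open import Algebra.Bundles using (CommutativeRing; Group; RawGroup; Semiring)
open import Algebra.Apartness.Bundles using (HeytingField)
import Algebra.Construct.DirectProduct as DirectProduct
open import Algebra.Definitions using (Invertible)
import Algebra.Definitions.RawMonoid as RawMonoidDefinitions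
import Algebra.Definitions.RawSemiring as RawSemiringDefinitions
import Algebra.Properties.AbelianGroup as AbelianGroupProperties
import Algebra.Properties.CommutativeSemigroup as CommutativeSemigroupProperties
import Algebra.Properties.Ring as RingProperties
import Algebra.Properties.Semiring.Mult as SemiringMult
import Algebra.Solver.Ring
open import Algebra.Solver.Ring.AlmostCommutativeRing using (fromCommutativeRing; _-Raw-AlmostCommutative⟶_)
open import Data.Integer.Base as ℤ using (ℤ; +_; -[1+_])
import Data.Integer.Properties as ℤ
open import Data.List.Base using (List; []; _∷_; map)
open import Data.Maybe.Base as Maybe using (Maybe)
open import Data.Nat.Base as ℕ using (ℕ; zero; suc)
import Data.Parity.Properties as Parity
open import Data.Product.Base using (Σ; ∃-syntax; _×_; _,_; proj₁)
open import Data.Rational.Base as ℚ using (ℚ; 0ℚ; 1ℚ; 1/_)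
import Data.Rational.Properties as ℚ
open import Data.Sum.Base using (_⊎_; inj₁; inj₂; [_,_]′)
open import Function.Base using (_∘_; _on_)
open import Level using (_⊔_; 0ℓ)
open import Relation.Binary.Bundles using (DecSetoid)
open import Relation.Binary.Consequences using (dec⇒weaklyDec)
open import Relation.Binary.Definitions using (Decidable)
open import Relation.Binary.Structures using (IsEquivalence)
import Relation.Binary.Properties.DecSetoid as DecSetoidProperties
import Relation.Binary.Reasoning.Setoid as SetoidReasoning
open import Relation.Binary.PropositionalEquality as ≡ using (_≡_; _≢_; cong; cong₂)
open import Relation.Nullary using (¬_; Dec; yes; no; contradiction)
open import Relation.Nullary.Decidable using (map′; _×-dec_; ¬?; from-no)

-- For an arbitrary ring the library instantiates its solver with natural
-- coefficients only, which cannot cancel x - x.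

module IntegerRingSolver {c ℓ} (R : CommutativeRing c ℓ) where

  open CommutativeRing R
  open SemiringMult semiring using (×-homo-+; ×1-homo-*) renaming (_×_ to _·_)
  open RingProperties ring using (-‿distribˡ-*; -‿distribʳ-*)
  open AbelianGroupProperties +-abelianGroup using (⁻¹-∙-comm; ⁻¹-involutive; ε⁻¹≈ε)
  open CommutativeSemigroupProperties +-commutativeSemigroup using (interchange)
  open SetoidReasoning setoid

  private
    ⟦_⟧ : ℤ → Carrier
    ⟦ + n ⟧      = n · 1#
    ⟦ -[1+ n ] ⟧ = - (suc n · 1#)

    ⊖-homo : ∀ m n → ⟦ m ℤ.⊖ n ⟧ ≈ m · 1# - n · 1#
    ⊖-homo zero    zero    = sym (trans (+-identityˡ _) ε⁻¹≈ε)
    ⊖-homo zero    (suc n) = sym (+-identityˡ _)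
    ⊖-homo (suc m) zero    = sym (trans (+-congˡ ε⁻¹≈ε) (+-identityʳ _))
    ⊖-homo (suc m) (suc n) = begin
      ⟦ suc m ℤ.⊖ suc n ⟧                  ≡⟨ cong ⟦_⟧ (ℤ.[1+m]⊖[1+n]≡m⊖n m n) ⟩
      ⟦ m ℤ.⊖ n ⟧                          ≈⟨ ⊖-homo m n ⟩
      m · 1# - n · 1#                      ≈⟨ +-identityˡ _ ⟨
      0# + (m · 1# - n · 1#)               ≈⟨ +-congʳ (-‿inverseʳ 1#) ⟨
      (1# - 1#) + (m · 1# - n · 1#)        ≈⟨ interchange _ _ _ _ ⟩
      (1# + m · 1#) + (- 1# + - (n · 1#))  ≈⟨ +-congˡ (⁻¹-∙-comm _ _) ⟩
      suc m · 1# - suc n · 1#              ∎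

    -‿homo : ∀ i → ⟦ ℤ.- i ⟧ ≈ - ⟦ i ⟧
    -‿homo (+ zero)  = sym ε⁻¹≈ε
    -‿homo (+ suc n) = refl
    -‿homo -[1+ n ]  = sym (⁻¹-involutive _)

    +-homo : ∀ i j → ⟦ i ℤ.+ j ⟧ ≈ ⟦ i ⟧ + ⟦ j ⟧
    +-homo (+ m)    (+ n)    = ×-homo-+ 1# m n
    +-homo (+ m)    -[1+ n ] = ⊖-homo m (suc n)
    +-homo -[1+ m ] (+ n)    = trans (⊖-homo n (suc m)) (+-comm _ _)
    +-homo -[1+ m ] -[1+ n ] = begin
      ⟦ -[1+ m ] ℤ.+ -[1+ n ] ⟧          ≡⟨ cong ⟦_⟧ (ℤ.neg-distrib-+ (+ suc m) (+ suc n)) ⟨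
      - ((suc m ℕ.+ suc n) · 1#)         ≈⟨ -‿cong (×-homo-+ 1# (suc m) (suc n)) ⟩
      - (suc m · 1# + suc n · 1#)        ≈⟨ ⁻¹-∙-comm _ _ ⟨
      ⟦ -[1+ m ] ⟧ + ⟦ -[1+ n ] ⟧        ∎

    *-homo⁺ : ∀ m j → ⟦ + m ℤ.* j ⟧ ≈ ⟦ + m ⟧ * ⟦ j ⟧
    *-homo⁺ m (+ n) = begin
      ⟦ + m ℤ.* + n ⟧    ≡⟨ cong ⟦_⟧ (ℤ.pos-* m n) ⟨
      (m ℕ.* n) · 1#     ≈⟨ ×1-homo-* m n ⟩
      ⟦ + m ⟧ * ⟦ + n ⟧  ∎
    *-homo⁺ m -[1+ n ] = begin
      ⟦ + m ℤ.* -[1+ n ] ⟧       ≡⟨ cong ⟦_⟧ (ℤ.neg-distribʳ-* (+ m) (+ suc n)) ⟨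
      ⟦ ℤ.- (+ m ℤ.* + suc n) ⟧  ≈⟨ -‿homo (+ m ℤ.* + suc n) ⟩
      - ⟦ + m ℤ.* + suc n ⟧      ≈⟨ -‿cong (*-homo⁺ m (+ suc n)) ⟩
      - (⟦ + m ⟧ * ⟦ + suc n ⟧)  ≈⟨ -‿distribʳ-* _ _ ⟩
      ⟦ + m ⟧ * ⟦ -[1+ n ] ⟧     ∎

    *-homo : ∀ i j → ⟦ i ℤ.* j ⟧ ≈ ⟦ i ⟧ * ⟦ j ⟧
    *-homo (+ m)    j = *-homo⁺ m j
    *-homo -[1+ m ] j = begin
      ⟦ -[1+ m ] ℤ.* j ⟧       ≡⟨ cong ⟦_⟧ (ℤ.neg-distribˡ-* (+ suc m) j) ⟨
      ⟦ ℤ.- (+ suc m ℤ.* j) ⟧  ≈⟨ -‿homo (+ suc m ℤ.* j) ⟩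
      - ⟦ + suc m ℤ.* j ⟧      ≈⟨ -‿cong (*-homo⁺ (suc m) j) ⟩
      - (⟦ + suc m ⟧ * ⟦ j ⟧)  ≈⟨ -‿distribˡ-* _ _ ⟩
      ⟦ -[1+ m ] ⟧ * ⟦ j ⟧     ∎

    morphism : ℤ.+-*-rawRing -Raw-AlmostCommutative⟶ fromCommutativeRing R
    morphism = record
      { ⟦_⟧    = ⟦_⟧
      ; +-homo = +-homo
      ; *-homo = *-homo
      ; -‿homo = -‿homo
      ; 0-homo = refl
      ; 1-homo = +-identityʳ 1#
      }

    ⟦⟧≟ : ∀ i j → Maybe (⟦ i ⟧ ≈ ⟦ j ⟧)
    ⟦⟧≟ i j = Maybe.map (reflexive ∘ cong ⟦_⟧) (dec⇒weaklyDec ℤ._≟_ i j)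

  open Algebra.Solver.Ring ℤ.+-*-rawRing (fromCommutativeRing R) morphism ⟦⟧≟ public
    using (solve; con; _:+_; _:*_; _:-_; :-_; _:=_)

-- ℚ[k]: a polynomial is its list of coefficients, constant term first.
-- Trailing zeros are allowed, so equality is equality of all coefficients.

module ℚ[k] where

  Poly : Set
  Poly = List ℚ

  coeff : Poly → ℕ → ℚ
  coeff []      _       = 0ℚ
  coeff (a ∷ p) zero    = a
  coeff (a ∷ p) (suc n) = coeff p n

  infix 4 _≈_
  record _≈_ (p q : Poly) : Set where
    constructor coeffwise
    field at : ∀ n → coeff p n ≡ coeff q n
  open _≈_ public

  infixl 6 _+_
  infixl 7 _*_
  infix  8 -_

  _+_ : Poly → Poly → Poly
  []      + q       = q
  (a ∷ p) + []      = a ∷ p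
  (a ∷ p) + (b ∷ q) = (a ℚ.+ b) ∷ (p + q)

  -_ : Poly → Poly
  -_ = map (ℚ.-_)

  scale : ℚ → Poly → Poly
  scale a = map (a ℚ.*_)

  _*_ : Poly → Poly → Poly
  []      * q = []
  (a ∷ p) * q = scale a q + (0ℚ ∷ p * q)

  0ᴾ 1ᴾ : Poly
  0ᴾ = []
  1ᴾ = 1ℚ ∷ []

  ≈-isEquivalence : IsEquivalence _≈_
  ≈-isEquivalence = record
    { refl  = coeffwise λ _ → ≡.refl
    ; sym   = λ e → coeffwise λ n → ≡.sym (at e n)
    ; trans = λ e f → coeffwise λ n → ≡.trans (at e n) (at f n)
    }

  open IsEquivalence ≈-isEquivalence using (refl; sym; trans)

  ∷-cong : ∀ {a b p q} → a ≡ b → p ≈ q → a ∷ p ≈ b ∷ q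
  ∷-cong a≡b p≈q = coeffwise λ { zero → a≡b ; (suc n) → at p≈q n }

  ∷≈0 : ∀ {a p} → a ≡ 0ℚ → p ≈ 0ᴾ → a ∷ p ≈ 0ᴾ
  ∷≈0 a≡0 p≈0 = coeffwise λ { zero → a≡0 ; (suc n) → at p≈0 n }

  tail≈0 : ∀ {a p} → a ∷ p ≈ 0ᴾ → p ≈ 0ᴾ
  tail≈0 e = coeffwise λ n → at e (suc n)

  ≈0? : ∀ p → Dec (p ≈ 0ᴾ)
  ≈0? []      = yes refl
  ≈0? (a ∷ p) = map′ (λ (e , f) → ∷≈0 e f) (λ e → at e zero , tail≈0 e)
                     ((a ℚ.≟ 0ℚ) ×-dec ≈0? p)

  infix 4 _≟_
  _≟_ : Decidable _≈_
  []      ≟ q       = map′ sym sym (≈0? q)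
  (a ∷ p) ≟ []      = ≈0? (a ∷ p)
  (a ∷ p) ≟ (b ∷ q) = map′ (λ (e , f) → ∷-cong e f)
                           (λ e → at e zero , coeffwise λ n → at e (suc n))
                           ((a ℚ.≟ b) ×-dec (p ≟ q))

  coeff-+ : ∀ p q n → coeff (p + q) n ≡ coeff p n ℚ.+ coeff q n
  coeff-+ []      q       n       = ≡.sym (ℚ.+-identityˡ _)
  coeff-+ (a ∷ p) []      n       = ≡.sym (ℚ.+-identityʳ _)
  coeff-+ (a ∷ p) (b ∷ q) zero    = ≡.refl
  coeff-+ (a ∷ p) (b ∷ q) (suc n) = coeff-+ p q n

  coeff-neg : ∀ p n → coeff (- p) n ≡ ℚ.- coeff p n
  coeff-neg []      n       = ≡.refl
  coeff-neg (a ∷ p) zero    = ≡.refl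
  coeff-neg (a ∷ p) (suc n) = coeff-neg p n

  coeff-scale : ∀ a p n → coeff (scale a p) n ≡ a ℚ.* coeff p n
  coeff-scale a []      n       = ≡.sym (ℚ.*-zeroʳ a)
  coeff-scale a (b ∷ p) zero    = ≡.refl
  coeff-scale a (b ∷ p) (suc n) = coeff-scale a p n

  private
    +-via : ∀ p q r s →
            (∀ n → coeff p n ℚ.+ coeff q n ≡ coeff r n ℚ.+ coeff s n) → p + q ≈ r + s
    +-via p q r s e = coeffwise λ n →
      ≡.trans (coeff-+ p q n) (≡.trans (e n) (≡.sym (coeff-+ r s n)))

  +-cong : ∀ {p q r s} → p ≈ q → r ≈ s → p + r ≈ q + s
  +-cong {p} {q} {r} {s} e f = +-via p r q s λ n → cong₂ ℚ._+_ (at e n) (at f n)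

  +-comm : ∀ p q → p + q ≈ q + p
  +-comm p q = +-via p q q p λ n → ℚ.+-comm (coeff p n) (coeff q n)

  +-assoc : ∀ p q r → (p + q) + r ≈ p + (q + r)
  +-assoc p q r = +-via (p + q) r p (q + r) λ n → ≡.trans (cong (ℚ._+ coeff r n) (coeff-+ p q n))
    (≡.trans (ℚ.+-assoc (coeff p n) _ _) (cong (coeff p n ℚ.+_) (≡.sym (coeff-+ q r n))))

  +-identityʳ : ∀ p → p + 0ᴾ ≈ p
  +-identityʳ p = +-comm p 0ᴾ

  -‿cong : ∀ {p q} → p ≈ q → - p ≈ - q
  -‿cong {p} {q} e = coeffwise λ n →
    ≡.trans (coeff-neg p n) (≡.trans (cong ℚ.-_ (at e n)) (≡.sym (coeff-neg q n)))

  -‿inverseˡ : ∀ p → - p + p ≈ 0ᴾ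
  -‿inverseˡ p = coeffwise λ n → ≡.trans (coeff-+ (- p) p n)
    (≡.trans (cong (ℚ._+ coeff p n) (coeff-neg p n)) (ℚ.+-inverseˡ (coeff p n)))

  -‿inverseʳ : ∀ p → p + - p ≈ 0ᴾ
  -‿inverseʳ p = trans (+-comm p (- p)) (-‿inverseˡ p)

  scale-cong : ∀ {a b p q} → a ≡ b → p ≈ q → scale a p ≈ scale b q
  scale-cong {a} {b} {p} {q} e f = coeffwise λ n →
    ≡.trans (coeff-scale a p n) (≡.trans (cong₂ ℚ._*_ e (at f n)) (≡.sym (coeff-scale b q n)))

  scale-distribˡ : ∀ a p q → scale a (p + q) ≈ scale a p + scale a q
  scale-distribˡ a []      q       = refl
  scale-distribˡ a (b ∷ p) []      = refl
  scale-distribˡ a (b ∷ p) (c ∷ q) = ∷-cong (ℚ.*-distribˡ-+ a b c) (scale-distribˡ a p q)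

  scale-assoc : ∀ a b p → scale (a ℚ.* b) p ≈ scale a (scale b p)
  scale-assoc a b []      = refl
  scale-assoc a b (c ∷ p) = ∷-cong (ℚ.*-assoc a b c) (scale-assoc a b p)

  scale-0 : ∀ p → scale 0ℚ p ≈ 0ᴾ
  scale-0 p = coeffwise λ n → ≡.trans (coeff-scale 0ℚ p n) (ℚ.*-zeroˡ (coeff p n))

  scale-1 : ∀ p → scale 1ℚ p ≈ p
  scale-1 p = coeffwise λ n → ≡.trans (coeff-scale 1ℚ p n) (ℚ.*-identityˡ (coeff p n))

  interchange : ∀ p q r s → (p + q) + (r + s) ≈ (p + r) + (q + s)
  interchange p q r s =
    trans (+-assoc p q (r + s)) (trans (+-cong (refl {p}) inner) (sym (+-assoc p r (q + s))))
    where
    inner : q + (r + s) ≈ r + (q + s)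
    inner = trans (sym (+-assoc q r s)) (trans (+-cong (+-comm q r) refl) (+-assoc r q s))

  *-congˡ : ∀ p {q r} → q ≈ r → p * q ≈ p * r
  *-congˡ []      e = refl
  *-congˡ (a ∷ p) e = +-cong (scale-cong {a} ≡.refl e) (∷-cong ≡.refl (*-congˡ p e))

  *-zeroʳ : ∀ p → p * 0ᴾ ≈ 0ᴾ
  *-zeroʳ []      = refl
  *-zeroʳ (a ∷ p) = ∷≈0 ≡.refl (*-zeroʳ p)

  *-∷ : ∀ p b q → p * (b ∷ q) ≈ scale b p + (0ℚ ∷ p * q)
  *-∷ []      b q = sym (∷≈0 ≡.refl refl)
  *-∷ (a ∷ p) b q = ∷-cong
    (cong (ℚ._+ 0ℚ) (ℚ.*-comm a b))
    (trans (+-cong refl (*-∷ p b q))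
      (trans (sym (+-assoc (scale a q) (scale b p) _))
        (trans (+-cong (+-comm (scale a q) (scale b p)) refl)
          (+-assoc (scale b p) (scale a q) _))))

  *-comm : ∀ p q → p * q ≈ q * p
  *-comm []      q = sym (*-zeroʳ q)
  *-comm (a ∷ p) q =
    trans (+-cong refl (∷-cong ≡.refl (*-comm p q))) (sym (*-∷ q a p))

  *-cong : ∀ {p q r s} → p ≈ q → r ≈ s → p * r ≈ q * s
  *-cong {p} {q} {r} {s} e f =
    trans (*-congˡ p f) (trans (*-comm p s) (trans (*-congˡ s e) (*-comm s q)))

  *-distribˡ-+ : ∀ p q r → p * (q + r) ≈ p * q + p * r
  *-distribˡ-+ []      q r = refl
  *-distribˡ-+ (a ∷ p) q r = trans
    (+-cong (scale-distribˡ a q r)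
            (∷-cong (≡.sym (ℚ.+-identityˡ 0ℚ)) (*-distribˡ-+ p q r)))
    (interchange (scale a q) (scale a r) (0ℚ ∷ p * q) (0ℚ ∷ p * r))

  *-distribʳ-+ : ∀ p q r → (q + r) * p ≈ q * p + r * p
  *-distribʳ-+ p q r =
    trans (*-comm (q + r) p) (trans (*-distribˡ-+ p q r) (+-cong (*-comm p q) (*-comm p r)))

  scale-* : ∀ a p q → scale a p * q ≈ scale a (p * q)
  scale-* a []      q = refl
  scale-* a (b ∷ p) q = trans
    (+-cong (scale-assoc a b q) (∷-cong (≡.sym (ℚ.*-zeroʳ a)) (scale-* a p q)))
    (sym (scale-distribˡ a (scale b q) (0ℚ ∷ p * q)))

  0∷-* : ∀ {a} p q → a ≡ 0ℚ → (a ∷ p) * q ≈ 0ℚ ∷ p * q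
  0∷-* p q a≡0 = +-cong (trans (scale-cong a≡0 (refl {q})) (scale-0 q)) refl

  *-0∷ : ∀ {b} p q → b ≡ 0ℚ → p * (b ∷ q) ≈ 0ℚ ∷ p * q
  *-0∷ {b} p q b≡0 =
    trans (*-∷ p b q) (+-cong (trans (scale-cong b≡0 (refl {p})) (scale-0 p)) refl)

  *-assoc : ∀ p q r → (p * q) * r ≈ p * (q * r)
  *-assoc []      q r = refl
  *-assoc (a ∷ p) q r = trans (*-distribʳ-+ r (scale a q) (0ℚ ∷ p * q))
    (+-cong (scale-* a q r) (trans (0∷-* (p * q) r ≡.refl) (∷-cong ≡.refl (*-assoc p q r))))

  *-identityˡ : ∀ p → 1ᴾ * p ≈ p
  *-identityˡ p = trans (+-cong (scale-1 p) (∷≈0 ≡.refl refl)) (+-identityʳ p)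

  *-identityʳ : ∀ p → p * 1ᴾ ≈ p
  *-identityʳ p = trans (*-comm p 1ᴾ) (*-identityˡ p)

  commutativeRing : CommutativeRing 0ℓ 0ℓ
  commutativeRing = record
    { Carrier = Poly ; _≈_ = _≈_ ; _+_ = _+_ ; _*_ = _*_ ; -_ = -_ ; 0# = 0ᴾ ; 1# = 1ᴾ
    ; isCommutativeRing = record
      { isRing = record
        { +-isAbelianGroup = record
          { isGroup = record
            { isMonoid = record
              { isSemigroup = record
                { isMagma = record { isEquivalence = ≈-isEquivalence ; ∙-cong = +-cong }
                ; assoc = +-assoc
                }
              ; identity = (λ _ → refl) , +-identityʳ
              }
            ; inverse = -‿inverseˡ , -‿inverseʳ
            ; ⁻¹-cong = -‿cong
            }
          ; comm = +-comm
          }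
        ; *-cong = *-cong
        ; *-assoc = *-assoc
        ; *-identity = *-identityˡ , *-identityʳ
        ; distrib = *-distribˡ-+ , *-distribʳ-+
        }
      ; *-comm = *-comm
      }
    }

  1≉0 : ¬ 1ᴾ ≈ 0ᴾ
  1≉0 e with () ← at e zero

  private
    ℚ-noZeroDivisors : ∀ a b → a ℚ.* b ≡ 0ℚ → a ≢ 0ℚ → b ≡ 0ℚ
    ℚ-noZeroDivisors a b ab≡0 a≢0 = begin
      b                      ≡⟨ ℚ.*-identityˡ b ⟨
      1ℚ ℚ.* b               ≡⟨ cong (ℚ._* b) (ℚ.*-inverseˡ a) ⟨
      ((1/ a) ℚ.* a) ℚ.* b   ≡⟨ ℚ.*-assoc (1/ a) a b ⟩
      (1/ a) ℚ.* (a ℚ.* b)   ≡⟨ cong ((1/ a) ℚ.*_) ab≡0 ⟩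
      (1/ a) ℚ.* 0ℚ          ≡⟨ ℚ.*-zeroʳ (1/ a) ⟩
      0ℚ                     ∎
      where
      open ≡.≡-Reasoning
      instance _ = ℚ.≢-nonZero a≢0

    a∷p-regular : ∀ {a} p → a ≢ 0ℚ → ∀ q → (a ∷ p) * q ≈ 0ᴾ → q ≈ 0ᴾ
    a∷p-regular     p a≢0 []      e = refl
    a∷p-regular {a} p a≢0 (b ∷ q) e =
      ∷≈0 b≡0 (a∷p-regular p a≢0 q (tail≈0 (trans (sym (*-0∷ (a ∷ p) q b≡0)) e)))
      where
      b≡0 : b ≡ 0ℚ
      b≡0 = ℚ-noZeroDivisors a b (≡.trans (≡.sym (ℚ.+-identityʳ (a ℚ.* b))) (at e zero)) a≢0

  noZeroDivisors : ∀ p q → p * q ≈ 0ᴾ → p ≈ 0ᴾ ⊎ q ≈ 0ᴾ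
  noZeroDivisors []      q e = inj₁ refl
  noZeroDivisors (a ∷ p) q e with a ℚ.≟ 0ℚ
  ... | yes a≡0 = [ (λ p≈0 → inj₁ (∷≈0 a≡0 p≈0)) , inj₂ ]′
                    (noZeroDivisors p q (tail≈0 (trans (sym (0∷-* p q a≡0)) e)))
  ... | no  a≢0 = inj₂ (a∷p-regular p a≢0 q e)

record IsDecIntegralDomain {c ℓ} (R : CommutativeRing c ℓ) : Set (c ⊔ ℓ) where
  open CommutativeRing R
  field
    _≟_            : Decidable _≈_
    1≉0            : ¬ 1# ≈ 0#
    noZeroDivisors : ∀ x y → x * y ≈ 0# → x ≈ 0# ⊎ y ≈ 0#

ℚ[k]-isDecIntegralDomain : IsDecIntegralDomain ℚ[k].commutativeRing
ℚ[k]-isDecIntegralDomain = record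
  { _≟_ = ℚ[k]._≟_ ; 1≉0 = ℚ[k].1≉0 ; noZeroDivisors = ℚ[k].noZeroDivisors }

module FractionField
  {c ℓ} (R : CommutativeRing c ℓ) (isDomain : IsDecIntegralDomain R)
  where

  open CommutativeRing R
  open IsDecIntegralDomain isDomain

  open IntegerRingSolver R
  open SetoidReasoning setoid
  open AbelianGroupProperties +-abelianGroup using (x∙y⁻¹≈ε⇒x≈y; x≈y⇒x∙y⁻¹≈ε)
  open RingProperties ring using ([y-z]x≈yx-zx)

  record Frac : Set (c ⊔ ℓ) where
    constructor frac
    field
      num   : Carrier
      den   : Carrier
      den≉0 : ¬ den ≈ 0#
  open Frac public

  infix  4 _≈ᶠ_
  infixl 6 _+ᶠ_
  infixl 7 _*ᶠ_
  infix  8 -ᶠ_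

  _≈ᶠ_ : Frac → Frac → Set ℓ
  x ≈ᶠ y = num x * den y ≈ num y * den x

  *-≉0 : ∀ {x y} → ¬ x ≈ 0# → ¬ y ≈ 0# → ¬ x * y ≈ 0#
  *-≉0 {x} {y} x≉0 y≉0 xy≈0 = [ x≉0 , y≉0 ]′ (noZeroDivisors x y xy≈0)

  *-cancelʳ : ∀ {x y} z → ¬ z ≈ 0# → x * z ≈ y * z → x ≈ y
  *-cancelʳ {x} {y} z z≉0 e =
    [ x∙y⁻¹≈ε⇒x≈y x y , (λ z≈0 → contradiction z≈0 z≉0) ]′
      (noZeroDivisors (x - y) z (trans ([y-z]x≈yx-zx z x y) (x≈y⇒x∙y⁻¹≈ε e)))

  embed : Carrier → Frac
  embed x = frac x 1# 1≉0

  _+ᶠ_ _*ᶠ_ : Frac → Frac → Frac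
  frac a b b≉0 +ᶠ frac c d d≉0 = frac (a * d + c * b) (b * d) (*-≉0 b≉0 d≉0)
  frac a b b≉0 *ᶠ frac c d d≉0 = frac (a * c) (b * d) (*-≉0 b≉0 d≉0)

  -ᶠ_ : Frac → Frac
  -ᶠ frac a b b≉0 = frac (- a) b b≉0

  0ᶠ 1ᶠ : Frac
  0ᶠ = embed 0#
  1ᶠ = embed 1#

  ≈ᶠ-trans : ∀ {x y z} → x ≈ᶠ y → y ≈ᶠ z → x ≈ᶠ z
  ≈ᶠ-trans {frac a b _} {frac c d d≉0} {frac e f _} p q = *-cancelʳ d d≉0 (begin
    (a * f) * d  ≈⟨ solve 3 (λ a f d → (a :* f) :* d := (a :* d) :* f) refl a f d ⟩
    (a * d) * f  ≈⟨ *-congʳ p ⟩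
    (c * b) * f  ≈⟨ solve 3 (λ c b f → (c :* b) :* f := (c :* f) :* b) refl c b f ⟩
    (c * f) * b  ≈⟨ *-congʳ q ⟩
    (e * d) * b  ≈⟨ solve 3 (λ e d b → (e :* d) :* b := (e :* b) :* d) refl e d b ⟩
    (e * b) * d  ∎)

  ≈ᶠ-isEquivalence : IsEquivalence _≈ᶠ_
  ≈ᶠ-isEquivalence = record
    { refl  = refl
    ; sym   = sym
    ; trans = λ {x} {y} {z} → ≈ᶠ-trans {x} {y} {z}
    }

  infix 4 _≟ᶠ_
  _≟ᶠ_ : Decidable _≈ᶠ_
  x ≟ᶠ y = (num x * den y) ≟ (num y * den x)

  +ᶠ-cong : ∀ {x y u v} → x ≈ᶠ y → u ≈ᶠ v → x +ᶠ u ≈ᶠ y +ᶠ v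
  +ᶠ-cong {frac a b _} {frac a′ b′ _} {frac c d _} {frac c′ d′ _} p q = begin
    (a * d + c * b) * (b′ * d′)
      ≈⟨ solve 6 (λ a b c d b′ d′ → (a :* d :+ c :* b) :* (b′ :* d′)
           := (a :* b′) :* (d :* d′) :+ (c :* d′) :* (b :* b′)) refl a b c d b′ d′ ⟩
    (a * b′) * (d * d′) + (c * d′) * (b * b′)
      ≈⟨ +-cong (*-congʳ p) (*-congʳ q) ⟩
    (a′ * b) * (d * d′) + (c′ * d) * (b * b′)
      ≈⟨ solve 6 (λ a′ b c′ d b′ d′ → (a′ :* b) :* (d :* d′) :+ (c′ :* d) :* (b :* b′)
           := (a′ :* d′ :+ c′ :* b′) :* (b :* d)) refl a′ b c′ d b′ d′ ⟩
    (a′ * d′ + c′ * b′) * (b * d) ∎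

  *ᶠ-cong : ∀ {x y u v} → x ≈ᶠ y → u ≈ᶠ v → x *ᶠ u ≈ᶠ y *ᶠ v
  *ᶠ-cong {frac a b _} {frac a′ b′ _} {frac c d _} {frac c′ d′ _} p q = begin
    (a * c) * (b′ * d′)  ≈⟨ swap a c b′ d′ ⟩
    (a * b′) * (c * d′)  ≈⟨ *-cong p q ⟩
    (a′ * b) * (c′ * d)  ≈⟨ swap a′ b c′ d ⟩
    (a′ * c′) * (b * d)  ∎
    where
    swap : ∀ w x y z → (w * x) * (y * z) ≈ (w * y) * (x * z)
    swap = solve 4 (λ w x y z → (w :* x) :* (y :* z) := (w :* y) :* (x :* z)) refl

  -ᶠ-cong : ∀ {x y} → x ≈ᶠ y → -ᶠ x ≈ᶠ -ᶠ y
  -ᶠ-cong {frac a b _} {frac a′ b′ _} p = begin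
    - a * b′    ≈⟨ solve 2 (λ a b → :- a :* b := :- (a :* b)) refl a b′ ⟩
    - (a * b′)  ≈⟨ -‿cong p ⟩
    - (a′ * b)  ≈⟨ solve 2 (λ a b → :- (a :* b) := :- a :* b) refl a′ b ⟩
    - a′ * b    ∎

  private
    unitˡ : ∀ a b → (0# * b + a * 1#) * b ≈ a * (1# * b)
    unitˡ a b = begin
      (0# * b + a * 1#) * b  ≈⟨ *-congʳ (+-cong (zeroˡ b) (*-identityʳ a)) ⟩
      (0# + a) * b           ≈⟨ *-congʳ (+-identityˡ a) ⟩
      a * b                  ≈⟨ *-congˡ (*-identityˡ b) ⟨
      a * (1# * b)           ∎

    oneˡ : ∀ a b → (1# * a) * b ≈ a * (1# * b)
    oneˡ a b = trans (*-congʳ (*-identityˡ a)) (*-congˡ (sym (*-identityˡ b)))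

    inverseˡ : ∀ a b → (- a * b + a * b) * 1# ≈ 0# * (b * b)
    inverseˡ a b = begin
      (- a * b + a * b) * 1#  ≈⟨ *-identityʳ _ ⟩
      - a * b + a * b         ≈⟨ distribʳ b (- a) a ⟨
      (- a + a) * b           ≈⟨ *-congʳ (-‿inverseˡ a) ⟩
      0# * b                  ≈⟨ zeroˡ b ⟩
      0#                      ≈⟨ zeroˡ (b * b) ⟨
      0# * (b * b)            ∎

  +ᶠ-comm : ∀ x y → x +ᶠ y ≈ᶠ y +ᶠ x
  +ᶠ-comm (frac a b _) (frac c d _) =
    solve 4 (λ a b c d → (a :* d :+ c :* b) :* (d :* b) := (c :* b :+ a :* d) :* (b :* d))
      refl a b c d

  +ᶠ-assoc : ∀ x y z → (x +ᶠ y) +ᶠ z ≈ᶠ x +ᶠ (y +ᶠ z)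
  +ᶠ-assoc (frac a b _) (frac c d _) (frac e f _) =
    solve 6 (λ a b c d e f →
      ((a :* d :+ c :* b) :* f :+ e :* (b :* d)) :* (b :* (d :* f))
      := (a :* (d :* f) :+ (c :* f :+ e :* d) :* b) :* ((b :* d) :* f)) refl a b c d e f

  *ᶠ-comm : ∀ x y → x *ᶠ y ≈ᶠ y *ᶠ x
  *ᶠ-comm (frac a b _) (frac c d _) =
    solve 4 (λ a b c d → (a :* c) :* (d :* b) := (c :* a) :* (b :* d)) refl a b c d

  *ᶠ-assoc : ∀ x y z → (x *ᶠ y) *ᶠ z ≈ᶠ x *ᶠ (y *ᶠ z)
  *ᶠ-assoc (frac a b _) (frac c d _) (frac e f _) =
    solve 6 (λ a b c d e f →
      ((a :* c) :* e) :* (b :* (d :* f)) := (a :* (c :* e)) :* ((b :* d) :* f))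
      refl a b c d e f

  *ᶠ-distribˡ : ∀ x y z → x *ᶠ (y +ᶠ z) ≈ᶠ x *ᶠ y +ᶠ x *ᶠ z
  *ᶠ-distribˡ (frac a b _) (frac c d _) (frac e f _) =
    solve 6 (λ a b c d e f →
      (a :* (c :* f :+ e :* d)) :* ((b :* d) :* (b :* f))
      := ((a :* c) :* (b :* f) :+ (a :* e) :* (b :* d)) :* (b :* (d :* f)))
      refl a b c d e f

  commutativeRingᶠ : CommutativeRing (c ⊔ ℓ) ℓ
  commutativeRingᶠ = record
    { Carrier = Frac ; _≈_ = _≈ᶠ_ ; _+_ = _+ᶠ_ ; _*_ = _*ᶠ_ ; -_ = -ᶠ_ ; 0# = 0ᶠ ; 1# = 1ᶠ
    ; isCommutativeRing = record
      { isRing = record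
        { +-isAbelianGroup = record
          { isGroup = record
            { isMonoid = record
              { isSemigroup = record
                { isMagma = record
                  { isEquivalence = ≈ᶠ-isEquivalence
                  ; ∙-cong = λ {x} {y} {u} {v} → +ᶠ-cong {x} {y} {u} {v}
                  }
                ; assoc = +ᶠ-assoc
                }
              ; identity = idˡ , λ x → ≈ᶠ-trans {x +ᶠ 0ᶠ} {0ᶠ +ᶠ x} {x} (+ᶠ-comm x 0ᶠ) (idˡ x)
              }
            ; inverse = invˡ , λ x →
                ≈ᶠ-trans {x +ᶠ -ᶠ x} { -ᶠ x +ᶠ x} {0ᶠ} (+ᶠ-comm x (-ᶠ x)) (invˡ x)
            ; ⁻¹-cong = λ {x} {y} → -ᶠ-cong {x} {y}
            }
          ; comm = +ᶠ-comm
          }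
        ; *-cong = λ {x} {y} {u} {v} → *ᶠ-cong {x} {y} {u} {v}
        ; *-assoc = *ᶠ-assoc
        ; *-identity = oneˡᶠ , λ x →
            ≈ᶠ-trans {x *ᶠ 1ᶠ} {1ᶠ *ᶠ x} {x} (*ᶠ-comm x 1ᶠ) (oneˡᶠ x)
        ; distrib = *ᶠ-distribˡ , λ x y z →
            ≈ᶠ-trans {(y +ᶠ z) *ᶠ x} {x *ᶠ (y +ᶠ z)} {y *ᶠ x +ᶠ z *ᶠ x}
              (*ᶠ-comm (y +ᶠ z) x)
              (≈ᶠ-trans {x *ᶠ (y +ᶠ z)} {x *ᶠ y +ᶠ x *ᶠ z} {y *ᶠ x +ᶠ z *ᶠ x}
                (*ᶠ-distribˡ x y z)
                (+ᶠ-cong {x *ᶠ y} {y *ᶠ x} {x *ᶠ z} {z *ᶠ x} (*ᶠ-comm x y) (*ᶠ-comm x z)))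
        }
      ; *-comm = *ᶠ-comm
      }
    }
    where
    idˡ : ∀ x → 0ᶠ +ᶠ x ≈ᶠ x
    idˡ (frac a b _) = unitˡ a b

    invˡ : ∀ x → -ᶠ x +ᶠ x ≈ᶠ 0ᶠ
    invˡ (frac a b _) = inverseˡ a b

    oneˡᶠ : ∀ x → 1ᶠ *ᶠ x ≈ᶠ x
    oneˡᶠ (frac a b _) = oneˡ a b

  private
    module F where
      open CommutativeRing commutativeRingᶠ public
      open AbelianGroupProperties (CommutativeRing.+-abelianGroup commutativeRingᶠ) public
        using (x∙y⁻¹≈ε⇒x≈y; x≈y⇒x∙y⁻¹≈ε)

    decSetoidᶠ : DecSetoid (c ⊔ ℓ) ℓ
    decSetoidᶠ = record
      { isDecEquivalence = record { isEquivalence = ≈ᶠ-isEquivalence ; _≟_ = _≟ᶠ_ } }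

    num≈0⇒≈0 : ∀ x → num x ≈ 0# → x ≈ᶠ 0ᶠ
    num≈0⇒≈0 x e = trans (*-congʳ e) (trans (zeroˡ 1#) (sym (zeroˡ (den x))))

  inv : ∀ x → ¬ x ≈ᶠ 0ᶠ → Frac
  inv x x≉0 = frac (den x) (num x) (x≉0 ∘ num≈0⇒≈0 x)

  inv-inverseˡ : ∀ x (x≉0 : ¬ x ≈ᶠ 0ᶠ) → inv x x≉0 *ᶠ x ≈ᶠ 1ᶠ
  inv-inverseˡ (frac a b _) _ = begin
    (b * a) * 1#  ≈⟨ *-identityʳ _ ⟩
    b * a         ≈⟨ *-comm b a ⟩
    a * b         ≈⟨ *-identityˡ _ ⟨
    1# * (a * b)  ∎

  heytingField : HeytingField (c ⊔ ℓ) ℓ ℓ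
  heytingField = record
    { _#_ = λ x y → ¬ x ≈ᶠ y
    ; isHeytingField = record
      { isHeytingCommutativeRing = record
        { isCommutativeRing   = F.isCommutativeRing
        ; isApartnessRelation = DecSetoidProperties.≉-isApartnessRelation decSetoidᶠ
        ; #⇒invertible = λ {x} {y} x≉y →
            let d   = x F.- y
                d≉0 = x≉y ∘ F.x∙y⁻¹≈ε⇒x≈y x y
                l   = inv-inverseˡ d d≉0
            in inv d d≉0 , l
             , F.trans {d F.* inv d d≉0} {inv d d≉0 F.* d} {F.1#} (F.*-comm d (inv d d≉0)) l
        ; invertible⇒# = λ {x} {y} (u , ul , _) x≈y → 1ᶠ≉0ᶠ
            (F.trans {1ᶠ} {u F.* (x F.- y)} {0ᶠ}
              (F.sym {u F.* (x F.- y)} {1ᶠ} ul)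
              (F.trans {u F.* (x F.- y)} {u F.* 0ᶠ} {0ᶠ}
                (F.*-congˡ {u} {x F.- y} {0ᶠ} (F.x≈y⇒x∙y⁻¹≈ε {x} {y} x≈y)) (F.zeroʳ u)))
        }
      ; tight = DecSetoidProperties.≉-tight decSetoidᶠ
      }
    }
    where
    1ᶠ≉0ᶠ : ¬ 1ᶠ ≈ᶠ 0ᶠ
    1ᶠ≉0ᶠ e = 1≉0 (trans (sym (*-identityʳ 1#)) (trans e (zeroˡ 1#)))

-- Decidable apartness gives decidable equality, by tightness.

module EllipticCurve
  {c ℓ₁ ℓ₂} (K : HeytingField c ℓ₁ ℓ₂) (_#?_ : Decidable (HeytingField._#_ K))
  where

  open HeytingField K

  private
    commutativeRing : CommutativeRing c ℓ₁
    commutativeRing = record { isCommutativeRing = isCommutativeRing }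

    open IntegerRingSolver commutativeRing
    open AbelianGroupProperties (CommutativeRing.+-abelianGroup commutativeRing)
      using (x∙y⁻¹≈ε⇒x≈y; x≈y⇒x∙y⁻¹≈ε)
    open SetoidReasoning setoid

    ¬#⇒≈ : ∀ {x y} → ¬ x # y → x ≈ y
    ¬#⇒≈ {x} {y} = proj₁ (tight x y)

  -- y² = (x + α)(x + β)(x + γ); it is smooth exactly when 2 ≠ 0 and the
  -- three roots are distinct.
  record Curve : Set (c ⊔ ℓ₂) where
    field
      α β γ : Carrier
      2#0   : (1# + 1#) # 0#
      α#β   : α # β
      β#γ   : β # γ
      α#γ   : α # γ

  module _ (E : Curve) where

    open Curve E

    cubic cubic′ : Carrier → Carrier
    cubic  x = (x + α) * (x + β) * (x + γ)
    cubic′ x = (x + α) * (x + β) + (x + α) * (x + γ) + (x + β) * (x + γ)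

    data Point : Set (c ⊔ ℓ₁) where
      O      : Point
      affine : (x y : Carrier) → y * y ≈ cubic x → Point

    infix 4 _≈ₚ_
    data _≈ₚ_ : Point → Point → Set (c ⊔ ℓ₁) where
      O≈O     : O ≈ₚ O
      affine≈ : ∀ {x y e x′ y′ e′} → x ≈ x′ → y ≈ y′ → affine x y e ≈ₚ affine x′ y′ e′

    -- For a line of slope s through (x₁ , y₁), whose first two intersections
    -- with the curve have abscissas x₁ and x₂: the reflection in the x-axis
    -- of the third intersection.
    thirdX : (s x₁ x₂ : Carrier) → Carrier
    thirdX s x₁ x₂ = s * s - (α + β + γ) - x₁ - x₂

    thirdY : (s x₁ y₁ x₂ : Carrier) → Carrier
    thirdY s x₁ y₁ x₂ = s * (x₁ - thirdX s x₁ x₂) - y₁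

    chordSlope : ∀ {x₁ x₂} (y₁ y₂ : Carrier) → x₁ # x₂ → Carrier
    chordSlope y₁ y₂ x₁#x₂ = (y₁ - y₂) * proj₁ (#⇒invertible x₁#x₂)

    -- Only used at x₁ = x₂, where y₁ ≠ - y₂ forces y₁ = y₂; the denominator
    -- y₁ - (- y₂) is then 2y₁.
    tangentSlope : ∀ (x₁ : Carrier) {y₁ y₂} → y₁ # (- y₂) → Carrier
    tangentSlope x₁ y₁#-y₂ = cubic′ x₁ * proj₁ (#⇒invertible y₁#-y₂)

    private
      cubic-cong : ∀ {x x′} → x ≈ x′ → cubic x ≈ cubic x′
      cubic-cong e = *-cong (*-cong (+-congʳ e) (+-congʳ e)) (+-congʳ e)

      chord-identity : ∀ x₁ x₂ x₃ y₁ s a b c →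
        ((x₃ + a) * (x₃ + b) * (x₃ + c) - (s * (x₁ - x₃) - y₁) * (s * (x₁ - x₃) - y₁)) * (x₁ - x₂)
        ≈ ((x₁ + a) * (x₁ + b) * (x₁ + c) - y₁ * y₁) * (x₃ - x₂)
          - ((x₂ + a) * (x₂ + b) * (x₂ + c)
              - (y₁ - s * (x₁ - x₂)) * (y₁ - s * (x₁ - x₂))) * (x₃ - x₁)
          + (x₃ - (s * s - (a + b + c) - x₁ - x₂)) * ((x₁ - x₂) * (x₃ - x₁) * (x₃ - x₂))
      chord-identity = solve 8 (λ x₁ x₂ x₃ y₁ s a b c →
        ((x₃ :+ a) :* (x₃ :+ b) :* (x₃ :+ c)
            :- (s :* (x₁ :- x₃) :- y₁) :* (s :* (x₁ :- x₃) :- y₁)) :* (x₁ :- x₂)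
        := ((x₁ :+ a) :* (x₁ :+ b) :* (x₁ :+ c) :- y₁ :* y₁) :* (x₃ :- x₂)
          :- ((x₂ :+ a) :* (x₂ :+ b) :* (x₂ :+ c)
              :- (y₁ :- s :* (x₁ :- x₂)) :* (y₁ :- s :* (x₁ :- x₂))) :* (x₃ :- x₁)
          :+ (x₃ :- (s :* s :- (a :+ b :+ c) :- x₁ :- x₂))
              :* ((x₁ :- x₂) :* (x₃ :- x₁) :* (x₃ :- x₂))) refl

      tangent-identity : ∀ x₁ x₃ y₁ s a b c →
        (x₃ + a) * (x₃ + b) * (x₃ + c) - (s * (x₁ - x₃) - y₁) * (s * (x₁ - x₃) - y₁)
        ≈ ((x₁ + a) * (x₁ + b) * (x₁ + c) - y₁ * y₁)
          + (((x₁ + a) * (x₁ + b) + (x₁ + a) * (x₁ + c) + (x₁ + b) * (x₁ + c))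
              - s * (y₁ - - y₁)) * (x₃ - x₁)
          + (x₃ - (s * s - (a + b + c) - x₁ - x₁)) * ((x₃ - x₁) * (x₃ - x₁))
      tangent-identity = solve 7 (λ x₁ x₃ y₁ s a b c →
        (x₃ :+ a) :* (x₃ :+ b) :* (x₃ :+ c)
          :- (s :* (x₁ :- x₃) :- y₁) :* (s :* (x₁ :- x₃) :- y₁)
        := ((x₁ :+ a) :* (x₁ :+ b) :* (x₁ :+ c) :- y₁ :* y₁)
          :+ (((x₁ :+ a) :* (x₁ :+ b) :+ (x₁ :+ a) :* (x₁ :+ c) :+ (x₁ :+ b) :* (x₁ :+ c))
              :- s :* (y₁ :- :- y₁)) :* (x₃ :- x₁)
          :+ (x₃ :- (s :* s :- (a :+ b :+ c) :- x₁ :- x₁)) :* ((x₃ :- x₁) :* (x₃ :- x₁))) refl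

      x≈y⇒x-y≈0 : ∀ {x y} → x ≈ y → x - y ≈ 0#
      x≈y⇒x-y≈0 = x≈y⇒x∙y⁻¹≈ε

      *≈0 : ∀ {x} y → x ≈ 0# → x * y ≈ 0#
      *≈0 y e = trans (*-congʳ e) (zeroˡ y)

      +≈0 : ∀ {x y} → x ≈ 0# → y ≈ 0# → x + y ≈ 0#
      +≈0 e f = trans (+-cong e f) (+-identityˡ 0#)

      neg≈0 : ∀ {x} → x ≈ 0# → - x ≈ 0#
      neg≈0 {x} e = trans (sym (+-identityˡ (- x))) (x≈y⇒x-y≈0 (sym e))

      cancel : ∀ {x y z} ((u , _) : Invertible _≈_ 1# _*_ z) → x * z ≈ y → x ≈ y * u
      cancel {x} {y} {z} (u , _ , zu≈1) e = begin
        x            ≈⟨ *-identityʳ x ⟨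
        x * 1#       ≈⟨ *-congˡ zu≈1 ⟨
        x * (z * u)  ≈⟨ *-assoc x z u ⟨
        x * z * u    ≈⟨ *-congʳ e ⟩
        y * u        ∎

      cancel₀ : ∀ {x z} → Invertible _≈_ 1# _*_ z → x * z ≈ 0# → x ≈ 0#
      cancel₀ i@(u , _) e = trans (cancel i e) (zeroˡ u)

      divides : ∀ {z} y ((u , _) : Invertible _≈_ 1# _*_ z) → (y * u) * z ≈ y
      divides {z} y (u , uz≈1 , _) =
        trans (*-assoc y u z) (trans (*-congˡ uz≈1) (*-identityʳ y))

      chord-on-curve : ∀ {x₁ y₁ x₂ y₂} (x₁#x₂ : x₁ # x₂) →
        y₁ * y₁ ≈ cubic x₁ → y₂ * y₂ ≈ cubic x₂ →
        let s = chordSlope y₁ y₂ x₁#x₂ ; y₃ = thirdY s x₁ y₁ x₂ in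
        y₃ * y₃ ≈ cubic (thirdX s x₁ x₂)
      chord-on-curve {x₁} {y₁} {x₂} {y₂} x₁#x₂ e₁ e₂ =
        sym (x∙y⁻¹≈ε⇒x≈y _ _ (cancel₀ (#⇒invertible x₁#x₂)
          (trans (chord-identity x₁ x₂ (thirdX s x₁ x₂) y₁ s α β γ)
            (+≈0 (+≈0 (*≈0 _ (x≈y⇒x-y≈0 (sym e₁)))
                      (neg≈0 (*≈0 _ (x≈y⇒x-y≈0 (trans (sym e₂) (*-cong y₂≈ y₂≈))))))
                 (*≈0 _ (x≈y⇒x-y≈0 refl))))))
        where
        s : Carrier
        s = chordSlope y₁ y₂ x₁#x₂

        y₂≈ : y₂ ≈ y₁ - s * (x₁ - x₂)
        y₂≈ = begin
          y₂                   ≈⟨ solve 2 (λ y z → z := y :- (y :- z)) refl y₁ y₂ ⟩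
          y₁ - (y₁ - y₂)       ≈⟨ +-congˡ (-‿cong (divides (y₁ - y₂) (#⇒invertible x₁#x₂))) ⟨
          y₁ - s * (x₁ - x₂)   ∎

      tangent-on-curve : ∀ {x₁ y₁ x₂ y₂} → x₁ ≈ x₂ → (y₁#-y₂ : y₁ # (- y₂)) →
        y₁ * y₁ ≈ cubic x₁ → y₂ * y₂ ≈ cubic x₂ →
        let s = tangentSlope x₁ y₁#-y₂ ; y₃ = thirdY s x₁ y₁ x₂ in
        y₃ * y₃ ≈ cubic (thirdX s x₁ x₂)
      tangent-on-curve {x₁} {y₁} {x₂} {y₂} x₁≈x₂ y₁#-y₂ e₁ e₂ =
        sym (x∙y⁻¹≈ε⇒x≈y _ _
          (trans (tangent-identity x₁ (thirdX s x₁ x₂) y₁ s α β γ)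
            (+≈0 (+≈0 (x≈y⇒x-y≈0 (sym e₁))
                      (*≈0 _ (x≈y⇒x-y≈0 (sym slope))))
                 (*≈0 _ (x≈y⇒x-y≈0 (+-congˡ (-‿cong (sym x₁≈x₂))))))))
        where
        s : Carrier
        s = tangentSlope x₁ y₁#-y₂

        y₁≈y₂ : y₁ ≈ y₂
        y₁≈y₂ = x∙y⁻¹≈ε⇒x≈y _ _ (cancel₀ (#⇒invertible y₁#-y₂) (begin
          (y₁ - y₂) * (y₁ - - y₂)
            ≈⟨ solve 2 (λ y z → (y :- z) :* (y :- :- z) := y :* y :- z :* z) refl y₁ y₂ ⟩
          y₁ * y₁ - y₂ * y₂
            ≈⟨ x≈y⇒x-y≈0 (trans e₁ (trans (cubic-cong x₁≈x₂) (sym e₂))) ⟩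
          0# ∎))

        slope : s * (y₁ - - y₁) ≈ cubic′ x₁
        slope = trans (*-congˡ (+-congˡ (-‿cong (-‿cong y₁≈y₂))))
                      (divides (cubic′ x₁) (#⇒invertible y₁#-y₂))

      neg-on-curve : ∀ {x y} → y * y ≈ cubic x → - y * - y ≈ cubic x
      neg-on-curve {x} {y} e = trans (solve 1 (λ y → :- y :* :- y := y :* y) refl y) e

    infix  8 ⊖_
    infixl 6 _⊕_

    ⊖_ : Point → Point
    ⊖ O            = O
    ⊖ affine x y e = affine x (- y) (neg-on-curve e)

    _⊕_ : Point → Point → Point
    O                ⊕ Q = Q
    P@(affine _ _ _) ⊕ O = P
    affine x₁ y₁ e₁  ⊕ affine x₂ y₂ e₂ with x₁ #? x₂
    ... | yes x₁#x₂ = affine (thirdX s x₁ x₂) (thirdY s x₁ y₁ x₂) (chord-on-curve x₁#x₂ e₁ e₂)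
      where
      s : Carrier
      s = chordSlope y₁ y₂ x₁#x₂
    ... | no ¬x₁#x₂ with y₁ #? (- y₂)
    ...   | yes y₁#-y₂ = affine (thirdX s x₁ x₂) (thirdY s x₁ y₁ x₂)
                           (tangent-on-curve (¬#⇒≈ ¬x₁#x₂) y₁#-y₂ e₁ e₂)
      where
      s : Carrier
      s = tangentSlope x₁ y₁#-y₂
    ...   | no _ = O

    pointGroup : RawGroup (c ⊔ ℓ₁) (c ⊔ ℓ₁)
    pointGroup = record { Carrier = Point ; _≈_ = _≈ₚ_ ; _∙_ = _⊕_ ; ε = O ; _⁻¹ = ⊖_ }

-- The torsion elements form a subgroup only because of the group axioms, which
-- a raw group lacks; so `subgroup` takes the closure properties as an argument.

module _ {c ℓ} (G : RawGroup c ℓ) where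

  open RawGroup G
  open RawMonoidDefinitions rawMonoid renaming (_×_ to _·_)

  IsTorsion : Carrier → Set ℓ
  IsTorsion x = ∃[ n ] ℕ.NonZero n × n · x ≈ ε

  record IsSubgroup {p} (P : Carrier → Set p) : Set (c ⊔ p) where
    field
      ∙-closed  : ∀ {x y} → P x → P y → P (x ∙ y)
      ε-closed  : P ε
      ⁻¹-closed : ∀ {x} → P x → P (x ⁻¹)

  subgroup : ∀ {p} {P : Carrier → Set p} → IsSubgroup P → RawGroup (c ⊔ p) ℓ
  subgroup {P = P} isSubgroup = record
    { Carrier = Σ Carrier P
    ; _≈_     = _≈_ on proj₁
    ; _∙_     = λ (x , px) (y , py) → x ∙ y , ∙-closed px py
    ; ε       = ε , ε-closed
    ; _⁻¹     = λ (x , px) → x ⁻¹ , ⁻¹-closed px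
    }
    where open IsSubgroup isSubgroup

-- Parity under addition is ℤ/2ℤ. The library's Data.Parity.Base.+-0-rawGroup
-- is not used: the inverse it records is the parity swap.

ℤ/2×ℤ/2 : RawGroup 0ℓ 0ℓ
ℤ/2×ℤ/2 = Group.rawGroup (DirectProduct.group Parity.+-0-group Parity.+-0-group)

module ℚ⟨k⟩ = FractionField ℚ[k].commutativeRing ℚ[k]-isDecIntegralDomain

ℚ⟨k⟩-field : HeytingField 0ℓ 0ℓ 0ℓ
ℚ⟨k⟩-field = ℚ⟨k⟩.heytingField

open HeytingField ℚ⟨k⟩-field using (_+_; _*_; _-_; _#_; 0#; 1#)
open RawSemiringDefinitions (Semiring.rawSemiring (CommutativeRing.semiring ℚ⟨k⟩.commutativeRingᶠ)) using (_^_)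

_#?_ : Decidable _#_
x #? y = ¬? (x ℚ⟨k⟩.≟ᶠ y)

open EllipticCurve ℚ⟨k⟩-field _#?_ public

k : ℚ⟨k⟩.Frac
k = ℚ⟨k⟩.embed (0ℚ ∷ 1ℚ ∷ [])

const : ℕ → ℚ⟨k⟩.Frac
const n = ℚ⟨k⟩.embed ((+ n ℚ./ 1) ∷ [])

a b c : ℚ⟨k⟩.Frac
a = const 10 * k ^ 2 - const 8 * k + const 8
b = k * (k ^ 2 - const 4 * k + const 20)
c = (k + const 2) * (k ^ 2 - const 4)

E : Curve
E = record
  { α   = a * b
  ; β   = b * c
  ; γ   = a * c
  ; 2#0 = from-no ((1# + 1#) ℚ⟨k⟩.≟ᶠ 0#)
  ; α#β = from-no ((a * b) ℚ⟨k⟩.≟ᶠ (b * c))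
  ; β#γ = from-no ((b * c) ℚ⟨k⟩.≟ᶠ (a * c))
  ; α#γ = from-no ((a * b) ℚ⟨k⟩.≟ᶠ (a * c))
  }

E⟨ℚ⟨k⟩⟩ : RawGroup 0ℓ 0ℓ
E⟨ℚ⟨k⟩⟩ = pointGroup E

{-# OPTIONS --safe #-}
module Submission where

-- Put X = x + α, A = α - β and B = α - γ, so that the curve is Y² = X (X - A) (X - B). Since A B is
-- not a square, X² - A B never vanishes, and the functions
--   u = 2 Y / (X² - A B),  v = (X² - 2 A X + A B) / (X² - A B),  w = (X² - 2 B X + A B) / (X² - A B)
-- are defined at every rational point. They satisfy A u² + v² = 1 = B u² + w² and add like the Jacobi
-- functions sn, cn, dn.
--
-- At k = 0, A has a simple zero and B = 64. The form 64 u² + w² is anisotropic over ℚ, so u, v, w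
-- have no pole there, and reduction maps the curve to the product of {±1} (by v) and the circle
-- 64 u² + w² = 1. A torsion point lands on a rational point of finite order of the circle, where
-- w is 0 or ±1 by Niven's theorem. If w reduces to ±1, then u (n P) = u (P) s with s ≡ ± n at k = 0, so
-- u (P) = 0. If w reduces to 0, the same argument with w (P) in place of u (P) gives w (P) = 0, so that
-- B is a square, but its leading coefficient is -60. Hence torsion means u = 0, which is
-- 2-torsion, and there v and w are independent characters with values ±1.
--
-- Only iterated addition of P is examined, so associativity of the group law is not needed.

open import Algebra.Apartness.Bundles using (HeytingField)
open import Algebra.Bundles using (CommutativeRing; RawGroup)
open import Algebra.Definitions using (Invertible)
import Algebra.Definitions.RawMonoid as RawMonoidDefinitions
open import Algebra.Morphism.Structures using (IsGroupIsomorphism)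
import Algebra.Properties.AbelianGroup as AbelianGroupProperties
open import Data.Integer.Base as ℤ using (ℤ; +_; -[1+_])
import Data.Integer.Properties as ℤ
open import Data.List.Base using ([]; _∷_)
open import Data.Nat.Base as ℕ using (ℕ; zero; suc; s≤s; z≤n)
import Data.Nat.Coprimality as Coprimality
open import Data.Nat.Divisibility using (_∣_; divides; ∣1⇒≡1)
import Data.Nat.Properties as ℕ
open import Data.Nat.Solver using (module +-*-Solver)
open import Data.Parity.Base as ℙ using (Parity; 0ℙ; 1ℙ)
open import Data.Product.Base using (_×_; _,_; proj₁; proj₂; ∃-syntax; Σ-syntax)
open import Data.Rational.Base as ℚ using (ℚ; mkℚ; 0ℚ; 1ℚ; ↥_; ↧ₙ_)
import Data.Rational.Properties as ℚ
import Data.Rational.Unnormalised.Base as ℚᵘ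
import Data.Rational.Unnormalised.Properties as ℚᵘ
open import Data.Sum.Base using (_⊎_; inj₁; inj₂; [_,_]′)
open import Function.Base using (_∘_; id)
open import Level using (Level; 0ℓ; _⊔_) renaming (suc to lsuc)
open import Relation.Binary.Definitions using (Decidable; tri<; tri≈; tri>)
open import Relation.Binary.PropositionalEquality as ≡ using (_≡_; _≢_; cong; cong₂; module ≡-Reasoning)
open import Relation.Nullary using (¬_; yes; no; contradiction)
open import Relation.Nullary.Decidable using (from-yes)
open import Defs using (module IntegerRingSolver; module EllipticCurve; module ℚ[k]; module ℚ⟨k⟩; IsTorsion; IsSubgroup; subgroup; ℤ/2×ℤ/2; ℚ⟨k⟩-field; _#?_; k; E; E⟨ℚ⟨k⟩⟩)

-- The curve A u² + v² = 1 = B u² + w² is another model of E: P ↦ (u, v, w) is an isomorphism onto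
-- it, and 1 / u² is the abscissa X of 2 P, which is why u = 0 singles out the points with 2 P = O.
-- What is gained is an addition law whose formulas also cover O, doubling and opposite points, and
-- whose denominator has residue 1 at k = 0. The place k = 0 is one of bad reduction: Y² = X (X - A)
-- (X - B) becomes the nodal cubic Y² = X² (X - 64), whose tangents at the node have the slopes ± 8
-- i. This is the origin of the circle and of the constant 8. Reduction alone only gives residues,
-- whereas u = 0 is wanted in the function field. A formal group would show that the kernel of
-- reduction is torsion-free; here the exact factorisation u (n P) = u (P) s takes its place. Only
-- the residue ± n of s has to be known, and it is nonzero because the residue field has
-- characteristic 0.

-- Polynomial identities of three collinear points

module JacobiIdentities {c ℓ} (R : CommutativeRing c ℓ) where

  open CommutativeRing R
  open IntegerRingSolver R
  open AbelianGroupProperties +-abelianGroup public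
    using () renaming (x∙y⁻¹≈ε⇒x≈y to x-y≈0⇒x≈y; x≈y⇒x∙y⁻¹≈ε to x≈y⇒x-y≈0)

  -- q is a parameter rather than A * B, so that exchanging A and B leaves N literally unchanged.
  N : (q x : Carrier) → Carrier
  N q x = x * x - q

  M : (a q x : Carrier) → Carrier
  M a q x = x * x - (a * x + a * x) + q

  *≈0 : ∀ {x} y → x ≈ 0# → x * y ≈ 0#
  *≈0 y e = trans (*-congʳ e) (zeroˡ y)

  +≈0 : ∀ {x y} → x ≈ 0# → y ≈ 0# → x + y ≈ 0#
  +≈0 e f = trans (+-cong e f) (+-identityˡ 0#)

  neg≈0 : ∀ {x} → x ≈ 0# → - x ≈ 0#
  neg≈0 {x} e = trans (-‿cong e) (solve 0 (:- con (+ 0) := con (+ 0)) refl)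

  -- The line y = s x + t meets y² = x (x - A) (x - B) in the abscissas x₁, x₂, x₃.
  record Collinear (A B q s t x₁ x₂ x₃ : Carrier) : Set ℓ where
    constructor collinear
    field
      AB≈q : A * B ≈ q
      sum₁ : A + B ≈ x₁ + x₂ + x₃ - s * s
      sum₂ : q ≈ x₁ * x₂ + x₁ * x₃ + x₂ * x₃ + (s * t + s * t)
      sum₃ : x₁ * x₂ * x₃ ≈ t * t

  -- A and B enter symmetrically; through this exchange every law for v yields one for w.
  swap-roots : ∀ {A B q s t x₁ x₂ x₃} → Collinear A B q s t x₁ x₂ x₃ → Collinear B A q s t x₁ x₂ x₃
  swap-roots (collinear e e₁ e₂ e₃) = collinear (trans (*-comm _ _) e) (trans (+-comm _ _) e₁) e₂ e₃

  swap-points : ∀ {A B q s t x₁ x₂ x₃} → Collinear A B q s t x₁ x₂ x₃ → Collinear A B q s t x₃ x₂ x₁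
  swap-points {s = s} {t} {x₁} {x₂} {x₃} (collinear e e₁ e₂ e₃) = collinear e
    (trans e₁ (solve 4 (λ s x₁ x₂ x₃ → x₁ :+ x₂ :+ x₃ :- s :* s := x₃ :+ x₂ :+ x₁ :- s :* s)
      refl s x₁ x₂ x₃))
    (trans e₂ (+-congʳ (solve 3 (λ x₁ x₂ x₃ → x₁ :* x₂ :+ x₁ :* x₃ :+ x₂ :* x₃
      := x₃ :* x₂ :+ x₃ :* x₁ :+ x₂ :* x₁) refl x₁ x₂ x₃)))
    (trans (solve 3 (λ x₁ x₂ x₃ → x₃ :* x₂ :* x₁ := x₁ :* x₂ :* x₃) refl x₁ x₂ x₃) e₃)

  module _ {A B q s t x₁ x₂ x₃ : Carrier} (col : Collinear A B q s t x₁ x₂ x₃) where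

    open Collinear col

    private
      -- The hypotheses are A B = q and the comparison of coefficients in x (x - A) (x - B) - (s x +
      -- t)² = (x - x₁) (x - x₂) (x - x₃). An identity follows from them once explicit cofactors c₁,
      -- ..., c₄ are exhibited, which reduces it to ring normalisation.
      combination : ∀ c₁ c₂ c₃ c₄ →
        (A + B - (x₁ + x₂ + x₃ - s * s)) * c₁ + (A * B - q) * c₂
        + (q - (x₁ * x₂ + x₁ * x₃ + x₂ * x₃ + (s * t + s * t))) * c₃
        + (x₁ * x₂ * x₃ - t * t) * c₄ ≈ 0#
      combination c₁ c₂ c₃ c₄ =
        +≈0 (+≈0 (+≈0 (*≈0 c₁ (x≈y⇒x-y≈0 sum₁)) (*≈0 c₂ (x≈y⇒x-y≈0 AB≈q)))
          (*≈0 c₃ (x≈y⇒x-y≈0 sum₂))) (*≈0 c₄ (x≈y⇒x-y≈0 sum₃))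

    -- v₁ v₂ = v₃ + A u₁ u₂ w₃ with denominators cleared.
    vv-identity :
      M A q x₁ * M A q x₂ * N q x₃
      ≈ M A q x₃ * N q x₁ * N q x₂
        + A * ((s * x₁ + t + (s * x₁ + t)) * (s * x₂ + t + (s * x₂ + t))) * M B q x₃
    vv-identity = x-y≈0⇒x≈y _ _ (trans
      (solve 8 (λ A B q s t x₁ x₂ x₃ →
        let d   = λ z → z :+ z
            N   = λ x → x :* x :- q
            M   = λ a x → x :* x :- (a :* x :+ a :* x) :+ q
            y   = λ x → s :* x :+ t :+ (s :* x :+ t)
        in M A x₁ :* M A x₂ :* N x₃
             :- (M A x₃ :* N x₁ :* N x₂ :+ A :* (y x₁ :* y x₂) :* M B x₃)
        := (A :+ B :- (x₁ :+ x₂ :+ x₃ :- s :* s)) :* d (d (A :* x₁ :* x₂ :* (x₃ :* x₃ :- q)))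
          :+ (A :* B :- q) :* d (d (x₁ :* x₂ :* (q :- x₃ :* x₃) :+ d (x₃ :* (s :* x₁ :+ t) :* (s :* x₂ :+ t))))
          :+ (q :- (x₁ :* x₂ :+ x₁ :* x₃ :+ x₂ :* x₃ :+ (s :* t :+ s :* t)))
               :* d (A :* (x₁ :* x₂ :* x₃ :+ q :* (x₁ :+ x₂ :+ x₃) :+ d (t :* (x₃ :* s :- t)))
                     :+ q :* (x₁ :* x₂ :- x₁ :* x₃ :- x₂ :* x₃ :- q :- d (s :* t))
                     :+ d (d ((s :* s :- x₃) :* (x₁ :* x₂ :* x₃ :- t :* t))))
          :+ (x₁ :* x₂ :* x₃ :- t :* t)
               :* d (d (A :* (x₁ :* x₂ :+ x₁ :* x₃ :+ x₂ :* x₃ :+ x₃ :* x₃ :+ d (s :* (t :- x₃ :* s)))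
                     :+ d ((s :* s :- x₃) :* (x₁ :* x₂ :+ x₁ :* x₃ :+ x₂ :* x₃ :+ d (s :* t))))))
        refl A B q s t x₁ x₂ x₃)
      (combination _ _ _ _))

    -- u₃ w₂ = u₁ v₂ + u₂ v₁ w₃ with denominators cleared.
    uw-identity :
      - (s * x₃ + t) * M B q x₂ * N q x₁
      ≈ (s * x₁ + t) * M A q x₂ * N q x₃ + (s * x₂ + t) * M A q x₁ * M B q x₃
    uw-identity = x-y≈0⇒x≈y _ _ (trans
      (solve 8 (λ A B q s t x₁ x₂ x₃ →
        let d   = λ z → z :+ z
            N   = λ x → x :* x :- q
            M   = λ a x → x :* x :- (a :* x :+ a :* x) :+ q
            y   = λ x → s :* x :+ t
        in :- (y x₃) :* M B x₂ :* N x₁ :- (y x₁ :* M A x₂ :* N x₃ :+ y x₂ :* M A x₁ :* M B x₃)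
        := (A :+ B :- (x₁ :+ x₂ :+ x₃ :- s :* s))
               :* d (x₁ :* x₁ :* (d (x₂ :* x₃ :* s) :+ t :* (x₂ :+ x₃)) :+ t :* q :* (x₃ :- x₂))
          :+ (A :* B :- q) :* (:- d (d (x₁ :* x₃ :* (s :* x₂ :+ t))))
          :+ (q :- (x₁ :* x₂ :+ x₁ :* x₃ :+ x₂ :* x₃ :+ (s :* t :+ s :* t)))
               :* (d (A :* t :* (x₁ :- x₃) :+ s :* t :* (s :* x₁ :+ t) :- x₁ :* x₁ :* t)
                   :- d (x₁ :* x₂ :* x₃ :* s) :- x₁ :* x₂ :* x₃ :* s
                   :+ t :* (x₂ :* x₃ :- x₁ :* x₂ :- x₁ :* x₃ :+ q) :+ s :* q :* (x₁ :- x₂ :+ x₃))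
          :+ (x₁ :* x₂ :* x₃ :- t :* t)
               :* d (d (s :* ((x₁ :- x₃) :* (x₁ :- A) :+ x₃ :* (x₁ :- x₂) :- s :* (s :* x₁ :+ t)))))
        refl A B q s t x₁ x₂ x₃)
      (combination _ _ _ _))

-- Jacobi coordinates

module JacobiCoordinates
  {c ℓ₁ ℓ₂} (K : HeytingField c ℓ₁ ℓ₂) (_#?_ : Decidable (HeytingField._#_ K))
  (E : EllipticCurve.Curve K _#?_)
  where

  open HeytingField K
  module EC = EllipticCurve K _#?_
  open EC.Curve E

  commutativeRing : CommutativeRing c ℓ₁
  commutativeRing = record { isCommutativeRing = isCommutativeRing }

  open IntegerRingSolver commutativeRing
  open JacobiIdentities commutativeRing

  A B q : Carrier
  A = α - β
  B = α - γ
  q = A * B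

  ¬#⇒≈ : ∀ {x y} → ¬ x # y → x ≈ y
  ¬#⇒≈ {x} {y} = proj₁ (tight x y)

  ≈⇒¬# : ∀ {x y} → x ≈ y → ¬ x # y
  ≈⇒¬# {x} {y} = proj₂ (tight x y)

  cancel₀ : ∀ {x z} → Invertible _≈_ 1# _*_ z → x * z ≈ 0# → x ≈ 0#
  cancel₀ {x} {z} (u , _ , zu≈1) e = trans (sym (*-identityʳ x))
    (trans (*-congˡ (sym zu≈1)) (trans (sym (*-assoc x z u)) (*≈0 u e)))

  quotient-* : ∀ {z} y ((u , _) : Invertible _≈_ 1# _*_ z) → (y * u) * z ≈ y
  quotient-* {z} y (u , uz≈1 , _) = trans (*-assoc y u z) (trans (*-congˡ uz≈1) (*-identityʳ y))

  #0⇒invertible : ∀ {x} → x # 0# → Invertible _≈_ 1# _*_ x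
  #0⇒invertible {x} x#0 with u , ux , xu ← #⇒invertible x#0 =
    u , trans (*-congˡ (sym x-0)) ux , trans (*-congʳ (sym x-0)) xu
    where
    x-0 : x - 0# ≈ x
    x-0 = solve 1 (λ x → x :- con (+ 0) := x) refl x

  noZeroDivisors : ∀ {x y} → x * y ≈ 0# → x ≈ 0# ⊎ y ≈ 0#
  noZeroDivisors {x} {y} e with y #? 0#
  ... | yes y#0 = inj₁ (cancel₀ (#0⇒invertible y#0) e)
  ... | no ¬y#0 = inj₂ (¬#⇒≈ ¬y#0)

  -- The quotients are stated with the denominator cleared, which keeps them within reach of ring
  -- identities.
  record Coordinates (x y u v w : Carrier) : Set ℓ₁ where
    constructor coordinates
    field
      uN : u * N q x ≈ y + y
      vN : v * N q x ≈ M A q x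
      wN : w * N q x ≈ M B q x

  -- On the curve w₂² + B u₂² v₁² is the usual denominator 1 - A B u₁² u₂².
  record Addition (u₁ v₁ w₁ u₂ v₂ w₂ u₃ v₃ w₃ : Carrier) : Set ℓ₁ where
    constructor addition
    field
      u-law : u₃ * (w₂ * w₂ + B * (u₂ * u₂) * (v₁ * v₁)) ≈ u₁ * v₂ * w₂ + u₂ * v₁ * w₁
      v-law : v₁ * v₂ ≈ v₃ + A * (u₁ * u₂) * w₃
      w-law : w₁ * w₂ ≈ w₃ + B * (u₁ * u₂) * v₃

  module Nonsquare (nonsquare : ∀ x → (x * x) # q) where

    N-invertible : ∀ x → Invertible _≈_ 1# _*_ (N q x)
    N-invertible x = #⇒invertible (nonsquare x)

    N-cancel : ∀ x₁ x₂ x₃ {y z} → (y - z) * N q x₁ * N q x₂ * N q x₃ ≈ 0# → y ≈ z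
    N-cancel x₁ x₂ x₃ e = x-y≈0⇒x≈y _ _
      (cancel₀ (N-invertible x₁) (cancel₀ (N-invertible x₂) (cancel₀ (N-invertible x₃) e)))

    -- `vv-identity` divided by the three values of N. It is stated for roots a, b in either order
    -- because it serves for v, for w, and for the same line read backwards.
    product-law : ∀ {a b s t x₁ x₂ x₃ u₁ v₁ u₂ v₂ v₃ w₃} → Collinear a b q s t x₁ x₂ x₃ →
      u₁ * N q x₁ ≈ s * x₁ + t + (s * x₁ + t) → v₁ * N q x₁ ≈ M a q x₁ →
      u₂ * N q x₂ ≈ s * x₂ + t + (s * x₂ + t) → v₂ * N q x₂ ≈ M a q x₂ →
      v₃ * N q x₃ ≈ M a q x₃ → w₃ * N q x₃ ≈ M b q x₃ →
      v₁ * v₂ ≈ v₃ + a * (u₁ * u₂) * w₃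
    product-law {a} {b} {s} {t} {x₁} {x₂} {x₃} {u₁} {v₁} {u₂} {v₂} {v₃} {w₃} col e₁ f₁ e₂ f₂ f₃ g₃ =
      N-cancel x₁ x₂ x₃ (trans
        (solve 10 (λ u₁ v₁ u₂ v₂ v₃ w₃ a n₁ n₂ n₃ →
          (v₁ :* v₂ :- (v₃ :+ a :* (u₁ :* u₂) :* w₃)) :* n₁ :* n₂ :* n₃
          := (v₁ :* n₁) :* (v₂ :* n₂) :* n₃
             :- ((v₃ :* n₃) :* n₁ :* n₂ :+ a :* ((u₁ :* n₁) :* (u₂ :* n₂)) :* (w₃ :* n₃)))
          refl u₁ v₁ u₂ v₂ v₃ w₃ a (N q x₁) (N q x₂) (N q x₃))
        (x≈y⇒x-y≈0 (trans (*-congʳ (*-cong f₁ f₂)) (trans (vv-identity col)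
          (sym (+-cong (*-congʳ (*-congʳ f₃)) (*-cong (*-congˡ (*-cong e₁ e₂)) g₃)))))))

    mixed-law : ∀ {s t x₁ x₂ x₃ u₁ v₁ u₂ v₂ w₂ u₃ w₃} → Collinear A B q s t x₁ x₂ x₃ →
      u₁ * N q x₁ ≈ s * x₁ + t + (s * x₁ + t) → v₁ * N q x₁ ≈ M A q x₁ →
      u₂ * N q x₂ ≈ s * x₂ + t + (s * x₂ + t) → v₂ * N q x₂ ≈ M A q x₂ → w₂ * N q x₂ ≈ M B q x₂ →
      u₃ * N q x₃ ≈ - (s * x₃ + t) + - (s * x₃ + t) → w₃ * N q x₃ ≈ M B q x₃ →
      u₃ * w₂ ≈ u₁ * v₂ + u₂ * v₁ * w₃
    mixed-law {s} {t} {x₁} {x₂} {x₃} {u₁} {v₁} {u₂} {v₂} {w₂} {u₃} {w₃} col e₁ f₁ e₂ f₂ g₂ e₃ g₃ =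
      N-cancel x₁ x₂ x₃ (trans
        (solve 10 (λ u₁ v₁ u₂ v₂ w₂ u₃ w₃ n₁ n₂ n₃ →
          (u₃ :* w₂ :- (u₁ :* v₂ :+ u₂ :* v₁ :* w₃)) :* n₁ :* n₂ :* n₃
          := (u₃ :* n₃) :* (w₂ :* n₂) :* n₁
             :- ((u₁ :* n₁) :* (v₂ :* n₂) :* n₃ :+ (u₂ :* n₂) :* (v₁ :* n₁) :* (w₃ :* n₃)))
          refl u₁ v₁ u₂ v₂ w₂ u₃ w₃ (N q x₁) (N q x₂) (N q x₃))
        (x≈y⇒x-y≈0 (trans (*-congʳ (*-cong e₃ g₂)) (trans (twice _ _ _ _ _ _ _ _ _ (uw-identity col))
          (sym (+-cong (*-congʳ (*-cong e₁ f₂)) (*-cong (*-cong e₂ f₁) g₃)))))))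
      where
      -- `uw-identity` is written in y, while u has the numerator 2 y.
      twice : ∀ p₁ p₂ p₃ q₁ q₂ q₃ r₁ r₂ r₃ → p₁ * p₂ * p₃ ≈ q₁ * q₂ * q₃ + r₁ * r₂ * r₃ →
        (p₁ + p₁) * p₂ * p₃ ≈ (q₁ + q₁) * q₂ * q₃ + (r₁ + r₁) * r₂ * r₃
      twice p₁ p₂ p₃ q₁ q₂ q₃ r₁ r₂ r₃ e = trans
        (solve 3 (λ x y z → (x :+ x) :* y :* z := x :* y :* z :+ x :* y :* z) refl p₁ p₂ p₃)
        (trans (+-cong e e)
          (solve 6 (λ x y z x′ y′ z′ →
            (x :* y :* z :+ x′ :* y′ :* z′) :+ (x :* y :* z :+ x′ :* y′ :* z′)
            := (x :+ x) :* y :* z :+ (x′ :+ x′) :* y′ :* z′) refl q₁ q₂ q₃ r₁ r₂ r₃))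

    -- For the u-law, `mixed` is multiplied by w₂ and w₃ w₂ is eliminated by `reversed`. The terms
    -- in u₃ then collect to the factor w₂² + B u₂² v₁², which involves only the two summands.
    collinear⇒addition :
      ∀ {s t x₁ y₁ u₁ v₁ w₁ x₂ y₂ u₂ v₂ w₂ x₃ y₃ u₃ v₃ w₃} → Collinear A B q s t x₁ x₂ x₃ →
      y₁ ≈ s * x₁ + t → y₂ ≈ s * x₂ + t → y₃ ≈ - (s * x₃ + t) →
      Coordinates x₁ y₁ u₁ v₁ w₁ → Coordinates x₂ y₂ u₂ v₂ w₂ → Coordinates x₃ y₃ u₃ v₃ w₃ →
      Addition u₁ v₁ w₁ u₂ v₂ w₂ u₃ v₃ w₃
    collinear⇒addition {s} {t} {u₁ = u₁} {v₁} {w₁} {u₂ = u₂} {v₂} {w₂} {x₃} {y₃} {u₃} {v₃} {w₃}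
      col l₁ l₂ l₃ (coordinates e₁ f₁ g₁) (coordinates e₂ f₂ g₂) (coordinates e₃ f₃ g₃) =
      addition
        (trans (solve 5 (λ u₃ w₂ B u₂ v₁ → u₃ :* (w₂ :* w₂ :+ B :* (u₂ :* u₂) :* (v₁ :* v₁))
            := (u₃ :* w₂) :* w₂ :+ u₂ :* v₁ :* (B :* (u₃ :* u₂) :* v₁)) refl u₃ w₂ B u₂ v₁)
          (trans (+-cong (*-congʳ mixed) refl)
            (trans (solve 7 (λ u₁ v₂ u₂ v₁ w₃ w₂ c →
                (u₁ :* v₂ :+ u₂ :* v₁ :* w₃) :* w₂ :+ u₂ :* v₁ :* c
                := u₁ :* v₂ :* w₂ :+ u₂ :* v₁ :* (w₃ :* w₂ :+ c)) refl u₁ v₂ u₂ v₁ w₃ w₂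
                (B * (u₃ * u₂) * v₁))
              (+-congˡ (*-congˡ (trans (+-congʳ reversed)
                (solve 5 (λ w₁ B u₃ u₂ v₁ → (w₁ :+ B :* (:- u₃ :* u₂) :* v₁) :+ B :* (u₃ :* u₂) :* v₁
                  := w₁) refl w₁ B u₃ u₂ v₁)))))))
        (product-law col e₁′ f₁ e₂′ f₂ f₃ g₃)
        (product-law (swap-roots col) e₁′ g₁ e₂′ g₂ g₃ f₃)
      where
      e₁′ = trans e₁ (+-cong l₁ l₁)
      e₂′ = trans e₂ (+-cong l₂ l₂)
      e₃′ = trans e₃ (+-cong l₃ l₃)

      mixed : u₃ * w₂ ≈ u₁ * v₂ + u₂ * v₁ * w₃
      mixed = mixed-law col e₁′ f₁ e₂′ f₂ g₂ e₃′ g₃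

      -u₃N : - u₃ * N q x₃ ≈ s * x₃ + t + (s * x₃ + t)
      -u₃N = trans (solve 2 (λ u n → :- u :* n := :- (u :* n)) refl u₃ (N q x₃))
        (trans (-‿cong e₃′) (solve 1 (λ l → :- (:- l :+ :- l) := l :+ l) refl (s * x₃ + t)))

      -- The line through P₁, P₂ and - P₃ read as - P₃ + P₂ = - P₁.
      reversed : w₃ * w₂ ≈ w₁ + B * (- u₃ * u₂) * v₁
      reversed = product-law (swap-points (swap-roots col)) -u₃N g₃ e₂′ g₂ g₁ f₁

    -- Two monic cubics that agree in the coefficients of x² and x, and both vanish at x₁, have the
    -- same constant term.
    line-through : ∀ {s t x₁ x₂ x₃} → A + B ≈ x₁ + x₂ + x₃ - s * s →
      (s * x₁ + t) * (s * x₁ + t) ≈ x₁ * (x₁ - A) * (x₁ - B) →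
      q ≈ x₁ * x₂ + x₁ * x₃ + x₂ * x₃ + (s * t + s * t) → Collinear A B q s t x₁ x₂ x₃
    line-through {s} {t} {x₁} {x₂} {x₃} e₁ g e₂ = collinear refl e₁ e₂ (x-y≈0⇒x≈y _ _ (trans
      (solve 7 (λ A B s t x₁ x₂ x₃ → x₁ :* x₂ :* x₃ :- t :* t
        := :- ((s :* x₁ :+ t) :* (s :* x₁ :+ t) :- x₁ :* (x₁ :- A) :* (x₁ :- B)) :* con (+ 1)
           :+ (A :* B :- (x₁ :* x₂ :+ x₁ :* x₃ :+ x₂ :* x₃ :+ (s :* t :+ s :* t))) :* (:- x₁)
           :+ (A :+ B :- (x₁ :+ x₂ :+ x₃ :- s :* s)) :* (x₁ :* x₁)) refl A B s t x₁ x₂ x₃)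
      (+≈0 (+≈0 (*≈0 _ (neg≈0 (x≈y⇒x-y≈0 g))) (*≈0 _ (x≈y⇒x-y≈0 e₂))) (*≈0 _ (x≈y⇒x-y≈0 e₁)))))

    -- Subtracting the curve equations at x₁ and x₂ removes the constant coefficient and leaves the
    -- linear one times x₁ - x₂.
    chord-sum₂ : ∀ {s t x₁ x₂ x₃} → Invertible _≈_ 1# _*_ (x₁ - x₂) →
      A + B ≈ x₁ + x₂ + x₃ - s * s →
      (s * x₁ + t) * (s * x₁ + t) ≈ x₁ * (x₁ - A) * (x₁ - B) →
      (s * x₂ + t) * (s * x₂ + t) ≈ x₂ * (x₂ - A) * (x₂ - B) →
      q ≈ x₁ * x₂ + x₁ * x₃ + x₂ * x₃ + (s * t + s * t)
    chord-sum₂ {s} {t} {x₁} {x₂} {x₃} i e g₁ g₂ = x-y≈0⇒x≈y _ _ (cancel₀ i (trans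
      (solve 7 (λ A B s t x₁ x₂ x₃ →
        (A :* B :- (x₁ :* x₂ :+ x₁ :* x₃ :+ x₂ :* x₃ :+ (s :* t :+ s :* t))) :* (x₁ :- x₂)
        := (A :+ B :- (x₁ :+ x₂ :+ x₃ :- s :* s)) :* (x₁ :* x₁ :- x₂ :* x₂)
           :+ ((s :* x₂ :+ t) :* (s :* x₂ :+ t) :- x₂ :* (x₂ :- A) :* (x₂ :- B))
           :+ :- ((s :* x₁ :+ t) :* (s :* x₁ :+ t) :- x₁ :* (x₁ :- A) :* (x₁ :- B)))
        refl A B s t x₁ x₂ x₃)
      (+≈0 (+≈0 (*≈0 _ (x≈y⇒x-y≈0 e)) (x≈y⇒x-y≈0 g₂)) (neg≈0 (x≈y⇒x-y≈0 g₁)))))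

    -- At a double root the derivative of the cubic minus the squared line vanishes; this replaces
    -- the difference quotient of the chord.
    tangent-sum₂ : ∀ {s t x₁ x₂ x₃} → x₁ ≈ x₂ → A + B ≈ x₁ + x₂ + x₃ - s * s →
      s * (s * x₁ + t + (s * x₁ + t))
        ≈ x₁ * (x₁ - A) + x₁ * (x₁ - B) + (x₁ - A) * (x₁ - B) →
      q ≈ x₁ * x₂ + x₁ * x₃ + x₂ * x₃ + (s * t + s * t)
    tangent-sum₂ {s} {t} {x₁} {x₂} {x₃} x₁≈x₂ e slope = x-y≈0⇒x≈y _ _ (trans
      (solve 7 (λ A B s t x₁ x₂ x₃ →
        A :* B :- (x₁ :* x₂ :+ x₁ :* x₃ :+ x₂ :* x₃ :+ (s :* t :+ s :* t))
        := (A :+ B :- (x₁ :+ x₂ :+ x₃ :- s :* s)) :* (x₁ :+ x₁)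
           :+ (x₁ :- x₂) :* (x₃ :- x₁)
           :+ :- (s :* (s :* x₁ :+ t :+ (s :* x₁ :+ t))
             :- (x₁ :* (x₁ :- A) :+ x₁ :* (x₁ :- B) :+ (x₁ :- A) :* (x₁ :- B))))
        refl A B s t x₁ x₂ x₃)
      (+≈0 (+≈0 (*≈0 _ (x≈y⇒x-y≈0 e)) (*≈0 _ (x≈y⇒x-y≈0 x₁≈x₂))) (neg≈0 (x≈y⇒x-y≈0 slope))))

    ratio : (z x : Carrier) → Carrier
    ratio z x = z * proj₁ (N-invertible (x + α))

    uₚ vₚ wₚ : EC.Point E → Carrier
    uₚ EC.O              = 0#
    uₚ (EC.affine x y _) = ratio (y + y) x
    vₚ EC.O              = 1#
    vₚ (EC.affine x y _) = ratio (M A q (x + α)) x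
    wₚ EC.O              = 1#
    wₚ (EC.affine x y _) = ratio (M B q (x + α)) x

    coords : ∀ x y →
      Coordinates (x + α) y (ratio (y + y) x) (ratio (M A q (x + α)) x) (ratio (M B q (x + α)) x)
    coords x y = coordinates (quotient-* _ i) (quotient-* _ i) (quotient-* _ i)
      where i = N-invertible (x + α)

    on-shifted : ∀ {x y} → y * y ≈ EC.cubic E x → y * y ≈ (x + α) * (x + α - A) * (x + α - B)
    on-shifted {x} e = trans e (solve 4 (λ x a b c → (x :+ a) :* (x :+ b) :* (x :+ c)
      := (x :+ a) :* (x :+ a :- (a :- b)) :* (x :+ a :- (a :- c))) refl x α β γ)

    -- M² - N² = (2 q - 2 a x) (2 x² - 2 a x), which is - 4 a x (x - a) (x - b) when a b = q.
    conic : ∀ {a b x y u v} → a * b ≈ q → y * y ≈ x * (x - a) * (x - b) →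
      u * N q x ≈ y + y → v * N q x ≈ M a q x → a * (u * u) + v * v ≈ 1#
    conic {a} {b} {x} {y} {u} {v} ab≈q g e f = x-y≈0⇒x≈y _ _
      (cancel₀ (N-invertible x) (cancel₀ (N-invertible x) (trans
        (solve 5 (λ a u v o n → (a :* (u :* u) :+ v :* v :- o) :* n :* n
          := a :* ((u :* n) :* (u :* n)) :+ (v :* n) :* (v :* n) :- o :* (n :* n)) refl a u v 1# (N q x))
        (trans (+-cong (+-cong (*-congˡ (*-cong e e)) (*-cong f f)) (-‿cong (*-identityˡ _)))
          (trans (solve 5 (λ a b q x y →
            let n = x :* x :- q ; m = x :* x :- (a :* x :+ a :* x) :+ q in
            a :* ((y :+ y) :* (y :+ y)) :+ m :* m :- n :* n
            := (y :* y :- x :* (x :- a) :* (x :- b)) :* (con (+ 4) :* a)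
               :+ (a :* b :- q) :* (con (+ 4) :* x :* (a :- x))) refl a b q x y)
            (+≈0 (*≈0 _ (x≈y⇒x-y≈0 g)) (*≈0 _ (x≈y⇒x-y≈0 ab≈q))))))))

    v-conic : ∀ P → A * (uₚ P * uₚ P) + vₚ P * vₚ P ≈ 1#
    v-conic EC.O = trans (+-cong (solve 1 (λ a → a :* (con (+ 0) :* con (+ 0)) := con (+ 0)) refl A)
      (*-identityˡ 1#)) (+-identityˡ 1#)
    v-conic (EC.affine x y e) = conic refl (on-shifted e) uN vN
      where open Coordinates (coords x y)

    w-conic : ∀ P → B * (uₚ P * uₚ P) + wₚ P * wₚ P ≈ 1#
    w-conic EC.O = trans (+-cong (solve 1 (λ a → a :* (con (+ 0) :* con (+ 0)) := con (+ 0)) refl B)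
      (*-identityˡ 1#)) (+-identityˡ 1#)
    w-conic (EC.affine x y e) = conic (*-comm B A) (trans (on-shifted e) (solve 3 (λ x a b →
      x :* (x :- a) :* (x :- b) := x :* (x :- b) :* (x :- a)) refl (x + α) A B)) uN wN
      where open Coordinates (coords x y)

    -- The common part of chord and tangent. They differ in the slope, hence in the argument for the
    -- linear coefficient, which is passed as a function of the facts established here. For a
    -- tangent the condition on s reads 0 = 0.
    third-point : ∀ {s x₁ y₁ x₂ y₂} →
      let X₁ = x₁ + α ; X₂ = x₂ + α
          x₃ = EC.thirdX E s x₁ x₂ ; X₃ = x₃ + α ; t = y₁ - s * X₁
          y₃ = EC.thirdY E s x₁ y₁ x₂ in
      s * (x₁ - x₂) ≈ y₁ - y₂ →
      (A + B ≈ X₁ + X₂ + X₃ - s * s → (s * X₁ + t) * (s * X₁ + t) ≈ X₁ * (X₁ - A) * (X₁ - B) →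
        (s * X₂ + t) * (s * X₂ + t) ≈ X₂ * (X₂ - A) * (X₂ - B) →
        q ≈ X₁ * X₂ + X₁ * X₃ + X₂ * X₃ + (s * t + s * t)) →
      y₁ * y₁ ≈ EC.cubic E x₁ → y₂ * y₂ ≈ EC.cubic E x₂ →
      Addition (ratio (y₁ + y₁) x₁) (ratio (M A q X₁) x₁) (ratio (M B q X₁) x₁)
               (ratio (y₂ + y₂) x₂) (ratio (M A q X₂) x₂) (ratio (M B q X₂) x₂)
               (ratio (y₃ + y₃) x₃) (ratio (M A q X₃) x₃) (ratio (M B q X₃) x₃)
    third-point {s} {x₁} {y₁} {x₂} {y₂} sδ sum₂ e₁ e₂ =
      collinear⇒addition (line-through sum₁ g₁ (sum₂ sum₁ g₁ g₂)) l₁ l₂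
        (solve 5 (λ s x₁ y₁ x₃ a → s :* (x₁ :- x₃) :- y₁
          := :- (s :* (x₃ :+ a) :+ (y₁ :- s :* (x₁ :+ a)))) refl s x₁ y₁ x₃ α)
        (coords x₁ y₁) (coords x₂ y₂) (coords x₃ _)
      where
      x₃ = EC.thirdX E s x₁ x₂
      X₁ = x₁ + α
      X₂ = x₂ + α
      t  = y₁ - s * X₁

      sum₁ : A + B ≈ X₁ + X₂ + (x₃ + α) - s * s
      sum₁ = solve 6 (λ a b c s x₁ x₂ → (a :- b) :+ (a :- c)
        := (x₁ :+ a) :+ (x₂ :+ a) :+ (s :* s :- (a :+ b :+ c) :- x₁ :- x₂ :+ a) :- s :* s)
        refl α β γ s x₁ x₂

      l₁ : y₁ ≈ s * X₁ + t
      l₁ = solve 2 (λ y z → y := z :+ (y :- z)) refl y₁ (s * X₁)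

      l₂ : y₂ ≈ s * X₂ + t
      l₂ = trans (solve 2 (λ y z → z := y :- (y :- z)) refl y₁ y₂)
        (trans (+-congˡ (-‿cong (sym sδ)))
          (solve 5 (λ y s x₁ x₂ a → y :- s :* (x₁ :- x₂) := s :* (x₂ :+ a) :+ (y :- s :* (x₁ :+ a)))
            refl y₁ s x₁ x₂ α))

      g₁ = trans (sym (*-cong l₁ l₁)) (on-shifted e₁)
      g₂ = trans (sym (*-cong l₂ l₂)) (on-shifted e₂)

    ratio-unique : ∀ {x x′ y y′ z z′} → x ≈ x′ → z ≈ z′ → y * N q x ≈ z → y′ * N q x′ ≈ z′ → y ≈ y′
    ratio-unique {x} {x′} {y} {y′} x≈x′ z≈z′ e e′ = x-y≈0⇒x≈y _ _ (cancel₀ (N-invertible x) (trans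
      (solve 3 (λ y z n → (y :- z) :* n := y :* n :- z :* n) refl y y′ (N q x))
      (x≈y⇒x-y≈0 (trans e (trans z≈z′ (trans (sym e′)
        (*-congˡ (+-congʳ (sym (*-cong x≈x′ x≈x′)))))))) ))

    M-cong : ∀ a {x x′} → x ≈ x′ → M a q x ≈ M a q x′
    M-cong a e = +-congʳ (+-cong (*-cong e e) (-‿cong (+-cong (*-congˡ e) (*-congˡ e))))

    -- Merges the five cases of ⊕ into one set of formulas without exceptions.
    ⊕-addition : ∀ P Q → let R = EC._⊕_ E P Q in
      Addition (uₚ P) (vₚ P) (wₚ P) (uₚ Q) (vₚ Q) (wₚ Q) (uₚ R) (vₚ R) (wₚ R)
    ⊕-addition EC.O Q = addition
      -- With v₁ = 1 the denominator is w₂² + B u₂², which is 1 by `w-conic`.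
      (trans (*-congˡ (trans (+-comm _ _) (trans
          (+-congʳ (trans (*-congˡ (*-identityˡ 1#)) (*-identityʳ _))) (w-conic Q))))
        (trans (*-identityʳ u) (trans (sym (trans (*-identityʳ _) (*-identityʳ u)))
          (solve 3 (λ x v w → x := con (+ 0) :* v :* w :+ x) refl (u * 1# * 1#) v w))))
      (trans (*-identityˡ v) (solve 4 (λ v a u w → v := v :+ a :* (con (+ 0) :* u) :* w) refl v A u w))
      (trans (*-identityˡ w) (solve 4 (λ v a u w → v := v :+ a :* (con (+ 0) :* u) :* w) refl w B u v))
      where u = uₚ Q
            v = vₚ Q
            w = wₚ Q
    ⊕-addition P@(EC.affine _ _ _) EC.O = addition
      (trans (*-congˡ (trans (solve 3 (λ o b v → o :* o :+ b :* (con (+ 0) :* con (+ 0)) :* (v :* v)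
            := o :* o) refl 1# B v) (*-identityˡ 1#)))
        (trans (*-identityʳ u) (trans (sym (trans (*-identityʳ _) (*-identityʳ u)))
          (solve 3 (λ x v w → x := x :+ con (+ 0) :* v :* w) refl (u * 1# * 1#) v w))))
      (trans (*-identityʳ v) (solve 4 (λ v a u w → v := v :+ a :* (u :* con (+ 0)) :* w) refl v A u w))
      (trans (*-identityʳ w) (solve 4 (λ v a u w → v := v :+ a :* (u :* con (+ 0)) :* w) refl w B u v))
      where u = uₚ P
            v = vₚ P
            w = wₚ P
    ⊕-addition P@(EC.affine x₁ y₁ e₁) Q@(EC.affine x₂ y₂ e₂) with x₁ #? x₂
    ... | yes x₁#x₂ = third-point (quotient-* _ i) (λ e g₁ g₂ → chord-sum₂ i′ e g₁ g₂) e₁ e₂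
      where
      i = #⇒invertible x₁#x₂
      shift : x₁ - x₂ ≈ (x₁ + α) - (x₂ + α)
      shift = solve 3 (λ x y a → x :- y := (x :+ a) :- (y :+ a)) refl x₁ x₂ α
      i′ : Invertible _≈_ 1# _*_ ((x₁ + α) - (x₂ + α))
      i′ with u , l , r ← i = u , trans (*-congˡ (sym shift)) l , trans (*-congʳ (sym shift)) r
    ... | no ¬x₁#x₂ with y₁ #? (- y₂)
    ...   | yes y₁#-y₂ = third-point
      (trans (*-congˡ (x≈y⇒x-y≈0 x₁≈x₂)) (trans (zeroʳ s) (sym (x≈y⇒x-y≈0 y₁≈y₂))))
      (λ e _ _ → tangent-sum₂ (+-congʳ x₁≈x₂) e (trans (*-congˡ (sym (+-cong l₁ l₁))) slope)) e₁ e₂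
      where
      x₁≈x₂ = ¬#⇒≈ ¬x₁#x₂
      s = EC.tangentSlope E x₁ y₁#-y₂
      l₁ : y₁ ≈ s * (x₁ + α) + (y₁ - s * (x₁ + α))
      l₁ = solve 2 (λ y z → y := z :+ (y :- z)) refl y₁ (s * (x₁ + α))

      y₁≈y₂ : y₁ ≈ y₂
      y₁≈y₂ = x-y≈0⇒x≈y _ _ (cancel₀ (#⇒invertible y₁#-y₂) (trans
        (solve 2 (λ y z → (y :- z) :* (y :- :- z) := y :* y :- z :* z) refl y₁ y₂)
        (x≈y⇒x-y≈0 (trans e₁ (trans (*-cong (*-cong (+-congʳ x₁≈x₂) (+-congʳ x₁≈x₂)) (+-congʳ x₁≈x₂))
          (sym e₂))))))

      slope : s * (y₁ + y₁) ≈ (x₁ + α) * (x₁ + α - A) + (x₁ + α) * (x₁ + α - B)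
                              + (x₁ + α - A) * (x₁ + α - B)
      slope = trans (*-congˡ (trans (+-congˡ y₁≈y₂) (solve 2 (λ y z → y :+ z := y :- :- z) refl y₁ y₂)))
        (trans (quotient-* (EC.cubic′ E x₁) (#⇒invertible y₁#-y₂))
          (solve 4 (λ x a b c → (x :+ a) :* (x :+ b) :+ (x :+ a) :* (x :+ c) :+ (x :+ b) :* (x :+ c)
            := (x :+ a) :* (x :+ a :- (a :- b)) :+ (x :+ a) :* (x :+ a :- (a :- c))
               :+ (x :+ a :- (a :- b)) :* (x :+ a :- (a :- c))) refl x₁ α β γ))
    -- The points are opposite: u₁ = - u₂, v₁ = v₂, w₁ = w₂, and the laws for v and w become the two
    -- conics.
    ...   | no ¬y₁#-y₂ = addition
      (trans (zeroˡ _) (sym (trans (+-cong (*-cong (*-cong u₁≈ refl) refl)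
          (*-cong (*-congˡ v₁≈) w₁≈))
        (solve 3 (λ u v w → :- u :* v :* w :+ u :* v :* w := con (+ 0)) refl u₂ v₂ w₂))))
      (trans (*-congʳ v₁≈) (vertical (v-conic Q)))
      (trans (*-congʳ w₁≈) (vertical (w-conic Q)))
      where
      u₂ = uₚ Q
      v₂ = vₚ Q
      w₂ = wₚ Q
      X≈ : x₁ + α ≈ x₂ + α
      X≈ = +-congʳ (¬#⇒≈ ¬x₁#x₂)
      module C₁ = Coordinates (coords x₁ y₁)
      module C₂ = Coordinates (coords x₂ y₂)

      u₁≈ : uₚ P ≈ - u₂
      u₁≈ = ratio-unique X≈
        (trans (+-cong (¬#⇒≈ ¬y₁#-y₂) (¬#⇒≈ ¬y₁#-y₂)) (solve 1 (λ y → :- y :+ :- y := :- (y :+ y)) refl y₂))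
        C₁.uN (trans (solve 2 (λ u n → :- u :* n := :- (u :* n)) refl u₂ (N q (x₂ + α))) (-‿cong C₂.uN))

      v₁≈ : vₚ P ≈ v₂
      v₁≈ = ratio-unique X≈ (M-cong A X≈) C₁.vN C₂.vN

      w₁≈ : wₚ P ≈ w₂
      w₁≈ = ratio-unique X≈ (M-cong B X≈) C₁.wN C₂.wN

      vertical : ∀ {a v} → a * (u₂ * u₂) + v * v ≈ 1# → v * v ≈ 1# + a * (uₚ P * u₂) * 1#
      vertical {a} {v} e = trans
        (solve 3 (λ a u v → v :* v := (a :* (u :* u) :+ v :* v) :+ a :* (:- u :* u)) refl a u₂ v)
        (+-cong e (trans (*-congˡ (*-congʳ (sym u₁≈))) (sym (*-identityʳ _))))

module ℤ-Solver = IntegerRingSolver ℤ.+-*-commutativeRing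
module ℚ-Solver = IntegerRingSolver ℚ.+-*-commutativeRing

-- Niven's theorem

-- Built directly in lowest terms, so that the numerator is i by computation.
ι : ℤ → ℚ
ι i = mkℚ i 0 (Coprimality.sym (Coprimality.1-coprimeTo ℤ.∣ i ∣))

ι-injective : ∀ {i j} → ι i ≡ ι j → i ≡ j
ι-injective = cong ↥_

ι-+ : ∀ i j → ι (i ℤ.+ j) ≡ ι i ℚ.+ ι j
ι-+ i j = ℚ.toℚᵘ-injective (ℚᵘ.≃-trans
  (ℚᵘ.*≡* (cong (ℤ._* + 1) (cong₂ ℤ._+_ (≡.sym (ℤ.*-identityʳ i)) (≡.sym (ℤ.*-identityʳ j)))))
  (ℚᵘ.≃-sym (ℚ.toℚᵘ-homo-+ (ι i) (ι j))))

ι-* : ∀ i j → ι (i ℤ.* j) ≡ ι i ℚ.* ι j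
ι-* i j = ℚ.toℚᵘ-injective (ℚᵘ.≃-sym (ℚ.toℚᵘ-homo-* (ι i) (ι j)))

ι-neg : ∀ i → ι (ℤ.- i) ≡ ℚ.- ι i
ι-neg (+ zero)   = ≡.refl
ι-neg (+ suc n)  = ≡.refl
ι-neg -[1+ n ]   = ≡.refl

↧*≡↥ : ∀ x → x ℚ.* ι (+ ↧ₙ x) ≡ ι (↥ x)
↧*≡↥ x@(mkℚ n d _) = ℚ.toℚᵘ-injective (ℚᵘ.≃-trans (ℚ.toℚᵘ-homo-* x (ι (+ suc d)))
  (ℚᵘ.*≡* (≡.trans (ℤ.*-identityʳ (n ℤ.* + suc d))
    (cong (λ e → n ℤ.* + e) (≡.sym (ℕ.*-identityʳ (suc d)))))))

abs-^ : ∀ i n → ℤ.∣ i ℤ.^ n ∣ ≡ ℤ.∣ i ∣ ℕ.^ n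
abs-^ i zero    = ≡.refl
abs-^ i (suc n) = ≡.trans (ℤ.abs-* i (i ℤ.^ n)) (cong (ℤ.∣ i ∣ ℕ.*_) (abs-^ i n))

square-abs : ∀ i → i ℤ.* i ≡ + (ℤ.∣ i ∣ ℕ.* ℤ.∣ i ∣)
square-abs (+ n)    = ≡.sym (ℤ.pos-* n n)
square-abs -[1+ n ] = ≡.refl

coprime∣^⇒≡1 : ∀ {m d} → Coprimality.Coprime m d → ∀ n → d ∣ m ℕ.^ n → d ≡ 1
coprime∣^⇒≡1 c zero    d∣1 = ∣1⇒≡1 d∣1
coprime∣^⇒≡1 c (suc n) d∣  =
  coprime∣^⇒≡1 c n (Coprimality.coprime-divisor (Coprimality.sym c) d∣)

-- Numerator and denominator are coprime, so a denominator that divides a power of the numerator is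
-- 1.
integral : ∀ x n j → (↥ x) ℤ.^ n ≡ + (↧ₙ x) ℤ.* j → x ≡ ι (↥ x)
integral x@(mkℚ p d c) n j e = lemma d c d≡0
  where
  d≡0 : suc d ≡ 1
  d≡0 = coprime∣^⇒≡1 (Coprimality.recompute c) n (divides ℤ.∣ j ∣ (≡.trans (≡.sym (abs-^ p n))
    (≡.trans (cong ℤ.∣_∣ e) (≡.trans (ℤ.abs-* (+ suc d) j) (ℕ.*-comm (suc d) ℤ.∣ j ∣)))))

  lemma : ∀ d .(c : Coprimality.Coprime ℤ.∣ p ∣ (suc d)) → suc d ≡ 1 → mkℚ p d c ≡ ι p
  lemma zero    c _  = ≡.refl
  lemma (suc d) c ()

squares-sum-to-4 : ∀ m n → m ℕ.* m ℕ.+ n ℕ.* n ≡ 4 → m ≡ 0 ⊎ m ≡ 2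
squares-sum-to-4 0 n e = inj₁ ≡.refl
squares-sum-to-4 1 0 ()
squares-sum-to-4 1 1 ()
squares-sum-to-4 1 (suc (suc n)) e =
  contradiction (≡.trans (≡.sym e) (cong suc (solve 1 (λ n → (con 2 :+ n) :* (con 2 :+ n)
    := con 4 :+ (n :* n :+ con 4 :* n)) ≡.refl n))) λ ()
  where open +-*-Solver
squares-sum-to-4 2 n e = inj₂ ≡.refl
squares-sum-to-4 (suc (suc (suc m))) n e =
  contradiction (≡.trans (≡.sym e) (solve 2 (λ m n → (con 3 :+ m) :* (con 3 :+ m) :+ n :* n
    := con 5 :+ (con 4 :+ (m :* m :+ con 6 :* m :+ n :* n))) ≡.refl m n)) λ ()
  where open +-*-Solver

module Rotation (c s : ℚ) where

  -- The real and imaginary parts of (c + i s)ⁿ.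
  rotate : ℕ → ℚ × ℚ
  rotate zero    = 1ℚ , 0ℚ
  rotate (suc n) = let cₙ , sₙ = rotate n in
    c ℚ.* cₙ ℚ.- s ℚ.* sₙ , s ℚ.* cₙ ℚ.+ c ℚ.* sₙ

  cos sin : ℕ → ℚ
  cos n = proj₁ (rotate n)
  sin n = proj₂ (rotate n)

  module _ (on-circle : c ℚ.* c ℚ.+ s ℚ.* s ≡ 1ℚ) where

    open ≡-Reasoning

    -- Cayley-Hamilton for multiplication by c + i s, which has trace 2 c and norm 1.
    cos-recurrence : ∀ n → cos (suc (suc n)) ≡ (c ℚ.+ c) ℚ.* cos (suc n) ℚ.- cos n
    cos-recurrence n = begin
      cos (suc (suc n))
        ≡⟨ solve 4 (λ c s x y → c :* (c :* x :- s :* y) :- s :* (s :* x :+ c :* y)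
             := (c :+ c) :* (c :* x :- s :* y) :- (c :* c :+ s :* s) :* x)
             ≡.refl c s (cos n) (sin n) ⟩
      (c ℚ.+ c) ℚ.* cos (suc n) ℚ.- (c ℚ.* c ℚ.+ s ℚ.* s) ℚ.* cos n
        ≡⟨ cong (λ z → (c ℚ.+ c) ℚ.* cos (suc n) ℚ.- z)
             (≡.trans (cong (ℚ._* cos n) on-circle) (ℚ.*-identityˡ (cos n))) ⟩
      (c ℚ.+ c) ℚ.* cos (suc n) ℚ.- cos n ∎
      where open ℚ-Solver

    private
      p = ↥ (c ℚ.+ c)
      d = + ↧ₙ (c ℚ.+ c)

    -- With 2 c = p / d in lowest terms, 2 cos n · dⁿ is an integer congruent to pⁿ modulo d;
    -- if cos n = 1 then d divides pⁿ, so d = 1.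
    scaled : ℕ → ℤ
    scaled zero          = + 2
    scaled (suc zero)    = p
    scaled (suc (suc n)) = p ℤ.* scaled (suc n) ℤ.- d ℤ.* d ℤ.* scaled n

    scaled-cos : ∀ n → (cos n ℚ.+ cos n) ℚ.* ι (d ℤ.^ n) ≡ ι (scaled n)
    scaled-cos zero       = ≡.refl
    scaled-cos (suc zero) = begin
      (cos 1 ℚ.+ cos 1) ℚ.* ι (d ℤ.* + 1)
        ≡⟨ cong₂ ℚ._*_ (cong (λ z → z ℚ.+ z) cos-1) (cong ι (ℤ.*-identityʳ d)) ⟩
      (c ℚ.+ c) ℚ.* ι d ≡⟨ ↧*≡↥ (c ℚ.+ c) ⟩
      ι p ∎
      where
      cos-1 : cos 1 ≡ c
      cos-1 = ≡.trans (cong₂ (λ x y → x ℚ.- y) (ℚ.*-identityʳ c) (ℚ.*-zeroʳ s)) (ℚ.+-identityʳ c)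
    scaled-cos (suc (suc n)) = begin
      (cos (2 ℕ.+ n) ℚ.+ cos (2 ℕ.+ n)) ℚ.* ι (d ℤ.* (d ℤ.* d ℤ.^ n))
        ≡⟨ cong₂ (λ z w → (z ℚ.+ z) ℚ.* w) (cos-recurrence n)
             (≡.trans (ι-* d (d ℤ.* d ℤ.^ n)) (cong (ι d ℚ.*_) (ι-* d (d ℤ.^ n)))) ⟩
      (t ℚ.* c₁ ℚ.- c₀ ℚ.+ (t ℚ.* c₁ ℚ.- c₀)) ℚ.* (ι d ℚ.* (ι d ℚ.* D))
        ≡⟨ solve 5 (λ t c₁ c₀ d D → (t :* c₁ :- c₀ :+ (t :* c₁ :- c₀)) :* (d :* (d :* D))
             := (t :* d) :* ((c₁ :+ c₁) :* (d :* D)) :- d :* d :* ((c₀ :+ c₀) :* D))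
             ≡.refl t c₁ c₀ (ι d) D ⟩
      (t ℚ.* ι d) ℚ.* ((c₁ ℚ.+ c₁) ℚ.* (ι d ℚ.* D)) ℚ.- ι d ℚ.* ι d ℚ.* ((c₀ ℚ.+ c₀) ℚ.* D)
        ≡⟨ cong₂ (λ z w → z ℚ.- ι d ℚ.* ι d ℚ.* w)
             (cong₂ ℚ._*_ (↧*≡↥ t)
               (≡.trans (cong ((c₁ ℚ.+ c₁) ℚ.*_) (≡.sym (ι-* d (d ℤ.^ n)))) (scaled-cos (suc n))))
             (scaled-cos n) ⟩
      ι p ℚ.* ι (scaled (suc n)) ℚ.- ι d ℚ.* ι d ℚ.* ι (scaled n)
        ≡⟨ cong₂ (λ z w → z ℚ.- w) (ι-* p (scaled (suc n)))
             (≡.trans (ι-* (d ℤ.* d) (scaled n)) (cong (ℚ._* ι (scaled n)) (ι-* d d))) ⟨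
      ι (p ℤ.* scaled (suc n)) ℚ.- ι (d ℤ.* d ℤ.* scaled n)
        ≡⟨ cong (ι (p ℤ.* scaled (suc n)) ℚ.+_) (ι-neg (d ℤ.* d ℤ.* scaled n)) ⟨
      ι (p ℤ.* scaled (suc n)) ℚ.+ ι (ℤ.- (d ℤ.* d ℤ.* scaled n))
        ≡⟨ ι-+ (p ℤ.* scaled (suc n)) (ℤ.- (d ℤ.* d ℤ.* scaled n)) ⟨
      ι (scaled (suc (suc n))) ∎
      where
      open ℚ-Solver
      t  = c ℚ.+ c
      c₁ = cos (suc n)
      c₀ = cos n
      D  = ι (d ℤ.^ n)

    -- The congruence starts at exponent 1, because `scaled 0` is 2 and not p⁰.
    scaled-mod : ∀ n → ∃[ m ] scaled (suc n) ≡ p ℤ.^ suc n ℤ.+ d ℤ.* m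
    scaled-mod zero    = + 0 , solve 2 (λ p d → p := p :* con (+ 1) :+ d :* con (+ 0)) ≡.refl p d
      where open ℤ-Solver
    scaled-mod (suc n) with m , e ← scaled-mod n =
      p ℤ.* m ℤ.- d ℤ.* scaled n ,
      ≡.trans (cong (λ z → p ℤ.* z ℤ.- d ℤ.* d ℤ.* scaled n) e)
        (solve 5 (λ p P d m a → p :* (P :+ d :* m) :- d :* d :* a := p :* P :+ d :* (p :* m :- d :* a))
          ≡.refl p (p ℤ.^ suc n) d m (scaled n))
      where open ℤ-Solver

    twice-cos-integral : ∀ n → cos (suc n) ≡ 1ℚ → c ℚ.+ c ≡ ι p
    twice-cos-integral n e with m , f ← scaled-mod n =
      -- cos (n + 1) = 1 gives 2 dⁿ⁺¹ = `scaled (suc n)` = pⁿ⁺¹ + d m; the cofactor of d is read off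
      -- from this.
      integral (c ℚ.+ c) (suc n) (+ 2 ℤ.* d ℤ.^ n ℤ.- m) (begin
        p ℤ.^ suc n
          ≡⟨ solve 3 (λ P d m → P := (P :+ d :* m) :- d :* m) ≡.refl (p ℤ.^ suc n) d m ⟩
        p ℤ.^ suc n ℤ.+ d ℤ.* m ℤ.- d ℤ.* m
          ≡⟨ cong (ℤ._- d ℤ.* m) (≡.trans (≡.sym f) (≡.sym g)) ⟩
        + 2 ℤ.* (d ℤ.* d ℤ.^ n) ℤ.- d ℤ.* m
          ≡⟨ solve 3 (λ d D m → con (+ 2) :* (d :* D) :- d :* m := d :* (con (+ 2) :* D :- m))
               ≡.refl d (d ℤ.^ n) m ⟩
        d ℤ.* (+ 2 ℤ.* d ℤ.^ n ℤ.- m) ∎)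
      where
      open ℤ-Solver
      g : + 2 ℤ.* (d ℤ.* d ℤ.^ n) ≡ scaled (suc n)
      g = ι-injective (≡.trans (ι-* (+ 2) (d ℤ.^ suc n))
        (≡.trans (cong (λ z → (z ℚ.+ z) ℚ.* ι (d ℤ.^ suc n)) (≡.sym e)) (scaled-cos (suc n))))

    -- Integrality of 2 c alone would leave the value ± 1. But s is rational too, and (2 s)² is the
    -- integer 4 - (2 c)², so 2 s is an integer as well; then 2 c = ± 1 would make 3 a square.
    niven : ∀ n → cos (suc n) ≡ 1ℚ → c ≡ 0ℚ ⊎ c ℚ.* c ≡ 1ℚ
    niven n e = conclude (squares-sum-to-4 ℤ.∣ p ∣ ℤ.∣ r ∣ (ℤ.+-injective
      (≡.trans (cong₂ ℤ._+_ (≡.sym (square-abs p)) (≡.sym (square-abs r))) sum₄)))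
      where
      t = c ℚ.+ c
      r = ↥ (s ℚ.+ s)
      δ = + ↧ₙ (s ℚ.+ s)
      t≡ : t ≡ ι p
      t≡ = twice-cos-integral n e

      sum : t ℚ.* t ℚ.+ (s ℚ.+ s) ℚ.* (s ℚ.+ s) ≡ ι (+ 4)
      sum = ≡.trans (solve 2 (λ c s → (c :+ c) :* (c :+ c) :+ (s :+ s) :* (s :+ s)
        := (c :* c :+ s :* s) :+ (c :* c :+ s :* s) :+ ((c :* c :+ s :* s) :+ (c :* c :+ s :* s)))
        ≡.refl c s) (cong (λ z → z ℚ.+ z ℚ.+ (z ℚ.+ z)) on-circle)
        where open ℚ-Solver

      r² : r ℤ.^ 2 ≡ δ ℤ.* (δ ℤ.* (+ 4 ℤ.- p ℤ.* p))
      r² = ι-injective (begin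
        ι (r ℤ.* (r ℤ.* + 1)) ≡⟨ cong (λ z → ι (r ℤ.* z)) (ℤ.*-identityʳ r) ⟩
        ι (r ℤ.* r) ≡⟨ ι-* r r ⟩
        ι r ℚ.* ι r ≡⟨ cong₂ ℚ._*_ (↧*≡↥ (s ℚ.+ s)) (↧*≡↥ (s ℚ.+ s)) ⟨
        (s ℚ.+ s) ℚ.* ι δ ℚ.* ((s ℚ.+ s) ℚ.* ι δ)
          ≡⟨ solve 3 (λ x δ t → x :* δ :* (x :* δ) := δ :* (δ :* ((t :* t :+ x :* x) :+ :- (t :* t))))
               ≡.refl (s ℚ.+ s) (ι δ) t ⟩
        ι δ ℚ.* (ι δ ℚ.* ((t ℚ.* t ℚ.+ (s ℚ.+ s) ℚ.* (s ℚ.+ s)) ℚ.+ ℚ.- (t ℚ.* t)))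
          ≡⟨ cong₂ (λ z w → ι δ ℚ.* (ι δ ℚ.* (z ℚ.+ ℚ.- w))) sum
               (≡.trans (cong₂ ℚ._*_ t≡ t≡) (≡.sym (ι-* p p))) ⟩
        ι δ ℚ.* (ι δ ℚ.* (ι (+ 4) ℚ.+ ℚ.- ι (p ℤ.* p)))
          ≡⟨ cong (λ z → ι δ ℚ.* (ι δ ℚ.* z))
               (≡.trans (ι-+ (+ 4) (ℤ.- (p ℤ.* p))) (cong (ι (+ 4) ℚ.+_) (ι-neg (p ℤ.* p)))) ⟨
        ι δ ℚ.* (ι δ ℚ.* ι (+ 4 ℤ.- p ℤ.* p))
          ≡⟨ ≡.trans (ι-* δ (δ ℤ.* (+ 4 ℤ.- p ℤ.* p))) (cong (ι δ ℚ.*_) (ι-* δ (+ 4 ℤ.- p ℤ.* p))) ⟨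
        ι (δ ℤ.* (δ ℤ.* (+ 4 ℤ.- p ℤ.* p))) ∎)
        where open ℚ-Solver

      2s≡ : s ℚ.+ s ≡ ι r
      2s≡ = integral (s ℚ.+ s) 2 _ r²

      sum₄ : p ℤ.* p ℤ.+ r ℤ.* r ≡ + 4
      sum₄ = ι-injective (begin
        ι (p ℤ.* p ℤ.+ r ℤ.* r) ≡⟨ ≡.trans (ι-+ (p ℤ.* p) (r ℤ.* r)) (cong₂ ℚ._+_ (ι-* p p) (ι-* r r)) ⟩
        ι p ℚ.* ι p ℚ.+ ι r ℚ.* ι r ≡⟨ cong₂ (λ x y → x ℚ.* x ℚ.+ y ℚ.* y) t≡ 2s≡ ⟨
        t ℚ.* t ℚ.+ (s ℚ.+ s) ℚ.* (s ℚ.+ s) ≡⟨ sum ⟩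
        ι (+ 4) ∎)

      half : ∀ z → t ≡ z ℚ.+ z → c ≡ z
      half z e = begin
        c                   ≡⟨ ℚ.*-identityʳ c ⟨
        c ℚ.* (ℚ.½ ℚ.+ ℚ.½) ≡⟨ solve 2 (λ c h → c :* (h :+ h) := (c :+ c) :* h) ≡.refl c ℚ.½ ⟩
        t ℚ.* ℚ.½           ≡⟨ cong (ℚ._* ℚ.½) e ⟩
        (z ℚ.+ z) ℚ.* ℚ.½   ≡⟨ solve 2 (λ c h → c :* (h :+ h) := (c :+ c) :* h) ≡.refl z ℚ.½ ⟨
        z ℚ.* (ℚ.½ ℚ.+ ℚ.½) ≡⟨ ℚ.*-identityʳ z ⟩
        z                   ∎
        where open ℚ-Solver

      from-± : ∀ i → ℤ.∣ i ∣ ≡ 2 → ι i ≡ 1ℚ ℚ.+ 1ℚ ⊎ ι i ≡ ℚ.- 1ℚ ℚ.+ ℚ.- 1ℚ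
      from-± (+ .2)    ≡.refl = inj₁ ≡.refl
      from-± -[1+ .1 ] ≡.refl = inj₂ ≡.refl

      conclude : ℤ.∣ p ∣ ≡ 0 ⊎ ℤ.∣ p ∣ ≡ 2 → c ≡ 0ℚ ⊎ c ℚ.* c ≡ 1ℚ
      conclude (inj₁ e₀) = inj₁ (half 0ℚ (≡.trans t≡ (cong ι (ℤ.∣i∣≡0⇒i≡0 e₀))))
      conclude (inj₂ e₂) with from-± p e₂
      ... | inj₁ f = inj₂ (cong (λ z → z ℚ.* z) (half 1ℚ (≡.trans t≡ f)))
      ... | inj₂ f = inj₂ (cong (λ z → z ℚ.* z) (half (ℚ.- 1ℚ) (≡.trans t≡ f)))

-- Signs of squares in ℚ

-- Nonnegativity is encoded as z ≡ ∣ z ∣, a form that passes to products because absolute values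
-- multiply.
square≡∣square∣ : ∀ x → x ℚ.* x ≡ ℚ.∣ x ℚ.* x ∣
square≡∣square∣ x with ℚ.∣p∣≡p∨∣p∣≡-p x
... | inj₁ e = ≡.sym (≡.trans (ℚ.∣p*q∣≡∣p∣*∣q∣ x x) (cong₂ ℚ._*_ e e))
... | inj₂ e = ≡.sym (≡.trans (ℚ.∣p*q∣≡∣p∣*∣q∣ x x) (≡.trans (cong₂ ℚ._*_ e e)
      (solve 1 (λ x → :- x :* :- x := x :* x) ≡.refl x)))
  where open ℚ-Solver

nonzero-cancel : ∀ x y → x ≢ 0ℚ → x ℚ.* y ≡ 0ℚ → y ≡ 0ℚ
nonzero-cancel x y x≢0 e = begin
  y                        ≡⟨ ℚ.*-identityˡ y ⟨
  1ℚ ℚ.* y                 ≡⟨ cong (ℚ._* y) (ℚ.*-inverseˡ x) ⟨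
  ((ℚ.1/ x) ℚ.* x) ℚ.* y   ≡⟨ ℚ.*-assoc (ℚ.1/ x) x y ⟩
  (ℚ.1/ x) ℚ.* (x ℚ.* y)   ≡⟨ cong ((ℚ.1/ x) ℚ.*_) e ⟩
  (ℚ.1/ x) ℚ.* 0ℚ          ≡⟨ ℚ.*-zeroʳ (ℚ.1/ x) ⟩
  0ℚ                       ∎
  where
  open ≡-Reasoning
  instance _ = ℚ.≢-nonZero x≢0

square≡0⇒≡0 : ∀ x → x ℚ.* x ≡ 0ℚ → x ≡ 0ℚ
square≡0⇒≡0 x e with x ℚ.≟ 0ℚ
... | yes x≡0 = x≡0
... | no  x≢0 = nonzero-cancel x x x≢0 e

-- Both z and the square - z equal their absolute values, so they agree, and halving gives 0.
negated-square : ∀ x z → z ≡ ℚ.∣ z ∣ → x ℚ.* x ≡ ℚ.- z → z ≡ 0ℚ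
negated-square x z z≡∣z∣ x²≡-z = begin
  z                       ≡⟨ ℚ.*-identityʳ z ⟨
  z ℚ.* (ℚ.½ ℚ.+ ℚ.½)     ≡⟨ solve 2 (λ z h → z :* (h :+ h) := (z :- :- z) :* h) ≡.refl z ℚ.½ ⟩
  (z ℚ.- (ℚ.- z)) ℚ.* ℚ.½ ≡⟨ cong (λ y → (z ℚ.- y) ℚ.* ℚ.½) -z≡z ⟩
  (z ℚ.- z) ℚ.* ℚ.½       ≡⟨ cong (ℚ._* ℚ.½) (ℚ.+-inverseʳ z) ⟩
  0ℚ                      ∎
  where
  open ≡-Reasoning
  open ℚ-Solver
  -z≡z : ℚ.- z ≡ z
  -z≡z = begin
    ℚ.- z           ≡⟨ x²≡-z ⟨
    x ℚ.* x         ≡⟨ square≡∣square∣ x ⟩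
    ℚ.∣ x ℚ.* x ∣   ≡⟨ cong ℚ.∣_∣ x²≡-z ⟩
    ℚ.∣ ℚ.- z ∣     ≡⟨ ℚ.∣-p∣≡∣p∣ z ⟩
    ℚ.∣ z ∣         ≡⟨ z≡∣z∣ ⟨
    z               ∎

ι-suc : ∀ n → ι (+ suc n) ≡ 1ℚ ℚ.+ ι (+ n)
ι-suc n = ι-+ (+ 1) (+ n)

-- Places with residue field ℚ

-- x ↝ r says that x is integral at the place, with residue r.
record RationalPlace {c ℓ} (R : CommutativeRing c ℓ) (p : Level) : Set (c ⊔ ℓ ⊔ lsuc p) where
  open CommutativeRing R
  infix 4 _↝_
  field
    _↝_      : Carrier → ℚ → Set p
    ↝-resp   : ∀ {x y r} → x ≈ y → x ↝ r → y ↝ r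
    ↝-+      : ∀ {x y r s} → x ↝ r → y ↝ s → x + y ↝ r ℚ.+ s
    ↝-*      : ∀ {x y r s} → x ↝ r → y ↝ s → x * y ↝ r ℚ.* s
    ↝-neg    : ∀ {x r} → x ↝ r → - x ↝ ℚ.- r
    1↝1      : 1# ↝ 1ℚ
    ↝-unique : ∀ {x r s} → x ↝ r → x ↝ s → r ≡ s
    integral⊎inverse : ∀ x → (∃[ r ] x ↝ r) ⊎ (∃[ y ] y * x ≈ 1# × y ↝ 0ℚ)

  0↝0 : 0# ↝ 0ℚ
  0↝0 = ↝-resp (-‿inverseʳ 1#) (↝-+ 1↝1 (↝-neg 1↝1))

  1≢0 : 1ℚ ≢ 0ℚ
  1≢0 ()

  -- Valuation rings are integrally closed: if x had a pole with inverse y, then 1 = y² x² would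
  -- have residue 0.
  sqrt-integral : ∀ {x r} → x * x ↝ r → ∃[ s ] x ↝ s × s ℚ.* s ≡ r
  sqrt-integral {x} {r} x² with integral⊎inverse x
  ... | inj₁ (s , x↝s) = s , x↝s , ↝-unique (↝-* x↝s x↝s) x²
  ... | inj₂ (y , yx≈1 , y↝0) = contradiction (↝-unique (↝-resp e (↝-* (↝-* y↝0 y↝0) x²)) 1↝1)
        λ e → 1≢0 (≡.trans (≡.sym e) (ℚ.*-zeroˡ r))
    where
    open IntegerRingSolver R
    e : y * y * (x * x) ≈ 1#
    e = trans (solve 2 (λ x y → y :* y :* (x :* x) := (y :* x) :* (y :* x)) refl x y)
          (trans (*-cong yx≈1 yx≈1) (*-identityˡ 1#))

  -- The valuation of ϖ y is odd. A square root x would have residue 0, hence be ϖ z, and y = ϖ z²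
  -- would have residue 0 too.
  uniformizer*unit-nonsquare : ∀ {ϖ y r} → ϖ ↝ 0ℚ → (∀ {x z} → ϖ * x ≈ ϖ * z → x ≈ z) →
    (∀ x → x ↝ 0ℚ → ∃[ z ] ∃[ s ] x ≈ ϖ * z × z ↝ s) → y ↝ r → r ≢ 0ℚ → ∀ x → ¬ x * x ≈ ϖ * y
  uniformizer*unit-nonsquare {ϖ} {y} {r} ϖ↝0 cancel divide y↝r r≢0 x x²≈ϖy =
    let s , x↝s , s² = sqrt-integral (↝-resp (sym x²≈ϖy) (↝-* ϖ↝0 y↝r))
        z , t , x≈ϖz , z↝t = divide x (≡.subst (x ↝_) (square≡0⇒≡0 s (≡.trans s² (ℚ.*-zeroˡ r))) x↝s)
        ϖz²≈y = cancel (trans (solve 2 (λ ϖ z → ϖ :* (ϖ :* (z :* z)) := (ϖ :* z) :* (ϖ :* z)) refl ϖ z)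
                  (trans (sym (*-cong x≈ϖz x≈ϖz)) x²≈ϖy))
    in r≢0 (≡.trans (↝-unique y↝r (↝-resp ϖz²≈y (↝-* ϖ↝0 (↝-* z↝t z↝t)))) (ℚ.*-zeroˡ (t ℚ.* t)))
    where open IntegerRingSolver R

  unit-inverse : ∀ {x y} → x * y ≈ 1# → x ↝ 1ℚ → y ↝ 1ℚ
  unit-inverse {x} {y} xy≈1 x↝1 with integral⊎inverse y
  ... | inj₁ (s , y↝s) = ≡.subst (y ↝_)
        (≡.trans (≡.sym (ℚ.*-identityˡ s)) (↝-unique (↝-resp xy≈1 (↝-* x↝1 y↝s)) 1↝1)) y↝s
  ... | inj₂ (z , zy≈1 , z↝0) = contradiction (↝-unique x↝1 (↝-resp z≈x z↝0)) 1≢0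
    where
    z≈x : z ≈ x
    z≈x = trans (sym (*-identityʳ z)) (trans (*-congˡ (sym xy≈1))
      (trans (*-congˡ (*-comm x y)) (trans (sym (*-assoc z y x)) (trans (*-congʳ zy≈1) (*-identityˡ x)))))

-- Torsion points at a place where A vanishes and B is a nonzero square

module TorsionBound
  {c ℓ₁ ℓ₂ p} (K : HeytingField c ℓ₁ ℓ₂) (_#?_ : Decidable (HeytingField._#_ K))
  (E : EllipticCurve.Curve K _#?_)
  (nonsquare : ∀ x → HeytingField._#_ K (HeytingField._*_ K x x) (JacobiCoordinates.q K _#?_ E))
  (𝔭 : RationalPlace (JacobiCoordinates.commutativeRing K _#?_ E) p)
  (e : ℚ) (e≢0 : e ≢ 0ℚ)
  where

  open HeytingField K
  open JacobiCoordinates K _#?_ E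
  open JacobiIdentities commutativeRing
  open Nonsquare nonsquare
  open RationalPlace 𝔭
  private
    module F = IntegerRingSolver commutativeRing
    module Q = ℚ-Solver

  open RawMonoidDefinitions (RawGroup.rawMonoid (EC.pointGroup E)) using () renaming (_×_ to _·_)

  infixl 6 _⊕_
  _⊕_ : EC.Point E → EC.Point E → EC.Point E
  _⊕_ = EC._⊕_ E

  record Residues (P : EC.Point E) : Set p where
    field
      {û v̂ ŵ} : ℚ
      u↝ : uₚ P ↝ û
      v↝ : vₚ P ↝ v̂
      w↝ : wₚ P ↝ ŵ
      v̂² : v̂ ℚ.* v̂ ≡ 1ℚ
      circle : e ℚ.* e ℚ.* (û ℚ.* û) ℚ.+ ŵ ℚ.* ŵ ≡ 1ℚ

  module _ (A↝0 : A ↝ 0ℚ) (B↝e² : B ↝ e ℚ.* e) where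

    -- At a pole of u the equation B u² + w² = 1 would make -e² a square.
    u-integral : ∀ P → ∃[ r ] uₚ P ↝ r
    u-integral P with integral⊎inverse (uₚ P)
    ... | inj₁ r = r
    ... | inj₂ (y , yu≈1 , y↝0) = contradiction (square≡0⇒≡0 e e²≡0) e≢0
      where
      u = uₚ P
      w = wₚ P
      -- The conic of w divided by u², with y = 1 / u.
      wy² : y * y + - B ≈ (w * y) * (w * y)
      wy² = trans
        (+-cong (trans (sym (*-identityˡ _)) (*-congʳ (sym (w-conic P))))
          (-‿cong (trans (sym (*-identityʳ B))
            (*-congˡ (trans (sym (*-identityˡ 1#)) (sym (*-cong yu≈1 yu≈1)))))))
        (F.solve 4 (λ b u w y → let open F in
          (b :* (u :* u) :+ w :* w) :* (y :* y) :+ :- (b :* ((y :* u) :* (y :* u)))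
          := (w :* y) :* (w :* y)) refl B u w y)
      r : ∃[ s ] w * y ↝ s × s ℚ.* s ≡ 0ℚ ℚ.* 0ℚ ℚ.+ ℚ.- (e ℚ.* e)
      r = sqrt-integral (↝-resp wy² (↝-+ (↝-* y↝0 y↝0) (↝-neg B↝e²)))
      e²≡0 : e ℚ.* e ≡ 0ℚ
      e²≡0 = negated-square (proj₁ r) (e ℚ.* e) (square≡∣square∣ e)
        (≡.trans (proj₂ (proj₂ r)) (ℚ.+-identityˡ (ℚ.- (e ℚ.* e))))

    -- v² = 1 - a u² is integral as soon as a and u are.
    conic-residue : ∀ {a u v â û} → a * (u * u) + v * v ≈ 1# → a ↝ â → u ↝ û →
      ∃[ v̂ ] v ↝ v̂ × â ℚ.* (û ℚ.* û) ℚ.+ v̂ ℚ.* v̂ ≡ 1ℚ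
    conic-residue {a} {u} {v} {â} {û} e a↝ u↝ =
      let v̂ , v↝ , v̂² = sqrt-integral (↝-resp v² (↝-+ 1↝1 (↝-neg (↝-* a↝ (↝-* u↝ u↝))))) in
      v̂ , v↝ , ≡.trans (cong (â ℚ.* (û ℚ.* û) ℚ.+_) v̂²)
        (Q.solve 2 (λ x o → x Q.:+ (o Q.:- x) Q.:= o) ≡.refl (â ℚ.* (û ℚ.* û)) 1ℚ)
      where
      v² : 1# + - (a * (u * u)) ≈ v * v
      v² = trans (+-congʳ (sym e))
        (F.solve 2 (λ x y → let open F in x :+ y :+ :- x := y) refl (a * (u * u)) (v * v))

    residues : ∀ P → Residues P
    residues P =
      let û , u↝ = u-integral P
          v̂ , v↝ , f = conic-residue (v-conic P) A↝0 u↝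
          ŵ , w↝ , g = conic-residue (w-conic P) B↝e² u↝
      in record
        { u↝ = u↝ ; v↝ = v↝ ; w↝ = w↝ ; circle = g
        ; v̂² = ≡.trans (≡.sym (≡.trans (cong (ℚ._+ v̂ ℚ.* v̂) (ℚ.*-zeroˡ (û ℚ.* û)))
                 (ℚ.+-identityˡ (v̂ ℚ.* v̂)))) f }

    module _ {P Q : EC.Point E} (rP : Residues P) (rQ : Residues Q) where

      private
        module P = Residues rP
        module Q′ = Residues rQ
      open Addition (⊕-addition P Q)

      D : Carrier
      D = wₚ Q * wₚ Q + B * (uₚ Q * uₚ Q) * (vₚ P * vₚ P)

      -- Since the residue of v P squares to 1, D reduces to the left side of the circle equation of
      -- Q. Hence the formula for u never degenerates at the place.
      D↝1 : D ↝ 1ℚ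
      D↝1 = ≡.subst (D ↝_)
        (≡.trans (cong (λ z → Q′.ŵ ℚ.* Q′.ŵ ℚ.+ e ℚ.* e ℚ.* (Q′.û ℚ.* Q′.û) ℚ.* z) P.v̂²)
          (≡.trans (cong (Q′.ŵ ℚ.* Q′.ŵ ℚ.+_) (ℚ.*-identityʳ (e ℚ.* e ℚ.* (Q′.û ℚ.* Q′.û))))
            (≡.trans (ℚ.+-comm (Q′.ŵ ℚ.* Q′.ŵ) (e ℚ.* e ℚ.* (Q′.û ℚ.* Q′.û))) Q′.circle)))
        (↝-+ (↝-* Q′.w↝ Q′.w↝) (↝-* (↝-* B↝e² (↝-* Q′.u↝ Q′.u↝)) (↝-* P.v↝ P.v↝)))

      D⁻¹ : ∃[ d ] D * d ≈ 1# × d ↝ 1ℚ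
      D⁻¹ with D #? 0#
      ... | yes D#0 = let d , _ , Dd≈1 = #0⇒invertible D#0 in d , Dd≈1 , unit-inverse Dd≈1 D↝1
      ... | no ¬D#0 = contradiction (↝-unique D↝1 (↝-resp (sym (¬#⇒≈ ¬D#0)) 0↝0)) 1≢0

      u-sum : uₚ (P ⊕ Q) ≈ (uₚ P * vₚ Q * wₚ Q + uₚ Q * vₚ P * wₚ P) * proj₁ D⁻¹
      u-sum with d , Dd≈1 , _ ← D⁻¹ = trans (sym (*-identityʳ _)) (trans (*-congˡ (sym Dd≈1))
        (trans (sym (*-assoc _ D d)) (*-congʳ u-law)))

      module _ (rR : Residues (P ⊕ Q)) where

        private module R = Residues rR

        v̂-law : R.v̂ ≡ P.v̂ ℚ.* Q′.v̂
        v̂-law = ≡.sym (≡.trans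
          (↝-unique (↝-* P.v↝ Q′.v↝)
            (↝-resp (sym v-law) (↝-+ R.v↝ (↝-* (↝-* A↝0 (↝-* P.u↝ Q′.u↝)) R.w↝))))
          (≡.trans (cong (R.v̂ ℚ.+_) (≡.trans (cong (ℚ._* R.ŵ) (ℚ.*-zeroˡ (P.û ℚ.* Q′.û))) (ℚ.*-zeroˡ R.ŵ)))
            (ℚ.+-identityʳ R.v̂)))

        ŵ-law : R.ŵ ≡ P.ŵ ℚ.* Q′.ŵ ℚ.- e ℚ.* e ℚ.* (P.û ℚ.* Q′.û) ℚ.* (P.v̂ ℚ.* Q′.v̂)
        ŵ-law = ≡.trans
          (Q.solve 2 (λ x y → x Q.:= (x Q.:+ y) Q.:- y) ≡.refl R.ŵ (e ℚ.* e ℚ.* (P.û ℚ.* Q′.û) ℚ.* R.v̂))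
          (cong₂ (λ x y → x ℚ.- e ℚ.* e ℚ.* (P.û ℚ.* Q′.û) ℚ.* y)
            (↝-unique (↝-resp (sym w-law) (↝-+ R.w↝ (↝-* (↝-* B↝e² (↝-* P.u↝ Q′.u↝)) R.v↝))) (↝-* P.w↝ Q′.w↝))
            v̂-law)

        û-law : R.û ≡ P.û ℚ.* Q′.v̂ ℚ.* Q′.ŵ ℚ.+ Q′.û ℚ.* P.v̂ ℚ.* P.ŵ
        û-law = ≡.trans (↝-unique R.u↝ (↝-resp (sym u-sum)
            (↝-* (↝-+ (↝-* (↝-* P.u↝ Q′.v↝) Q′.w↝) (↝-* (↝-* Q′.u↝ P.v↝) P.w↝)) (proj₂ (proj₂ D⁻¹)))))
          (ℚ.*-identityʳ (P.û ℚ.* Q′.v̂ ℚ.* Q′.ŵ ℚ.+ Q′.û ℚ.* P.v̂ ℚ.* P.ŵ))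

    ≈O⇒u≈0 : ∀ {Q} → EC._≈ₚ_ E Q EC.O → uₚ Q ≈ 0#
    ≈O⇒u≈0 EC.O≈O = refl

    ≈O⇒v≈1 : ∀ {Q} → EC._≈ₚ_ E Q EC.O → vₚ Q ≈ 1#
    ≈O⇒v≈1 EC.O≈O = refl

    ≈O⇒w≈1 : ∀ {Q} → EC._≈ₚ_ E Q EC.O → wₚ Q ≈ 1#
    ≈O⇒w≈1 EC.O≈O = refl

    module Multiples (P : EC.Point E) where

      private
        module P = Residues (residues P)
        module _ (n : ℕ) where
          open Residues (residues (n · P)) public
            renaming (û to ûₙ; v̂ to v̂ₙ; ŵ to ŵₙ; u↝ to uₙ↝; v↝ to vₙ↝; w↝ to wₙ↝; v̂² to v̂ₙ²) using ()

        u = uₚ P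
        v = vₚ P
        w = wₚ P

        û₀ : ûₙ 0 ≡ 0ℚ
        û₀ = ↝-unique (uₙ↝ 0) 0↝0

        v̂₀ : v̂ₙ 0 ≡ 1ℚ
        v̂₀ = ↝-unique (vₙ↝ 0) 1↝1

        ŵ₀ : ŵₙ 0 ≡ 1ℚ
        ŵ₀ = ↝-unique (wₙ↝ 0) 1↝1

        v̂-suc : ∀ n → v̂ₙ (suc n) ≡ P.v̂ ℚ.* v̂ₙ n
        v̂-suc n = v̂-law (residues P) (residues (n · P)) (residues (suc n · P))

        ŵ-suc : ∀ n → ŵₙ (suc n) ≡ P.ŵ ℚ.* ŵₙ n ℚ.- e ℚ.* e ℚ.* (P.û ℚ.* ûₙ n) ℚ.* (P.v̂ ℚ.* v̂ₙ n)
        ŵ-suc n = ŵ-law (residues P) (residues (n · P)) (residues (suc n · P))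

        û-suc : ∀ n → ûₙ (suc n) ≡ P.û ℚ.* v̂ₙ n ℚ.* ŵₙ n ℚ.+ ûₙ n ℚ.* P.v̂ ℚ.* P.ŵ
        û-suc n = û-law (residues P) (residues (n · P)) (residues (suc n · P))

        d⁻¹ : ∀ n → Carrier
        d⁻¹ n = proj₁ (D⁻¹ (residues P) (residues (n · P)))

        d⁻¹↝1 : ∀ n → d⁻¹ n ↝ 1ℚ
        d⁻¹↝1 n = proj₂ (proj₂ (D⁻¹ (residues P) (residues (n · P))))

        u-suc : ∀ n → uₚ (suc n · P) ≈ (u * vₚ (n · P) * wₚ (n · P) + uₚ (n · P) * v * w) * d⁻¹ n
        u-suc n = u-sum (residues P) (residues (n · P))

      -- The circle coordinate e û, twisted by the sign v̂. The twist absorbs the factors v̂ of the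
      -- addition law for û and leaves a plain rotation by (ŵ, sₚ).
      sₚ : ℚ
      sₚ = e ℚ.* (P.û ℚ.* P.v̂)

      open Rotation P.ŵ sₚ

      on-circle : P.ŵ ℚ.* P.ŵ ℚ.+ sₚ ℚ.* sₚ ≡ 1ℚ
      on-circle = begin
        P.ŵ ℚ.* P.ŵ ℚ.+ sₚ ℚ.* sₚ
          ≡⟨ Q.solve 4 (λ w e u v → let open Q in w :* w :+ e :* (u :* v) :* (e :* (u :* v))
               := e :* e :* (u :* u) :* (v :* v) :+ w :* w) ≡.refl P.ŵ e P.û P.v̂ ⟩
        e ℚ.* e ℚ.* (P.û ℚ.* P.û) ℚ.* (P.v̂ ℚ.* P.v̂) ℚ.+ P.ŵ ℚ.* P.ŵ
          ≡⟨ cong (λ z → e ℚ.* e ℚ.* (P.û ℚ.* P.û) ℚ.* z ℚ.+ P.ŵ ℚ.* P.ŵ) P.v̂² ⟩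
        e ℚ.* e ℚ.* (P.û ℚ.* P.û) ℚ.* 1ℚ ℚ.+ P.ŵ ℚ.* P.ŵ
          ≡⟨ cong (ℚ._+ P.ŵ ℚ.* P.ŵ) (ℚ.*-identityʳ (e ℚ.* e ℚ.* (P.û ℚ.* P.û))) ⟩
        e ℚ.* e ℚ.* (P.û ℚ.* P.û) ℚ.+ P.ŵ ℚ.* P.ŵ ≡⟨ P.circle ⟩
        1ℚ ∎
        where open ≡-Reasoning

      residue-rotation : ∀ n → ŵₙ n ≡ cos n × e ℚ.* (ûₙ n ℚ.* v̂ₙ n) ≡ sin n
      residue-rotation zero    = ŵ₀ ,
        ≡.trans (cong (λ z → e ℚ.* (z ℚ.* v̂ₙ 0)) û₀)
          (≡.trans (cong (e ℚ.*_) (ℚ.*-zeroˡ (v̂ₙ 0))) (ℚ.*-zeroʳ e))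
      residue-rotation (suc n) =
        let ŵ≡ , û≡ = residue-rotation n in
        (begin
          ŵₙ (suc n) ≡⟨ ŵ-suc n ⟩
          P.ŵ ℚ.* ŵₙ n ℚ.- e ℚ.* e ℚ.* (P.û ℚ.* ûₙ n) ℚ.* (P.v̂ ℚ.* v̂ₙ n)
            ≡⟨ Q.solve 6 (λ x e u u′ v v′ → let open Q in
                 x :- e :* e :* (u :* u′) :* (v :* v′) := x :- e :* (u :* v) :* (e :* (u′ :* v′)))
                 ≡.refl (P.ŵ ℚ.* ŵₙ n) e P.û (ûₙ n) P.v̂ (v̂ₙ n) ⟩
          P.ŵ ℚ.* ŵₙ n ℚ.- sₚ ℚ.* (e ℚ.* (ûₙ n ℚ.* v̂ₙ n))
            ≡⟨ cong₂ (λ x y → P.ŵ ℚ.* x ℚ.- sₚ ℚ.* y) ŵ≡ û≡ ⟩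
          cos (suc n) ∎) ,
        (begin
          e ℚ.* (ûₙ (suc n) ℚ.* v̂ₙ (suc n)) ≡⟨ cong₂ (λ x y → e ℚ.* (x ℚ.* y)) (û-suc n) (v̂-suc n) ⟩
          e ℚ.* ((P.û ℚ.* v̂ₙ n ℚ.* ŵₙ n ℚ.+ ûₙ n ℚ.* P.v̂ ℚ.* P.ŵ) ℚ.* (P.v̂ ℚ.* v̂ₙ n))
            ≡⟨ Q.solve 7 (λ e u v w u′ v′ w′ → let open Q in
                 e :* ((u :* v′ :* w′ :+ u′ :* v :* w) :* (v :* v′))
                 := e :* (u :* v) :* w′ :* (v′ :* v′) :+ w :* (e :* (u′ :* v′)) :* (v :* v))
                 ≡.refl e P.û P.v̂ P.ŵ (ûₙ n) (v̂ₙ n) (ŵₙ n) ⟩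
          sₚ ℚ.* ŵₙ n ℚ.* (v̂ₙ n ℚ.* v̂ₙ n) ℚ.+ P.ŵ ℚ.* (e ℚ.* (ûₙ n ℚ.* v̂ₙ n)) ℚ.* (P.v̂ ℚ.* P.v̂)
            ≡⟨ cong₂ ℚ._+_
                 (≡.trans (cong (sₚ ℚ.* ŵₙ n ℚ.*_) (v̂ₙ² n)) (ℚ.*-identityʳ (sₚ ℚ.* ŵₙ n)))
                 (≡.trans (cong (P.ŵ ℚ.* (e ℚ.* (ûₙ n ℚ.* v̂ₙ n)) ℚ.*_) P.v̂²)
                   (ℚ.*-identityʳ (P.ŵ ℚ.* (e ℚ.* (ûₙ n ℚ.* v̂ₙ n))))) ⟩
          sₚ ℚ.* ŵₙ n ℚ.+ P.ŵ ℚ.* (e ℚ.* (ûₙ n ℚ.* v̂ₙ n))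
            ≡⟨ cong₂ (λ x y → sₚ ℚ.* x ℚ.+ P.ŵ ℚ.* y) ŵ≡ û≡ ⟩
          sin (suc n) ∎)
        where open ≡-Reasoning

      -- P reduces to a point of order at most 2, so n P differs from it or
      -- from the identity by n times a first-order displacement.
      module OrderTwo (û≡0 : P.û ≡ 0ℚ) where

        private
          τ : ℚ
          τ = P.v̂ ℚ.* P.ŵ

          τₙ : ℕ → ℚ
          τₙ n = v̂ₙ n ℚ.* ŵₙ n

          ŵ²≡1 : P.ŵ ℚ.* P.ŵ ≡ 1ℚ
          ŵ²≡1 = ≡.trans (Q.solve 2 (λ x e → let open Q in x := e :* e :* (con (+ 0) :* con (+ 0)) :+ x)
              ≡.refl (P.ŵ ℚ.* P.ŵ) e)
            (≡.trans (cong (λ z → e ℚ.* e ℚ.* (z ℚ.* z) ℚ.+ P.ŵ ℚ.* P.ŵ) (≡.sym û≡0)) P.circle)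

          τ²≡1 : τ ℚ.* τ ≡ 1ℚ
          τ²≡1 = ≡.trans (Q.solve 2 (λ v w → let open Q in v :* w :* (v :* w) := v :* v :* (w :* w))
            ≡.refl P.v̂ P.ŵ) (cong₂ ℚ._*_ P.v̂² ŵ²≡1)

          τ-suc : ∀ n → τₙ (suc n) ≡ τ ℚ.* τₙ n
          τ-suc n = ≡.trans
            (cong₂ ℚ._*_ (v̂-suc n) (≡.trans (ŵ-suc n)
              (cong (λ z → P.ŵ ℚ.* ŵₙ n ℚ.- e ℚ.* e ℚ.* (z ℚ.* ûₙ n) ℚ.* (P.v̂ ℚ.* v̂ₙ n)) û≡0)))
            (Q.solve 6 (λ v v′ w w′ e u′ → let open Q in
              v :* v′ :* (w :* w′ :- e :* e :* (con (+ 0) :* u′) :* (v :* v′)) := v :* w :* (v′ :* w′))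
              ≡.refl P.v̂ (v̂ₙ n) P.ŵ (ŵₙ n) e (ûₙ n))

        -- τₙ is τⁿ, so s has residue n times a sign. The natural exponent of that sign is n - 1; as
        -- τ² = 1, writing τ τₙ gives the same value and also makes sense at n = 0.
        multiple : ∀ n → ∃[ s ] uₚ (n · P) ≈ u * s × s ↝ ι (+ n) ℚ.* (τ ℚ.* τₙ n)
        multiple zero    = 0# , sym (zeroʳ u) ,
          ≡.subst (0# ↝_) (≡.sym (ℚ.*-zeroˡ (τ ℚ.* τₙ 0))) 0↝0
        multiple (suc n) =
          let s , uₙ≈ , s↝ = multiple n
              s′ = (vₚ (n · P) * wₚ (n · P) + s * v * w) * d⁻¹ n
          in s′ ,
          trans (u-suc n) (trans (*-congʳ (+-congˡ (*-congʳ (*-congʳ uₙ≈))))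
            (F.solve 7 (λ u v′ w′ s v w d → let open F in (u :* v′ :* w′ :+ u :* s :* v :* w) :* d
              := u :* ((v′ :* w′ :+ s :* v :* w) :* d)) refl u (vₚ (n · P)) (wₚ (n · P)) s v w (d⁻¹ n))) ,
          ≡.subst (s′ ↝_) (residue n)
            (↝-* (↝-+ (↝-* (vₙ↝ n) (wₙ↝ n)) (↝-* (↝-* s↝ P.v↝) P.w↝)) (d⁻¹↝1 n))
          where
          open ≡-Reasoning
          residue : ∀ n → (v̂ₙ n ℚ.* ŵₙ n ℚ.+ ι (+ n) ℚ.* (τ ℚ.* τₙ n) ℚ.* P.v̂ ℚ.* P.ŵ) ℚ.* 1ℚ
                    ≡ ι (+ suc n) ℚ.* (τ ℚ.* τₙ (suc n))
          residue n = begin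
            (τₙ n ℚ.+ ι (+ n) ℚ.* (τ ℚ.* τₙ n) ℚ.* P.v̂ ℚ.* P.ŵ) ℚ.* 1ℚ
              ≡⟨ Q.solve 5 (λ t n v w o → let open Q in
                   (t :+ n :* (v :* w :* t) :* v :* w) :* o := o :* t :+ n :* t :* (v :* w :* (v :* w)) :* o)
                   ≡.refl (τₙ n) (ι (+ n)) P.v̂ P.ŵ 1ℚ ⟩
            1ℚ ℚ.* τₙ n ℚ.+ ι (+ n) ℚ.* τₙ n ℚ.* (τ ℚ.* τ) ℚ.* 1ℚ
              ≡⟨ cong₂ (λ x y → x ℚ.* τₙ n ℚ.+ ι (+ n) ℚ.* τₙ n ℚ.* (τ ℚ.* τ) ℚ.* y) τ²≡1 ≡.refl ⟨
            (τ ℚ.* τ) ℚ.* τₙ n ℚ.+ ι (+ n) ℚ.* τₙ n ℚ.* (τ ℚ.* τ) ℚ.* 1ℚ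
              ≡⟨ Q.solve 4 (λ t t′ n o → let open Q in t :* t :* t′ :+ n :* t′ :* (t :* t) :* o
                   := (t :* (t :* t′)) :+ n :* (t :* (t :* t′)) :* o) ≡.refl τ (τₙ n) (ι (+ n)) 1ℚ ⟩
            τ ℚ.* (τ ℚ.* τₙ n) ℚ.+ ι (+ n) ℚ.* (τ ℚ.* (τ ℚ.* τₙ n)) ℚ.* 1ℚ
              ≡⟨ cong₂ ℚ._+_ (≡.sym (ℚ.*-identityˡ x)) (ℚ.*-identityʳ (ι (+ n) ℚ.* x)) ⟩
            1ℚ ℚ.* x ℚ.+ ι (+ n) ℚ.* x ≡⟨ ℚ.*-distribʳ-+ x 1ℚ (ι (+ n)) ⟨
            (1ℚ ℚ.+ ι (+ n)) ℚ.* x ≡⟨ cong₂ (λ y z → y ℚ.* (τ ℚ.* z)) (ι-suc n) (τ-suc n) ⟨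
            ι (+ suc n) ℚ.* (τ ℚ.* τₙ (suc n)) ∎
            where x = τ ℚ.* (τ ℚ.* τₙ n)

        -- u (n P) = u s holds in the field itself, and s is nonzero because its residue is; so u
        -- vanishes and not merely its residue.
        u≈0 : ∀ n → EC._≈ₚ_ E (suc n · P) EC.O → u ≈ 0#
        u≈0 n nP≈O = [ id , (λ s≈0 → contradiction (n≡0 (↝-unique (↝-resp s≈0 s↝) 0↝0)) λ ()) ]′
          (noZeroDivisors (trans (sym uₙ≈) (≈O⇒u≈0 nP≈O)))
          where
          open ≡-Reasoning
          s = proj₁ (multiple (suc n))
          uₙ≈ = proj₁ (proj₂ (multiple (suc n)))
          s↝ = proj₂ (proj₂ (multiple (suc n)))
          τₙ≡1 : τₙ (suc n) ≡ 1ℚ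
          τₙ≡1 = cong₂ ℚ._*_ (↝-unique (vₙ↝ (suc n)) (↝-resp (sym (≈O⇒v≈1 nP≈O)) 1↝1))
                             (↝-unique (wₙ↝ (suc n)) (↝-resp (sym (≈O⇒w≈1 nP≈O)) 1↝1))
          n≡0 : ι (+ suc n) ℚ.* (τ ℚ.* τₙ (suc n)) ≡ 0ℚ → + suc n ≡ + 0
          n≡0 e₀ = ι-injective (begin
            N′                             ≡⟨ ℚ.*-identityʳ N′ ⟨
            N′ ℚ.* 1ℚ                      ≡⟨ cong (N′ ℚ.*_) τ²≡1 ⟨
            N′ ℚ.* (τ ℚ.* τ)               ≡⟨ ℚ.*-assoc N′ τ τ ⟨
            N′ ℚ.* τ ℚ.* τ                 ≡⟨ cong (λ z → N′ ℚ.* z ℚ.* τ) (ℚ.*-identityʳ τ) ⟨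
            N′ ℚ.* (τ ℚ.* 1ℚ) ℚ.* τ        ≡⟨ cong (λ z → N′ ℚ.* (τ ℚ.* z) ℚ.* τ) τₙ≡1 ⟨
            N′ ℚ.* (τ ℚ.* τₙ (suc n)) ℚ.* τ ≡⟨ cong (ℚ._* τ) e₀ ⟩
            0ℚ ℚ.* τ                       ≡⟨ ℚ.*-zeroˡ τ ⟩
            0ℚ                             ∎)
            where N′ = ι (+ suc n)

      -- P reduces to a point of order 4; now w P plays the role of the displacement,
      -- and it occurs in u (n P) for even n and in w (n P) for odd n.
      module OrderFour (ŵ≡0 : P.ŵ ≡ 0ℚ) where

        private
          h = P.û
          ε = P.v̂

          e²h²≡1 : e ℚ.* e ℚ.* (h ℚ.* h) ≡ 1ℚ
          e²h²≡1 = ≡.trans (Q.solve 1 (λ x → let open Q in x := x :+ con (+ 0) :* con (+ 0))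
              ≡.refl (e ℚ.* e ℚ.* (h ℚ.* h)))
            (≡.trans (cong (λ z → e ℚ.* e ℚ.* (h ℚ.* h) ℚ.+ z ℚ.* z) (≡.sym ŵ≡0)) P.circle)

        -- ω is the sign (-1)^⌊n/2⌋: `even⇒odd` passes it on and `odd⇒even` changes it, as the
        -- residue of n P runs through a cyclic group of order 4 on the circle.
        record EvenMultiple (n : ℕ) : Set (c ⊔ ℓ₁ ⊔ p) where
          field
            s  : Carrier
            ω  : ℚ
            u≈ : uₚ (n · P) ≈ w * s
            s↝ : s ↝ ℚ.- (ι (+ n) ℚ.* (h ℚ.* (ε ℚ.* ω)))
            ŵ≡ : ŵₙ n ≡ ω
            v̂≡ : v̂ₙ n ≡ 1ℚ

        record OddMultiple (n : ℕ) : Set (c ⊔ ℓ₁ ⊔ p) where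
          field
            s  : Carrier
            ω  : ℚ
            w≈ : wₚ (n · P) ≈ w * s
            s↝ : s ↝ ι (+ n) ℚ.* ω
            û≡ : ûₙ n ≡ ω ℚ.* h
            v̂≡ : v̂ₙ n ≡ ε

        zero-even : EvenMultiple 0
        zero-even = record
          { s = 0# ; ω = 1ℚ ; u≈ = sym (zeroʳ w) ; ŵ≡ = ŵ₀ ; v̂≡ = v̂₀
          ; s↝ = ≡.subst (0# ↝_) (≡.sym (cong ℚ.-_ (ℚ.*-zeroˡ (h ℚ.* (ε ℚ.* 1ℚ))))) 0↝0 }

        even⇒odd : ∀ n → EvenMultiple n → OddMultiple (suc n)
        even⇒odd n even = record
          { s = s′ ; ω = ω
          ; w≈ = trans (F.solve 2 (λ x y → let open F in x := (x :+ y) :- y) refl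
                   (wₚ (suc n · P)) (B * (u * uₚ (n · P)) * vₚ (suc n · P)))
                 (trans (+-cong (sym w-law) (-‿cong (*-congʳ (*-congˡ (*-congˡ u≈)))))
                   (F.solve 6 (λ w w′ b u s v → let open F in w :* w′ :- b :* (u :* (w :* s)) :* v
                     := w :* (w′ :- b :* (u :* s) :* v)) refl w (wₚ (n · P)) B u s (vₚ (suc n · P))))
          ; s↝ = ≡.subst (s′ ↝_) residue
                   (↝-+ (wₙ↝ n) (↝-neg (↝-* (↝-* B↝e² (↝-* P.u↝ s↝)) (vₙ↝ (suc n)))))
          ; û≡ = begin
              ûₙ (suc n) ≡⟨ û-suc n ⟩
              h ℚ.* v̂ₙ n ℚ.* ŵₙ n ℚ.+ ûₙ n ℚ.* ε ℚ.* P.ŵ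
                ≡⟨ cong₂ ℚ._+_ (cong₂ (λ x y → h ℚ.* x ℚ.* y) v̂≡ ŵ≡) (cong (ûₙ n ℚ.* ε ℚ.*_) ŵ≡0) ⟩
              h ℚ.* 1ℚ ℚ.* ω ℚ.+ ûₙ n ℚ.* ε ℚ.* 0ℚ
                ≡⟨ cong₂ (λ x y → x ℚ.* ω ℚ.+ y) (ℚ.*-identityʳ h) (ℚ.*-zeroʳ (ûₙ n ℚ.* ε)) ⟩
              h ℚ.* ω ℚ.+ 0ℚ ≡⟨ ≡.trans (ℚ.+-identityʳ (h ℚ.* ω)) (ℚ.*-comm h ω) ⟩
              ω ℚ.* h ∎
          ; v̂≡ = v̂′ }
          where
          open ≡-Reasoning
          open EvenMultiple even
          open Addition (⊕-addition P (n · P))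
          s′ = wₚ (n · P) - B * (u * s) * vₚ (suc n · P)

          v̂′ : v̂ₙ (suc n) ≡ ε
          v̂′ = ≡.trans (v̂-suc n) (≡.trans (cong (ε ℚ.*_) v̂≡) (ℚ.*-identityʳ ε))

          residue : ŵₙ n ℚ.+ ℚ.- (e ℚ.* e ℚ.* (h ℚ.* ℚ.- (ι (+ n) ℚ.* (h ℚ.* (ε ℚ.* ω)))) ℚ.* v̂ₙ (suc n))
                    ≡ ι (+ suc n) ℚ.* ω
          residue = begin
            ŵₙ n ℚ.+ ℚ.- (e ℚ.* e ℚ.* (h ℚ.* ℚ.- (ι (+ n) ℚ.* (h ℚ.* (ε ℚ.* ω)))) ℚ.* v̂ₙ (suc n))
              ≡⟨ cong₂ (λ x y → x ℚ.+ ℚ.- (e ℚ.* e ℚ.* (h ℚ.* ℚ.- (ι (+ n) ℚ.* (h ℚ.* (ε ℚ.* ω)))) ℚ.* y))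
                   ŵ≡ v̂′ ⟩
            ω ℚ.+ ℚ.- (e ℚ.* e ℚ.* (h ℚ.* ℚ.- (ι (+ n) ℚ.* (h ℚ.* (ε ℚ.* ω)))) ℚ.* ε)
              ≡⟨ Q.solve 5 (λ ω e h n ε → let open Q in
                   ω :+ :- (e :* e :* (h :* :- (n :* (h :* (ε :* ω)))) :* ε)
                   := ω :+ n :* ω :* (e :* e :* (h :* h) :* (ε :* ε))) ≡.refl ω e h (ι (+ n)) ε ⟩
            ω ℚ.+ ι (+ n) ℚ.* ω ℚ.* (e ℚ.* e ℚ.* (h ℚ.* h) ℚ.* (ε ℚ.* ε))
              ≡⟨ cong₂ (λ x y → ω ℚ.+ ι (+ n) ℚ.* ω ℚ.* (x ℚ.* y)) e²h²≡1 P.v̂² ⟩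
            ω ℚ.+ ι (+ n) ℚ.* ω ℚ.* 1ℚ
              ≡⟨ cong₂ ℚ._+_ (≡.sym (ℚ.*-identityˡ ω)) (ℚ.*-identityʳ (ι (+ n) ℚ.* ω)) ⟩
            1ℚ ℚ.* ω ℚ.+ ι (+ n) ℚ.* ω ≡⟨ ℚ.*-distribʳ-+ ω 1ℚ (ι (+ n)) ⟨
            (1ℚ ℚ.+ ι (+ n)) ℚ.* ω ≡⟨ cong (ℚ._* ω) (ι-suc n) ⟨
            ι (+ suc n) ℚ.* ω ∎

        odd⇒even : ∀ n → OddMultiple n → EvenMultiple (suc n)
        odd⇒even n odd = record
          { s = s′ ; ω = ℚ.- ω
          ; u≈ = trans (u-suc n) (trans (*-congʳ (+-congʳ (*-congˡ w≈)))
                   (F.solve 7 (λ u v′ w s u′ v d → let open F in (u :* v′ :* (w :* s) :+ u′ :* v :* w) :* d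
                     := w :* ((u :* v′ :* s :+ u′ :* v) :* d))
                     refl u (vₚ (n · P)) w s (uₚ (n · P)) v (d⁻¹ n)))
          ; s↝ = ≡.subst (s′ ↝_) residue
                   (↝-* (↝-+ (↝-* (↝-* P.u↝ (vₙ↝ n)) s↝) (↝-* (uₙ↝ n) P.v↝)) (d⁻¹↝1 n))
          ; ŵ≡ = begin
              ŵₙ (suc n) ≡⟨ ŵ-suc n ⟩
              P.ŵ ℚ.* ŵₙ n ℚ.- e ℚ.* e ℚ.* (h ℚ.* ûₙ n) ℚ.* (ε ℚ.* v̂ₙ n)
                ≡⟨ cong₂ (λ x y → x ℚ.* ŵₙ n ℚ.- e ℚ.* e ℚ.* (h ℚ.* ûₙ n) ℚ.* (ε ℚ.* y)) ŵ≡0 v̂≡ ⟩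
              0ℚ ℚ.* ŵₙ n ℚ.- e ℚ.* e ℚ.* (h ℚ.* ûₙ n) ℚ.* (ε ℚ.* ε)
                ≡⟨ cong (λ x → 0ℚ ℚ.* ŵₙ n ℚ.- e ℚ.* e ℚ.* (h ℚ.* x) ℚ.* (ε ℚ.* ε)) û≡ ⟩
              0ℚ ℚ.* ŵₙ n ℚ.- e ℚ.* e ℚ.* (h ℚ.* (ω ℚ.* h)) ℚ.* (ε ℚ.* ε)
                ≡⟨ Q.solve 5 (λ w e h ω ε → let open Q in
                     con (+ 0) :* w :- e :* e :* (h :* (ω :* h)) :* (ε :* ε)
                     := :- (ω :* (e :* e :* (h :* h) :* (ε :* ε)))) ≡.refl (ŵₙ n) e h ω ε ⟩
              ℚ.- (ω ℚ.* (e ℚ.* e ℚ.* (h ℚ.* h) ℚ.* (ε ℚ.* ε)))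
                ≡⟨ cong₂ (λ x y → ℚ.- (ω ℚ.* (x ℚ.* y))) e²h²≡1 P.v̂² ⟩
              ℚ.- (ω ℚ.* 1ℚ) ≡⟨ cong ℚ.-_ (ℚ.*-identityʳ ω) ⟩
              ℚ.- ω ∎
          ; v̂≡ = ≡.trans (v̂-suc n) (≡.trans (cong (ε ℚ.*_) v̂≡) P.v̂²) }
          where
          open ≡-Reasoning
          open OddMultiple odd
          s′ = (u * vₚ (n · P) * s + uₚ (n · P) * v) * d⁻¹ n

          residue : (h ℚ.* v̂ₙ n ℚ.* (ι (+ n) ℚ.* ω) ℚ.+ ûₙ n ℚ.* ε) ℚ.* 1ℚ
                    ≡ ℚ.- (ι (+ suc n) ℚ.* (h ℚ.* (ε ℚ.* ℚ.- ω)))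
          residue = begin
            (h ℚ.* v̂ₙ n ℚ.* (ι (+ n) ℚ.* ω) ℚ.+ ûₙ n ℚ.* ε) ℚ.* 1ℚ ≡⟨ ℚ.*-identityʳ _ ⟩
            h ℚ.* v̂ₙ n ℚ.* (ι (+ n) ℚ.* ω) ℚ.+ ûₙ n ℚ.* ε
              ≡⟨ cong₂ (λ x y → h ℚ.* x ℚ.* (ι (+ n) ℚ.* ω) ℚ.+ y ℚ.* ε) v̂≡ û≡ ⟩
            h ℚ.* ε ℚ.* (ι (+ n) ℚ.* ω) ℚ.+ ω ℚ.* h ℚ.* ε
              ≡⟨ cong (h ℚ.* ε ℚ.* (ι (+ n) ℚ.* ω) ℚ.+_) (≡.sym (ℚ.*-identityˡ (ω ℚ.* h ℚ.* ε))) ⟩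
            h ℚ.* ε ℚ.* (ι (+ n) ℚ.* ω) ℚ.+ 1ℚ ℚ.* (ω ℚ.* h ℚ.* ε)
              ≡⟨ Q.solve 5 (λ h ε n ω o → let open Q in h :* ε :* (n :* ω) :+ o :* (ω :* h :* ε)
                   := :- ((o :+ n) :* (h :* (ε :* :- ω)))) ≡.refl h ε (ι (+ n)) ω 1ℚ ⟩
            ℚ.- ((1ℚ ℚ.+ ι (+ n)) ℚ.* (h ℚ.* (ε ℚ.* ℚ.- ω)))
              ≡⟨ cong (λ x → ℚ.- (x ℚ.* (h ℚ.* (ε ℚ.* ℚ.- ω)))) (ι-suc n) ⟨
            ℚ.- (ι (+ suc n) ℚ.* (h ℚ.* (ε ℚ.* ℚ.- ω))) ∎

        multiple : ∀ n → EvenMultiple n ⊎ OddMultiple n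
        multiple zero    = inj₁ zero-even
        multiple (suc n) = [ inj₂ ∘ even⇒odd n , inj₁ ∘ odd⇒even n ]′ (multiple n)

        -- An odd multiple cannot be O, since w (n P) = w s has residue 0 while w is 1 at O. For an
        -- even one, u (n P) = w s = 0 and s has nonzero residue.
        w≈0 : ∀ n → EC._≈ₚ_ E (suc n · P) EC.O → w ≈ 0#
        w≈0 n nP≈O = [ even-case , odd-case ]′ (multiple (suc n))
          where
          open ≡-Reasoning
          ŵ≡1 : ŵₙ (suc n) ≡ 1ℚ
          ŵ≡1 = ↝-unique (wₙ↝ (suc n)) (↝-resp (sym (≈O⇒w≈1 nP≈O)) 1↝1)

          odd-case : OddMultiple (suc n) → w ≈ 0#
          odd-case odd = contradiction
            (≡.trans (≡.sym ŵ≡1) (↝-unique (wₙ↝ (suc n)) (↝-resp (sym w≈) (↝-* P.w↝ s↝))))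
            λ e₁ → 1≢0 (≡.trans e₁ (≡.trans (cong (ℚ._* (ι (+ suc n) ℚ.* ω)) ŵ≡0)
              (ℚ.*-zeroˡ (ι (+ suc n) ℚ.* ω))))
            where open OddMultiple odd

          even-case : EvenMultiple (suc n) → w ≈ 0#
          even-case even = [ id , (λ s≈0 → contradiction
            (n≡0 (↝-unique (↝-resp s≈0 s↝) 0↝0)) λ ()) ]′ (noZeroDivisors (trans (sym u≈) (≈O⇒u≈0 nP≈O)))
            where
            open EvenMultiple even
            N′ = ι (+ suc n)
            n≡0 : ℚ.- (N′ ℚ.* (h ℚ.* (ε ℚ.* ω))) ≡ 0ℚ → + suc n ≡ + 0
            n≡0 e₀ = ι-injective (begin
              N′ ≡⟨ ≡.trans (cong (λ x → N′ ℚ.* x) (cong₂ ℚ._*_ e²h²≡1 P.v̂²)) (ℚ.*-identityʳ N′) ⟨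
              N′ ℚ.* (e ℚ.* e ℚ.* (h ℚ.* h) ℚ.* (ε ℚ.* ε)) ≡⟨ ℚ.*-identityʳ _ ⟨
              N′ ℚ.* (e ℚ.* e ℚ.* (h ℚ.* h) ℚ.* (ε ℚ.* ε)) ℚ.* 1ℚ
                ≡⟨ cong (N′ ℚ.* (e ℚ.* e ℚ.* (h ℚ.* h) ℚ.* (ε ℚ.* ε)) ℚ.*_) (≡.trans (≡.sym ŵ≡) ŵ≡1) ⟨
              N′ ℚ.* (e ℚ.* e ℚ.* (h ℚ.* h) ℚ.* (ε ℚ.* ε)) ℚ.* ω
                -- The factor - e² h ε inverts - h ε, because e² h² = 1 = ε².
                ≡⟨ Q.solve 5 (λ n e h ε ω → let open Q in n :* (e :* e :* (h :* h) :* (ε :* ε)) :* ω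
                     := :- (n :* (h :* (ε :* ω))) :* (:- (e :* e :* h :* ε))) ≡.refl N′ e h ε ω ⟩
              ℚ.- (N′ ℚ.* (h ℚ.* (ε ℚ.* ω))) ℚ.* (ℚ.- (e ℚ.* e ℚ.* h ℚ.* ε))
                ≡⟨ cong (ℚ._* (ℚ.- (e ℚ.* e ℚ.* h ℚ.* ε))) e₀ ⟩
              0ℚ ℚ.* (ℚ.- (e ℚ.* e ℚ.* h ℚ.* ε)) ≡⟨ ℚ.*-zeroˡ (ℚ.- (e ℚ.* e ℚ.* h ℚ.* ε)) ⟩
              0ℚ ∎)

      torsion⇒u≈0 : (∀ x → ¬ B * (x * x) ≈ 1#) → ∀ n → EC._≈ₚ_ E (suc n · P) EC.O → u ≈ 0#
      torsion⇒u≈0 B-nonsquare n nP≈O = [ order-four , order-two ]′ (niven on-circle n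
        (≡.trans (≡.sym (proj₁ (residue-rotation (suc n))))
          (↝-unique (wₙ↝ (suc n)) (↝-resp (sym (≈O⇒w≈1 nP≈O)) 1↝1))))
        where
        order-four : P.ŵ ≡ 0ℚ → u ≈ 0#
        order-four ŵ≡0 = contradiction
          (trans (sym (+-identityʳ _)) (trans (+-congˡ (sym (*≈0 w (OrderFour.w≈0 ŵ≡0 n nP≈O)))) (w-conic P)))
          (B-nonsquare u)

        order-two : P.ŵ ℚ.* P.ŵ ≡ 1ℚ → u ≈ 0#
        order-two ŵ²≡1 = OrderTwo.u≈0 (nonzero-cancel e P.û e≢0 (square≡0⇒≡0 (e ℚ.* P.û) (begin
          e ℚ.* P.û ℚ.* (e ℚ.* P.û)
            ≡⟨ Q.solve 3 (λ e u x → let open Q in e :* u :* (e :* u) := (e :* e :* (u :* u) :+ x) :- x)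
                 ≡.refl e P.û (P.ŵ ℚ.* P.ŵ) ⟩
          (e ℚ.* e ℚ.* (P.û ℚ.* P.û) ℚ.+ P.ŵ ℚ.* P.ŵ) ℚ.- P.ŵ ℚ.* P.ŵ ≡⟨ cong₂ ℚ._-_ P.circle ŵ²≡1 ⟩
          0ℚ ∎))) n nP≈O
          where open ≡-Reasoning

-- The points with u = 0 and their two sign characters

module TorsionSubgroup
  {c ℓ₁ ℓ₂} (K : HeytingField c ℓ₁ ℓ₂) (_#?_ : Decidable (HeytingField._#_ K))
  (E : EllipticCurve.Curve K _#?_)
  (nonsquare : ∀ x → HeytingField._#_ K (HeytingField._*_ K x x) (JacobiCoordinates.q K _#?_ E))
  where

  open HeytingField K
  open JacobiCoordinates K _#?_ E
  open EC.Curve E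
  open JacobiIdentities commutativeRing
  open IntegerRingSolver commutativeRing
  open Nonsquare nonsquare

  private
    G : RawGroup (c ⊔ ℓ₁) (c ⊔ ℓ₁)
    G = EC.pointGroup E

    infix 4 _≈ₚ_
    _≈ₚ_ : EC.Point E → EC.Point E → Set (c ⊔ ℓ₁)
    _≈ₚ_ = EC._≈ₚ_ E

    infixl 6 _⊕_
    _⊕_ : EC.Point E → EC.Point E → EC.Point E
    _⊕_ = EC._⊕_ E

    infix 8 ⊖_
    ⊖_ : EC.Point E → EC.Point E
    ⊖_ = EC.⊖_ E

  halve : ∀ {x} → x + x ≈ 0# → x ≈ 0#
  halve {x} e = cancel₀ (#0⇒invertible 2#0)
    (trans (distribˡ x 1# 1#) (trans (+-cong (*-identityʳ x) (*-identityʳ x)) e))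

  1≉-1 : ¬ 1# ≈ - 1#
  1≉-1 e = ≈⇒¬# (trans (+-congˡ e) (-‿inverseʳ 1#)) 2#0

  data HasSign (x : Carrier) : Parity → Set ℓ₁ where
    pos : x ≈ 1#   → HasSign x 0ℙ
    neg : x ≈ - 1# → HasSign x 1ℙ

  HasSign-unique : ∀ {x p q} → HasSign x p → HasSign x q → p ≡ q
  HasSign-unique (pos e) (pos f) = ≡.refl
  HasSign-unique (pos e) (neg f) = contradiction (trans (sym e) f) 1≉-1
  HasSign-unique (neg e) (pos f) = contradiction (trans (sym f) e) 1≉-1
  HasSign-unique (neg e) (neg f) = ≡.refl

  HasSign-injective : ∀ {x y p} → HasSign x p → HasSign y p → x ≈ y
  HasSign-injective (pos e) (pos f) = trans e (sym f)
  HasSign-injective (neg e) (neg f) = trans e (sym f)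

  HasSign-resp : ∀ {x y p} → x ≈ y → HasSign x p → HasSign y p
  HasSign-resp x≈y (pos e) = pos (trans (sym x≈y) e)
  HasSign-resp x≈y (neg e) = neg (trans (sym x≈y) e)

  HasSign-* : ∀ {x y p q} → HasSign x p → HasSign y q → HasSign (x * y) (p ℙ.+ q)
  HasSign-* {y = y} (pos e) s = HasSign-resp (sym (trans (*-congʳ e) (*-identityˡ y))) s
  HasSign-* {x = x} (neg e) (pos f) = neg (trans (*-congˡ f) (trans (*-identityʳ x) e))
  HasSign-* (neg e) (neg f) = pos (trans (*-cong e f)
    (trans (solve 1 (λ x → :- x :* :- x := x :* x) refl 1#) (*-identityˡ 1#)))

  -- Every x apart from 1 receives the odd sign; the value is meaningful for square roots of 1.
  sign : Carrier → Parity
  sign x with x #? 1#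
  ... | yes _ = 1ℙ
  ... | no  _ = 0ℙ

  square≈1⇒HasSign : ∀ {x} → x * x ≈ 1# → HasSign x (sign x)
  square≈1⇒HasSign {x} e with x #? 1#
  ... | no ¬x#1 = pos (¬#⇒≈ ¬x#1)
  ... | yes x#1 = neg (x-y≈0⇒x≈y _ _ (cancel₀ (#⇒invertible x#1)
    (trans (solve 2 (λ x o → (x :- :- o) :* (x :- o) := x :* x :- o :* o) refl x 1#)
      (x≈y⇒x-y≈0 (trans e (sym (*-identityˡ 1#)))))))

  sign-unique : ∀ {x p} → x * x ≈ 1# → HasSign x p → sign x ≡ p
  sign-unique e = HasSign-unique (square≈1⇒HasSign e)

  v-cong : ∀ {P Q} → P ≈ₚ Q → vₚ P ≈ vₚ Q
  v-cong EC.O≈O = refl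
  v-cong (EC.affine≈ {x} {y} {_} {x′} {y′} e _) =
    ratio-unique (+-congʳ e) (M-cong A (+-congʳ e))
      (Coordinates.vN (coords x y)) (Coordinates.vN (coords x′ y′))

  w-cong : ∀ {P Q} → P ≈ₚ Q → wₚ P ≈ wₚ Q
  w-cong EC.O≈O = refl
  w-cong (EC.affine≈ {x} {y} {_} {x′} {y′} e _) =
    ratio-unique (+-congʳ e) (M-cong B (+-congʳ e))
      (Coordinates.wN (coords x y)) (Coordinates.wN (coords x′ y′))

  v²≈1 : ∀ P → uₚ P ≈ 0# → vₚ P * vₚ P ≈ 1#
  v²≈1 P u≈0 = trans
    (sym (trans (+-congʳ (trans (*-congˡ (*≈0 _ u≈0)) (zeroʳ A))) (+-identityˡ _)))
    (v-conic P)

  w²≈1 : ∀ P → uₚ P ≈ 0# → wₚ P * wₚ P ≈ 1#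
  w²≈1 P u≈0 = trans
    (sym (trans (+-congʳ (trans (*-congˡ (*≈0 _ u≈0)) (zeroʳ B))) (+-identityˡ _)))
    (w-conic P)

  v-⊕ : ∀ P Q → uₚ P ≈ 0# → vₚ P * vₚ Q ≈ vₚ (P ⊕ Q)
  v-⊕ P Q u≈0 = trans (Addition.v-law (⊕-addition P Q))
    (trans (+-congˡ (*≈0 _ (trans (*-congˡ (*≈0 _ u≈0)) (zeroʳ A)))) (+-identityʳ _))

  w-⊕ : ∀ P Q → uₚ P ≈ 0# → wₚ P * wₚ Q ≈ wₚ (P ⊕ Q)
  w-⊕ P Q u≈0 = trans (Addition.w-law (⊕-addition P Q))
    (trans (+-congˡ (*≈0 _ (trans (*-congˡ (*≈0 _ u≈0)) (zeroʳ B)))) (+-identityʳ _))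

  u-⊕ : ∀ P Q → uₚ P ≈ 0# → uₚ Q ≈ 0# → uₚ (P ⊕ Q) ≈ 0#
  u-⊕ P Q uP≈0 uQ≈0 = trans (sym (*-identityʳ _)) (trans (*-congˡ (sym D≈1))
    (trans (Addition.u-law (⊕-addition P Q)) (+≈0 (*≈0 _ (*≈0 _ uP≈0)) (*≈0 _ (*≈0 _ uQ≈0)))))
    where
    D≈1 : wₚ Q * wₚ Q + B * (uₚ Q * uₚ Q) * (vₚ P * vₚ P) ≈ 1#
    D≈1 = trans (+-cong (w²≈1 Q uQ≈0) (*≈0 _ (trans (*-congˡ (*≈0 _ uQ≈0)) (zeroʳ B)))) (+-identityʳ 1#)

  u-⊖ : ∀ P → uₚ P ≈ 0# → uₚ (⊖ P) ≈ 0#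
  u-⊖ EC.O              e = e
  u-⊖ (EC.affine x y _) e = trans
    (solve 2 (λ y i → (:- y :+ :- y) :* i := :- ((y :+ y) :* i)) refl y _) (neg≈0 e)

  u≈0⇒y≈0 : ∀ x y → ratio (y + y) x ≈ 0# → y ≈ 0#
  u≈0⇒y≈0 x y e = halve (trans (sym (Coordinates.uN (coords x y))) (*≈0 _ e))

  y≈0⇒u≈0 : ∀ x y → y ≈ 0# → ratio (y + y) x ≈ 0#
  y≈0⇒u≈0 x y e = *≈0 _ (+≈0 e e)

  y≈0⇒2P≈O : ∀ {x y e} → y ≈ 0# → EC.affine x y e ⊕ EC.affine x y e ≈ₚ EC.O
  y≈0⇒2P≈O {x} {y} y≈0 with x #? x
  ... | yes x#x = contradiction x#x (≈⇒¬# refl)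
  ... | no _ with y #? (- y)
  ...   | yes y#-y = contradiction y#-y (≈⇒¬# (trans y≈0 (sym (neg≈0 y≈0))))
  ...   | no _ = EC.O≈O

  u≈0⇒torsion : ∀ P → uₚ P ≈ 0# → IsTorsion G P
  u≈0⇒torsion EC.O              _ = 1 , _ , EC.O≈O
  u≈0⇒torsion (EC.affine x y _) e = 2 , _ , y≈0⇒2P≈O (u≈0⇒y≈0 x y e)

  -- X / N and 1 / N, extended to O by their value 0 at infinity.
  κₚ νₚ : EC.Point E → Carrier
  κₚ EC.O              = 0#
  κₚ (EC.affine x _ _) = ratio (x + α) x
  νₚ EC.O              = 0#
  νₚ (EC.affine x _ _) = proj₁ (N-invertible (x + α))

  -- M = N - 2 (a x - q).
  character-formula : ∀ {a x i} → i * N q x ≈ 1# →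
    M a q x * i ≈ 1# - (a * (x * i) - q * i) - (a * (x * i) - q * i)
  character-formula {a} {x} {i} e = trans
    (solve 4 (λ a q x i → (x :* x :- (a :* x :+ a :* x) :+ q) :* i
      := i :* (x :* x :- q) :- (a :* (x :* i) :- q :* i) :- (a :* (x :* i) :- q :* i)) refl a q x i)
    (+-congʳ (+-congʳ e))

  v-formula : ∀ P → vₚ P ≈ 1# - (A * κₚ P - q * νₚ P) - (A * κₚ P - q * νₚ P)
  v-formula EC.O = solve 3 (λ o a q →
    o := o :- (a :* con (+ 0) :- q :* con (+ 0)) :- (a :* con (+ 0) :- q :* con (+ 0)))
    refl 1# A q
  v-formula (EC.affine x _ _) = character-formula (proj₁ (proj₂ (N-invertible (x + α))))

  w-formula : ∀ P → wₚ P ≈ 1# - (B * κₚ P - q * νₚ P) - (B * κₚ P - q * νₚ P)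
  w-formula EC.O = solve 3 (λ o a q →
    o := o :- (a :* con (+ 0) :- q :* con (+ 0)) :- (a :* con (+ 0) :- q :* con (+ 0)))
    refl 1# B q
  w-formula (EC.affine x _ _) = character-formula (proj₁ (proj₂ (N-invertible (x + α))))

  A-invertible : Invertible _≈_ 1# _*_ A
  A-invertible = #⇒invertible α#β

  B-invertible : Invertible _≈_ 1# _*_ B
  B-invertible = #⇒invertible α#γ

  -- v and w are affine functions of X/N and 1/N with independent coefficients.
  κν-determined : ∀ P Q → vₚ P ≈ vₚ Q → wₚ P ≈ wₚ Q → κₚ P ≈ κₚ Q × νₚ P ≈ νₚ Q
  κν-determined P Q v≈ w≈ = κ≈ , ν≈
    where
    δ-zero : ∀ {o a κ κ′ ν ν′} →
      o - (a * κ - q * ν) - (a * κ - q * ν) ≈ o - (a * κ′ - q * ν′) - (a * κ′ - q * ν′) →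
      a * (κ - κ′) - q * (ν - ν′) ≈ 0#
    δ-zero {o} {a} {κ} {κ′} {ν} {ν′} e = halve (trans
      (solve 7 (λ o a q κ κ′ ν ν′ →
        (a :* (κ :- κ′) :- q :* (ν :- ν′)) :+ (a :* (κ :- κ′) :- q :* (ν :- ν′))
        := :- ((o :- (a :* κ :- q :* ν) :- (a :* κ :- q :* ν))
               :- (o :- (a :* κ′ :- q :* ν′) :- (a :* κ′ :- q :* ν′))))
        refl o a q κ κ′ ν ν′)
      (neg≈0 (x≈y⇒x-y≈0 e)))

    eA : A * (κₚ P - κₚ Q) - q * (νₚ P - νₚ Q) ≈ 0#
    eA = δ-zero (trans (sym (v-formula P)) (trans v≈ (v-formula Q)))

    eB : B * (κₚ P - κₚ Q) - q * (νₚ P - νₚ Q) ≈ 0#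
    eB = δ-zero (trans (sym (w-formula P)) (trans w≈ (w-formula Q)))

    -- Subtracting `eA` from `eB` eliminates ν and leaves the coefficient B - A = β - γ.
    κ-0 : κₚ P - κₚ Q ≈ 0#
    κ-0 = cancel₀ (#⇒invertible β#γ) (trans
      (solve 5 (λ a b c z t → z :* (b :- c) := ((a :- c) :* z :- t) :- ((a :- b) :* z :- t))
        refl α β γ (κₚ P - κₚ Q) (q * (νₚ P - νₚ Q)))
      (+≈0 eB (neg≈0 eA)))

    κ≈ : κₚ P ≈ κₚ Q
    κ≈ = x-y≈0⇒x≈y _ _ κ-0

    ν≈ : νₚ P ≈ νₚ Q
    ν≈ = x-y≈0⇒x≈y _ _ (cancel₀ A-invertible (cancel₀ B-invertible (trans
      (solve 4 (λ a b z n → n :* a :* b := z :* a :- (a :* z :- a :* b :* n))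
        refl A B (κₚ P - κₚ Q) (νₚ P - νₚ Q))
      (+≈0 (*≈0 A κ-0) (neg≈0 eA)))))

  1≉0 : ¬ 1# ≈ 0#
  1≉0 e = 1≉-1 (trans e (sym (neg≈0 e)))

  ν≉0 : ∀ x → ¬ proj₁ (N-invertible (x + α)) ≈ 0#
  ν≉0 x e = 1≉0 (trans (sym (proj₁ (proj₂ (N-invertible (x + α))))) (*≈0 _ e))

  -- ν vanishes at O alone, and elsewhere X = κ / ν; the ordinate is 0 because u is.
  point-determined : ∀ P Q → uₚ P ≈ 0# → uₚ Q ≈ 0# → vₚ P ≈ vₚ Q → wₚ P ≈ wₚ Q → P ≈ₚ Q
  point-determined EC.O EC.O _ _ _ _ = EC.O≈O
  point-determined P@EC.O Q@(EC.affine x _ _) _ _ v≈ w≈ =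
    contradiction (sym (proj₂ (κν-determined P Q v≈ w≈))) (ν≉0 x)
  point-determined P@(EC.affine x _ _) Q@EC.O _ _ v≈ w≈ =
    contradiction (proj₂ (κν-determined P Q v≈ w≈)) (ν≉0 x)
  point-determined P@(EC.affine x y _) Q@(EC.affine x′ y′ _) uP uQ v≈ w≈ =
    EC.affine≈ x≈x′ (trans (u≈0⇒y≈0 x y uP) (sym (u≈0⇒y≈0 x′ y′ uQ)))
    where
    i  = N-invertible (x + α)
    i′ = N-invertible (x′ + α)
    κ≈ = proj₁ (κν-determined P Q v≈ w≈)
    ν≈ = proj₂ (κν-determined P Q v≈ w≈)

    X≈ : x + α ≈ x′ + α
    X≈ = x-y≈0⇒x≈y _ _ (cancel₀ (N q (x + α) , proj₂ (proj₂ i) , proj₁ (proj₂ i)) (trans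
      (solve 3 (λ x y i → (x :- y) :* i := x :* i :- y :* i) refl (x + α) (x′ + α) (proj₁ i))
      (x≈y⇒x-y≈0 (trans κ≈ (*-congˡ (sym ν≈))))))

    x≈x′ : x ≈ x′
    x≈x′ = trans (solve 2 (λ x a → x := (x :+ a) :- a) refl x α)
      (trans (+-congʳ X≈) (solve 2 (λ x a → (x :+ a) :- a := x) refl x′ α))

  module _ (torsion⇒u≈0 : ∀ P → IsTorsion G P → uₚ P ≈ 0#) where

    -- Closure passes through the condition u = 0, which ⊕ and ⊖ preserve, rather than through the
    -- orders of the summands.
    isSubgroup : IsSubgroup G (IsTorsion G)
    isSubgroup = record
      { ∙-closed  = λ {P} {Q} tP tQ → u≈0⇒torsion (P ⊕ Q) (u-⊕ P Q (torsion⇒u≈0 P tP) (torsion⇒u≈0 Q tQ))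
      ; ε-closed  = u≈0⇒torsion EC.O refl
      ; ⁻¹-closed = λ {P} tP → u≈0⇒torsion (⊖ P) (u-⊖ P (torsion⇒u≈0 P tP))
      }

    signs : Σ[ P ∈ EC.Point E ] IsTorsion G P → Parity × Parity
    signs (P , _) = sign (vₚ P) , sign (wₚ P)

    private
      v-sign : ∀ {P} → IsTorsion G P → HasSign (vₚ P) (sign (vₚ P))
      v-sign {P} t = square≈1⇒HasSign (v²≈1 P (torsion⇒u≈0 P t))

      w-sign : ∀ {P} → IsTorsion G P → HasSign (wₚ P) (sign (wₚ P))
      w-sign {P} t = square≈1⇒HasSign (w²≈1 P (torsion⇒u≈0 P t))

      signs-cong : ∀ {P Q} → IsTorsion G P → IsTorsion G Q → P ≈ₚ Q →
        sign (vₚ P) ≡ sign (vₚ Q) × sign (wₚ P) ≡ sign (wₚ Q)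
      signs-cong {P} {Q} tP tQ e =
        HasSign-unique (HasSign-resp (v-cong e) (v-sign tP)) (v-sign tQ) ,
        HasSign-unique (HasSign-resp (w-cong e) (w-sign tP)) (w-sign tQ)

    two-torsion : ∀ x → (x + α) * (x + β) * (x + γ) ≈ 0# → EC.Point E
    two-torsion x e = EC.affine x 0# (trans (zeroˡ 0#) (sym e))

    preimage : ∀ {x p p′} (e : (x + α) * (x + β) * (x + γ) ≈ 0#) →
      HasSign (vₚ (two-torsion x e)) p → HasSign (wₚ (two-torsion x e)) p′ →
      Σ[ t ∈ Σ[ P ∈ EC.Point E ] IsTorsion G P ] (∀ {s} → proj₁ s ≈ₚ proj₁ t →
        proj₁ (signs s) ≡ p × proj₂ (signs s) ≡ p′)
    preimage {x} e sv sw = (two-torsion x e , t) , λ {s} s≈ →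
      HasSign-unique (HasSign-resp (v-cong s≈) (v-sign (proj₂ s))) sv ,
      HasSign-unique (HasSign-resp (w-cong s≈) (w-sign (proj₂ s))) sw
      where
      t : IsTorsion G (two-torsion x e)
      t = u≈0⇒torsion _ (y≈0⇒u≈0 x 0# refl)

    plus-sign : ∀ a x → M a q (x + α) ≈ N q (x + α) → HasSign (ratio (M a q (x + α)) x) 0ℙ
    plus-sign a x e = pos (ratio-unique refl e (quotient-* _ (N-invertible (x + α))) (*-identityˡ _))

    minus-sign : ∀ a x → M a q (x + α) ≈ - N q (x + α) → HasSign (ratio (M a q (x + α)) x) 1ℙ
    minus-sign a x e = neg (ratio-unique refl e (quotient-* _ (N-invertible (x + α)))
      (trans (solve 2 (λ o n → :- o :* n := :- (o :* n)) refl 1# (N q (x + α))) (-‿cong (*-identityˡ _))))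

    isGroupIsomorphism : IsGroupIsomorphism (subgroup G isSubgroup) ℤ/2×ℤ/2 signs
    isGroupIsomorphism = record
      { isGroupMonomorphism = record
        { isGroupHomomorphism = record
          { isMonoidHomomorphism = record
            { isMagmaHomomorphism = record
              { isRelHomomorphism = record { cong = λ { {P , tP} {Q , tQ} e → signs-cong tP tQ e } }
              ; homo = λ (P , tP) (Q , tQ) →
                  let uP = torsion⇒u≈0 P tP ; uPQ = u-⊕ P Q uP (torsion⇒u≈0 Q tQ) in
                  sign-unique (v²≈1 (P ⊕ Q) uPQ)
                    (HasSign-resp (v-⊕ P Q uP) (HasSign-* (v-sign tP) (v-sign tQ))) ,
                  sign-unique (w²≈1 (P ⊕ Q) uPQ)
                    (HasSign-resp (w-⊕ P Q uP) (HasSign-* (w-sign tP) (w-sign tQ)))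
              }
            ; ε-homo = sign-unique (*-identityˡ 1#) (pos refl) , sign-unique (*-identityˡ 1#) (pos refl)
            }
          -- v and w depend on the abscissa only, and inversion in the target is the identity.
          ; ⁻¹-homo = λ { (EC.O , _) → ≡.refl , ≡.refl ; (EC.affine _ _ _ , _) → ≡.refl , ≡.refl }
          }
        ; injective = λ { {P , tP} {Q , tQ} (ev , ew) →
            point-determined P Q (torsion⇒u≈0 P tP) (torsion⇒u≈0 Q tQ)
              (HasSign-injective (v-sign tP) (≡.subst (HasSign (vₚ Q)) (≡.sym ev) (v-sign tQ)))
              (HasSign-injective (w-sign tP) (≡.subst (HasSign (wₚ Q)) (≡.sym ew) (w-sign tQ))) }
        }
      ; surjective = surjective
      }
      where
      surjective : ∀ p → Σ[ t ∈ Σ[ P ∈ EC.Point E ] IsTorsion G P ] (∀ {s} → proj₁ s ≈ₚ proj₁ t →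
        proj₁ (signs s) ≡ proj₁ p × proj₂ (signs s) ≡ proj₂ p)
      surjective (0ℙ , 0ℙ) = (EC.O , u≈0⇒torsion EC.O refl) , λ {s} s≈ →
        HasSign-unique (HasSign-resp (v-cong s≈) (v-sign (proj₂ s))) (pos refl) ,
        HasSign-unique (HasSign-resp (w-cong s≈) (w-sign (proj₂ s))) (pos refl)
      -- In the coordinate X the three points are 0, then A, then B. At each of them both numerators
      -- M are N or - N.
      surjective (1ℙ , 1ℙ) = preimage
        (solve 3 (λ a b c → (:- a :+ a) :* (:- a :+ b) :* (:- a :+ c) := con (+ 0)) refl α β γ)
        (minus-sign A (- α) (solve 3 (λ a A q → let x = :- a :+ a in
          x :* x :- (A :* x :+ A :* x) :+ q := :- (x :* x :- q)) refl α A q))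
        (minus-sign B (- α) (solve 3 (λ a A q → let x = :- a :+ a in
          x :* x :- (A :* x :+ A :* x) :+ q := :- (x :* x :- q)) refl α B q))
      surjective (1ℙ , 0ℙ) = preimage
        (solve 3 (λ a b c → (:- b :+ a) :* (:- b :+ b) :* (:- b :+ c) := con (+ 0)) refl α β γ)
        (minus-sign A (- β) (solve 3 (λ a b q → let x = :- b :+ a ; A = a :- b in
          x :* x :- (A :* x :+ A :* x) :+ q := :- (x :* x :- q)) refl α β q))
        (plus-sign B (- β) (solve 3 (λ a b c → let x = :- b :+ a ; B = a :- c ; q = (a :- b) :* B in
          x :* x :- (B :* x :+ B :* x) :+ q := x :* x :- q) refl α β γ))
      surjective (0ℙ , 1ℙ) = preimage
        (solve 3 (λ a b c → (:- c :+ a) :* (:- c :+ b) :* (:- c :+ c) := con (+ 0)) refl α β γ)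
        (plus-sign A (- γ) (solve 3 (λ a b c → let x = :- c :+ a ; A = a :- b ; q = A :* (a :- c) in
          x :* x :- (A :* x :+ A :* x) :+ q := x :* x :- q) refl α β γ))
        (minus-sign B (- γ) (solve 3 (λ a c q → let x = :- c :+ a ; B = a :- c in
          x :* x :- (B :* x :+ B :* x) :+ q := :- (x :* x :- q)) refl α γ q))

-- The place k = 0 of ℚ(k)

module PlaceAtZero where

  open ℚ[k] using (Poly; coeff; coeff-+; coeff-neg; at; coeffwise; 0∷-*; _≈_; _+_; _*_; -_; 0ᴾ; 1ᴾ)
  open CommutativeRing ℚ[k].commutativeRing
    using (refl; sym; trans; *-cong; *-congˡ; *-congʳ; +-cong; *-comm; *-identityˡ; *-identityʳ;
      zeroˡ; -‿cong)
  open IntegerRingSolver ℚ[k].commutativeRing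
  open ℚ⟨k⟩ using (Frac; frac; num; den; _≈ᶠ_; _+ᶠ_; _*ᶠ_; -ᶠ_; 1ᶠ; embed; *-cancelʳ)
  private module Q = ℚ-Solver

  coeff₀-* : ∀ p q → coeff (p * q) 0 ≡ coeff p 0 ℚ.* coeff q 0
  coeff₀-* []      q = ≡.sym (ℚ.*-zeroˡ (coeff q 0))
  coeff₀-* (a ∷ p) q = ≡.trans (coeff-+ (ℚ[k].scale a q) (0ℚ ∷ p * q) 0)
    (≡.trans (ℚ.+-identityʳ _) (ℚ[k].coeff-scale a q 0))

  -- Fractions are not reduced, and in k / k the denominator vanishes at 0. So the residue is read
  -- from some equal fraction p / q with q (0) ≠ 0, and stated as p (0) = r q (0).
  record _↝_ (x : Frac) (r : ℚ) : Set where
    constructor represented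
    field
      p q  : Poly
      q₀≢0 : coeff q 0 ≢ 0ℚ
      x≈   : num x * q ≈ p * den x
      p₀   : coeff p 0 ≡ r ℚ.* coeff q 0

  *-≢0 : ∀ {x y} → x ≢ 0ℚ → y ≢ 0ℚ → x ℚ.* y ≢ 0ℚ
  *-≢0 {x} {y} x≢0 y≢0 e = y≢0 (nonzero-cancel x y x≢0 e)

  product₀ : ∀ p q → coeff p 0 ≢ 0ℚ → coeff q 0 ≢ 0ℚ → coeff (p * q) 0 ≢ 0ℚ
  product₀ p q p₀ q₀ e = *-≢0 p₀ q₀ (≡.trans (≡.sym (coeff₀-* p q)) e)

  ↝-resp : ∀ {x y r} → x ≈ᶠ y → x ↝ r → y ↝ r
  ↝-resp {frac n d d≉0} {frac n′ d′ _} e (represented p q q₀ x≈ p₀) = represented p q q₀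
    (*-cancelʳ d d≉0 (trans (solve 3 (λ n q d → n :* q :* d := (n :* d) :* q) refl n′ q d)
      (trans (*-congʳ (sym e)) (trans (solve 3 (λ n q d → n :* d :* q := (n :* q) :* d) refl n q d′)
        (trans (*-congʳ x≈) (solve 3 (λ p d e → p :* d :* e := p :* e :* d) refl p d d′)))))) p₀

  ↝-+ : ∀ {x y r s} → x ↝ r → y ↝ s → (x +ᶠ y) ↝ (r ℚ.+ s)
  ↝-+ {frac n d _} {frac n′ d′ _} {r} {s} (represented p q q₀ e p₀) (represented p′ q′ q₀′ e′ p₀′) =
    represented (p * q′ + p′ * q) (q * q′) (product₀ q q′ q₀ q₀′)
      (trans (solve 6 (λ n d n′ d′ q q′ → (n :* d′ :+ n′ :* d) :* (q :* q′)
          := (n :* q) :* (d′ :* q′) :+ (n′ :* q′) :* (d :* q)) refl n d n′ d′ q q′)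
        (trans (+-cong (*-congʳ e) (*-congʳ e′))
          (solve 6 (λ p d p′ d′ q q′ → (p :* d) :* (d′ :* q′) :+ (p′ :* d′) :* (d :* q)
            := (p :* q′ :+ p′ :* q) :* (d :* d′)) refl p d p′ d′ q q′)))
      (begin
        coeff (p * q′ + p′ * q) 0 ≡⟨ coeff-+ (p * q′) (p′ * q) 0 ⟩
        coeff (p * q′) 0 ℚ.+ coeff (p′ * q) 0 ≡⟨ cong₂ ℚ._+_ (coeff₀-* p q′) (coeff₀-* p′ q) ⟩
        coeff p 0 ℚ.* coeff q′ 0 ℚ.+ coeff p′ 0 ℚ.* coeff q 0
          ≡⟨ cong₂ (λ x y → x ℚ.* coeff q′ 0 ℚ.+ y ℚ.* coeff q 0) p₀ p₀′ ⟩
        r ℚ.* coeff q 0 ℚ.* coeff q′ 0 ℚ.+ s ℚ.* coeff q′ 0 ℚ.* coeff q 0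
          ≡⟨ Q.solve 4 (λ r s x y → r Q.:* x Q.:* y Q.:+ s Q.:* y Q.:* x Q.:= (r Q.:+ s) Q.:* (x Q.:* y))
               ≡.refl r s (coeff q 0) (coeff q′ 0) ⟩
        (r ℚ.+ s) ℚ.* (coeff q 0 ℚ.* coeff q′ 0) ≡⟨ cong ((r ℚ.+ s) ℚ.*_) (coeff₀-* q q′) ⟨
        (r ℚ.+ s) ℚ.* coeff (q * q′) 0 ∎)
    where open ≡-Reasoning

  ↝-* : ∀ {x y r s} → x ↝ r → y ↝ s → (x *ᶠ y) ↝ (r ℚ.* s)
  ↝-* {frac n d _} {frac n′ d′ _} {r} {s} (represented p q q₀ e p₀) (represented p′ q′ q₀′ e′ p₀′) =
    represented (p * p′) (q * q′) (product₀ q q′ q₀ q₀′)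
      (trans (solve 4 (λ n n′ q q′ → (n :* n′) :* (q :* q′) := (n :* q) :* (n′ :* q′)) refl n n′ q q′)
        (trans (*-cong e e′)
          (solve 4 (λ p d p′ d′ → (p :* d) :* (p′ :* d′) := (p :* p′) :* (d :* d′)) refl p d p′ d′)))
      (begin
        coeff (p * p′) 0 ≡⟨ coeff₀-* p p′ ⟩
        coeff p 0 ℚ.* coeff p′ 0 ≡⟨ cong₂ ℚ._*_ p₀ p₀′ ⟩
        r ℚ.* coeff q 0 ℚ.* (s ℚ.* coeff q′ 0)
          ≡⟨ Q.solve 4 (λ r s x y → r Q.:* x Q.:* (s Q.:* y) Q.:= (r Q.:* s) Q.:* (x Q.:* y))
               ≡.refl r s (coeff q 0) (coeff q′ 0) ⟩
        (r ℚ.* s) ℚ.* (coeff q 0 ℚ.* coeff q′ 0) ≡⟨ cong ((r ℚ.* s) ℚ.*_) (coeff₀-* q q′) ⟨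
        (r ℚ.* s) ℚ.* coeff (q * q′) 0 ∎)
    where open ≡-Reasoning

  ↝-neg : ∀ {x r} → x ↝ r → (-ᶠ x) ↝ (ℚ.- r)
  ↝-neg {frac n d _} {r} (represented p q q₀ e p₀) = represented (- p) q q₀
    (trans (solve 2 (λ n q → :- n :* q := :- (n :* q)) refl n q)
      (trans (-‿cong e) (solve 2 (λ p d → :- (p :* d) := :- p :* d) refl p d)))
    (≡.trans (coeff-neg p 0) (≡.trans (cong ℚ.-_ p₀) (ℚ.neg-distribˡ-* r (coeff q 0))))

  embed↝ : ∀ p → embed p ↝ coeff p 0
  embed↝ p = represented p 1ᴾ (λ ()) refl (≡.sym (ℚ.*-identityʳ (coeff p 0)))

  ↝-unique : ∀ {x r s} → x ↝ r → x ↝ s → r ≡ s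
  ↝-unique {frac n d d≉0} {r} {s} (represented p q q₀ e p₀) (represented p′ q′ q₀′ e′ p₀′) =
    r-s≡0 (nonzero-cancel (coeff q 0 ℚ.* coeff q′ 0) (r ℚ.- s) (*-≢0 q₀ q₀′) (begin
      coeff q 0 ℚ.* coeff q′ 0 ℚ.* (r ℚ.- s)
        ≡⟨ Q.solve 4 (λ x y r s → x Q.:* y Q.:* (r Q.:- s) Q.:= r Q.:* x Q.:* y Q.:- s Q.:* y Q.:* x)
             ≡.refl (coeff q 0) (coeff q′ 0) r s ⟩
      r ℚ.* coeff q 0 ℚ.* coeff q′ 0 ℚ.- s ℚ.* coeff q′ 0 ℚ.* coeff q 0
        ≡⟨ cong₂ (λ x y → x ℚ.* coeff q′ 0 ℚ.- y ℚ.* coeff q 0) p₀ p₀′ ⟨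
      coeff p 0 ℚ.* coeff q′ 0 ℚ.- coeff p′ 0 ℚ.* coeff q 0
        ≡⟨ cong₂ ℚ._-_ (≡.trans (≡.sym (coeff₀-* p q′)) (at pq′≈p′q 0)) (≡.sym (coeff₀-* p′ q)) ⟩
      coeff (p′ * q) 0 ℚ.- coeff (p′ * q) 0 ≡⟨ ℚ.+-inverseʳ (coeff (p′ * q) 0) ⟩
      0ℚ ∎))
    where
    open ≡-Reasoning
    r-s≡0 : r ℚ.- s ≡ 0ℚ → r ≡ s
    r-s≡0 e = ≡.trans (Q.solve 2 (λ r s → r Q.:= (r Q.:- s) Q.:+ s) ≡.refl r s)
      (≡.trans (cong (ℚ._+ s) e) (ℚ.+-identityˡ s))

    pq′≈p′q : p * q′ ≈ p′ * q
    pq′≈p′q = *-cancelʳ d d≉0 (trans (solve 3 (λ p q d → p :* q :* d := (p :* d) :* q) refl p q′ d)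
      (trans (*-congʳ (sym e)) (trans (solve 3 (λ n q q′ → n :* q :* q′ := (n :* q′) :* q) refl n q q′)
        (trans (*-congʳ e′) (solve 3 (λ p d q → p :* d :* q := p :* q :* d) refl p′ d q)))))

  data Reduction (n d : Poly) : Set where
    pole-free : ∀ p q → coeff q 0 ≢ 0ℚ → n * q ≈ p * d → Reduction n d
    pole      : ∀ p q → coeff q 0 ≢ 0ℚ → coeff p 0 ≡ 0ℚ → ¬ n ≈ 0ᴾ → d * q ≈ p * n → Reduction n d

  -- Strips common factors k until numerator or denominator has a nonzero constant term; the
  -- denominator cannot run out because it is nonzero.
  reduce : ∀ n d → ¬ d ≈ 0ᴾ → Reduction n d
  reduce n []      d≉0 = contradiction refl d≉0
  reduce n (b ∷ d) d≉0 with b ℚ.≟ 0ℚ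
  ... | no  b≢0 = pole-free n (b ∷ d) b≢0 refl
  reduce []      (b ∷ d) d≉0 | yes b≡0 = pole-free 0ᴾ 1ᴾ (λ ()) refl
  reduce (a ∷ n) (b ∷ d) d≉0 | yes b≡0 with a ℚ.≟ 0ℚ
  ... | no  a≢0 = pole (b ∷ d) (a ∷ n) a≢0 b≡0 (λ e → a≢0 (at e 0)) refl
  ... | yes a≡0 with reduce n d (λ d≈0 → d≉0 (ℚ[k].∷≈0 b≡0 d≈0))
  ...   | pole-free p q q₀ e = pole-free p q q₀
          (trans (0∷-* n q a≡0) (trans (ℚ[k].∷-cong ≡.refl e) (sym (ℚ[k].*-0∷ p d b≡0))))
  ...   | pole p q q₀ p₀ n≉0 e = pole p q q₀ p₀ (n≉0 ∘ ℚ[k].tail≈0)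
          (trans (0∷-* d q b≡0) (trans (ℚ[k].∷-cong ≡.refl e) (sym (ℚ[k].*-0∷ p n a≡0))))

  integral⊎inverse : ∀ x → (∃[ r ] x ↝ r) ⊎ (∃[ y ] y *ᶠ x ≈ᶠ 1ᶠ × y ↝ 0ℚ)
  integral⊎inverse (frac n d d≉0) with reduce n d d≉0
  ... | pole-free p q q₀ e = inj₁ (coeff p 0 ℚ.* (ℚ.1/ coeff q 0) , represented p q q₀ e
        (≡.trans (≡.sym (ℚ.*-identityʳ _)) (≡.trans (cong (coeff p 0 ℚ.*_) (≡.sym (ℚ.*-inverseˡ (coeff q 0))))
          (≡.sym (ℚ.*-assoc (coeff p 0) _ (coeff q 0))))))
    where instance _ = ℚ.≢-nonZero q₀
  ... | pole p q q₀ p₀ n≉0 e = inj₂ (frac d n n≉0 ,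
        trans (*-identityʳ _) (trans (*-comm d n) (sym (*-identityˡ _))) ,
        represented p q q₀ e (≡.trans p₀ (≡.sym (ℚ.*-zeroˡ (coeff q 0)))))

  place : RationalPlace ℚ⟨k⟩.commutativeRingᶠ 0ℓ
  place = record
    { _↝_ = _↝_
    ; ↝-resp = λ {x} {y} → ↝-resp {x} {y}
    ; ↝-+ = ↝-+ ; ↝-* = ↝-* ; ↝-neg = ↝-neg
    ; 1↝1 = embed↝ 1ᴾ
    ; ↝-unique = ↝-unique
    ; integral⊎inverse = integral⊎inverse
    }

  -- Leading coefficients

  -- Trailing zeros make the length of a list useless as a degree. That x is nonzero is a separate
  -- condition, imposed where the degree has to be determined.
  record Top (p : Poly) (d : ℕ) (x : ℚ) : Set where
    constructor top
    field
      leading : coeff p d ≡ x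
      above   : ∀ m → d ℕ.< m → coeff p m ≡ 0ℚ

  find-top : ∀ p → p ≈ 0ᴾ ⊎ ∃[ d ] ∃[ x ] x ≢ 0ℚ × Top p d x
  find-top [] = inj₁ refl
  find-top (a ∷ p) with find-top p
  ... | inj₂ (d , x , x≢0 , top l h) = inj₂ (suc d , x , x≢0 , top l λ { (suc m) (s≤s d<m) → h m d<m })
  ... | inj₁ p≈0 with a ℚ.≟ 0ℚ
  ...   | yes a≡0 = inj₁ (ℚ[k].∷≈0 a≡0 p≈0)
  ...   | no  a≢0 = inj₂ (0 , a , a≢0 , top ≡.refl λ { (suc m) _ → at p≈0 m })

  coeff-∷* : ∀ a p q m → coeff ((a ∷ p) * q) (suc m) ≡ a ℚ.* coeff q (suc m) ℚ.+ coeff (p * q) m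
  coeff-∷* a p q m = ≡.trans (coeff-+ (ℚ[k].scale a q) (0ℚ ∷ p * q) (suc m))
    (cong (ℚ._+ coeff (p * q) m) (ℚ[k].coeff-scale a q (suc m)))

  top-* : ∀ {p q d e x y} → Top p d x → Top q e y → Top (p * q) (d ℕ.+ e) (x ℚ.* y)
  top-* {[]} {y = y} (top l _) _ =
    top (≡.trans (≡.sym (ℚ.*-zeroˡ y)) (cong (ℚ._* y) l)) λ _ _ → ≡.refl
  top-* {a ∷ p} {q} {zero} {e} {x} {y} (top l h) (top l′ h′) =
    top (≡.trans (constant e) (cong₂ ℚ._*_ l l′))
      λ m e<m → ≡.trans (constant m) (≡.trans (cong (a ℚ.*_) (h′ m e<m)) (ℚ.*-zeroʳ a))
    where
    p≈0 : p ≈ 0ᴾ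
    p≈0 = coeffwise λ m → h (suc m) (s≤s z≤n)
    constant : ∀ m → coeff ((a ∷ p) * q) m ≡ a ℚ.* coeff q m
    constant m = ≡.trans (coeff-+ (ℚ[k].scale a q) (0ℚ ∷ p * q) m)
      (≡.trans (cong₂ ℚ._+_ (ℚ[k].coeff-scale a q m)
        (at (ℚ[k].∷≈0 ≡.refl (trans (*-congʳ p≈0) (zeroˡ q))) m)) (ℚ.+-identityʳ _))
  top-* {a ∷ p} {q} {suc d} {e} {x} {y} (top l h) tq@(top l′ h′) =
    top (≡.trans (shifted (d ℕ.+ e) (s≤s (ℕ.m≤n+m e d))) (Top.leading rest))
      λ { (suc m) (s≤s d+e<m) → ≡.trans
            (shifted m (s≤s (ℕ.≤-trans (ℕ.m≤n+m e d) (ℕ.<⇒≤ d+e<m)))) (Top.above rest m d+e<m) }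
    where
    rest : Top (p * q) (d ℕ.+ e) (x ℚ.* y)
    rest = top-* {p} (top l λ m d<m → h (suc m) (s≤s d<m)) tq
    shifted : ∀ m → e ℕ.< suc m → coeff ((a ∷ p) * q) (suc m) ≡ coeff (p * q) m
    shifted m e<m = ≡.trans (coeff-∷* a p q m)
      (≡.trans (cong (λ z → a ℚ.* z ℚ.+ coeff (p * q) m) (h′ (suc m) e<m))
        (≡.trans (cong (ℚ._+ coeff (p * q) m) (ℚ.*-zeroʳ a)) (ℚ.+-identityˡ _)))

  top-unique : ∀ {p q d e x y} → p ≈ q → Top p d x → Top q e y → x ≢ 0ℚ → y ≢ 0ℚ → x ≡ y
  top-unique {d = d} {e} p≈q (top l h) (top l′ h′) x≢0 y≢0 with ℕ.<-cmp d e
  ... | tri< d<e _ _ = contradiction (≡.trans (≡.sym l′) (≡.trans (≡.sym (at p≈q e)) (h e d<e))) y≢0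
  ... | tri≈ _ ≡.refl _ = ≡.trans (≡.sym l) (≡.trans (at p≈q d) l′)
  ... | tri> _ _ e<d = contradiction (≡.trans (≡.sym l) (≡.trans (at p≈q d) (h′ d e<d))) x≢0

  -- With y = n / m, p n² = m² compares leading coefficients: a negative number times a nonzero
  -- square would be a square.
  negative-leading⇒nonsquare : ∀ {p d x} → Top p d (ℚ.- x) → x ≢ 0ℚ → ℚ.∣ x ∣ ≡ x →
    ∀ y → ¬ embed p *ᶠ (y *ᶠ y) ≈ᶠ 1ᶠ
  negative-leading⇒nonsquare {p} {d} {x} tp x≢0 ∣x∣≡x (frac n m m≉0) e =
    compare (find-top n) (find-top m)
    where
    pn²≈m² : p * (n * n) ≈ m * m
    pn²≈m² = trans (sym (*-identityʳ _)) (trans e (trans (*-identityˡ _) (*-identityˡ _)))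

    compare : (n ≈ 0ᴾ ⊎ ∃[ d ] ∃[ x ] x ≢ 0ℚ × Top n d x) → (m ≈ 0ᴾ ⊎ ∃[ d ] ∃[ x ] x ≢ 0ℚ × Top m d x) → _
    compare _ (inj₁ m≈0) = m≉0 m≈0
    compare (inj₁ n≈0) (inj₂ _) = ℚ⟨k⟩.*-≉0 m≉0 m≉0 (trans (sym pn²≈m²)
      (trans (*-congˡ {p} (trans (*-congʳ n≈0) (zeroˡ n))) (ℚ[k].*-zeroʳ p)))
    compare (inj₂ (_ , y , y≢0 , tn)) (inj₂ (_ , z , z≢0 , tm)) =
      *-≢0 x≢0 (*-≢0 y≢0 y≢0) (negated-square z (x ℚ.* (y ℚ.* y))
        (≡.sym (≡.trans (ℚ.∣p*q∣≡∣p∣*∣q∣ x (y ℚ.* y)) (cong₂ ℚ._*_ ∣x∣≡x (≡.sym (square≡∣square∣ y)))))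
        (≡.trans (≡.sym (top-unique pn²≈m² (top-* tp (top-* tn tn)) (top-* tm tm)
            (*-≢0 -x≢0 (*-≢0 y≢0 y≢0)) (*-≢0 z≢0 z≢0)))
          (≡.sym (ℚ.neg-distribˡ-* x (y ℚ.* y)))))
      where
      -x≢0 : ℚ.- x ≢ 0ℚ
      -x≢0 e = x≢0 (≡.trans (Q.solve 1 (λ x → x Q.:= Q.:- (Q.:- x)) ≡.refl x) (cong ℚ.-_ e))

-- The given curve at k = 0

module CurveAtZero where

  open PlaceAtZero
  open ℚ[k] using (Poly; coeff; at; 0∷-*; 0ᴾ)
  open CommutativeRing ℚ[k].commutativeRing
    using (refl; sym; trans; _≈_; _*_; *-congˡ; *-congʳ; *-identityˡ)
  open IntegerRingSolver ℚ[k].commutativeRing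
  open ℚ⟨k⟩ using (frac; embed; _≈ᶠ_; _*ᶠ_; _≟ᶠ_)

  private module J = JacobiCoordinates ℚ⟨k⟩-field _#?_ E

  kᴾ : Poly
  kᴾ = 0ℚ ∷ 1ℚ ∷ []

  kᴾ≉0 : ¬ kᴾ ≈ 0ᴾ
  kᴾ≉0 e with () ← at e 1

  kᴾ-* : ∀ p → kᴾ * p ≈ 0ℚ ∷ p
  kᴾ-* p = trans (0∷-* (1ℚ ∷ []) p ≡.refl) (ℚ[k].∷-cong ≡.refl (*-identityˡ p))

  embed-cancel : ∀ {κ} → ¬ κ ≈ 0ᴾ → ∀ x z → embed κ *ᶠ x ≈ᶠ embed κ *ᶠ z → x ≈ᶠ z
  embed-cancel {κ} κ≉0 (frac n d _) (frac n′ d′ _) e = ℚ⟨k⟩.*-cancelʳ κ κ≉0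
    (trans (solve 3 (λ n d κ → n :* d :* κ := (κ :* n) :* d) refl n d′ κ)
      (trans (*-congˡ {κ * n} (sym (*-identityˡ d′))) (trans e (trans (*-congˡ {κ * n′} (*-identityˡ d))
        (solve 3 (λ n d κ → (κ :* n) :* d := n :* d :* κ) refl n′ d κ)))))

  -- The numerator has constant term 0, so dropping the head of its list divides it by k.
  k-divides : ∀ x → x ↝ 0ℚ → ∃[ z ] ∃[ s ] x ≈ᶠ k *ᶠ z × z ↝ s
  k-divides (frac n d d≉0) (represented p q q₀≢0 x≈ p₀) =
    frac (tail p) q q≉0 , coeff (tail p) 0 ℚ.* (ℚ.1/ coeff q 0) ,
    trans (*-congˡ {n} (*-identityˡ q)) (trans x≈ (*-congʳ (p≈ p (≡.trans p₀ (ℚ.*-zeroˡ (coeff q 0)))))) ,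
    represented (tail p) q q₀≢0 refl
      (≡.trans (≡.sym (ℚ.*-identityʳ _)) (≡.trans (cong (coeff (tail p) 0 ℚ.*_)
        (≡.sym (ℚ.*-inverseˡ (coeff q 0))))
        (≡.sym (ℚ.*-assoc (coeff (tail p) 0) _ (coeff q 0)))))
    where
    instance _ = ℚ.≢-nonZero q₀≢0
    q≉0 : ¬ q ≈ 0ᴾ
    q≉0 e = q₀≢0 (at e 0)
    tail : Poly → Poly
    tail []      = []
    tail (_ ∷ p) = p
    p≈ : ∀ p → coeff p 0 ≡ 0ℚ → p ≈ kᴾ * tail p
    p≈ []      _  = sym (ℚ[k].*-zeroʳ kᴾ)
    p≈ (x ∷ p) e₀ = trans (ℚ[k].∷-cong e₀ refl) (sym (kᴾ-* p))

  -- Expansions of A / k = (k² - 4 k + 20) (a - c) and B = a (b - c). The cubic terms of b and c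
  -- cancel, so B has degree 4 and leading coefficient 10 · (-6).
  A/k Bᴾ : Poly
  A/k = ι (+ 320) ∷ ι -[1+ 143 ] ∷ ι (+ 192) ∷ ι -[1+ 55 ] ∷ ι (+ 12) ∷ ι -[1+ 0 ] ∷ []
  Bᴾ  = ι (+ 64) ∷ ι (+ 128) ∷ ι -[1+ 159 ] ∷ ι (+ 288) ∷ ι -[1+ 59 ] ∷ []

  A≈ : J.A ≈ᶠ embed (0ℚ ∷ A/k)
  A≈ = from-yes (J.A ≟ᶠ embed (0ℚ ∷ A/k))

  B≈ : J.B ≈ᶠ embed Bᴾ
  B≈ = from-yes (J.B ≟ᶠ embed Bᴾ)

  q≈ : J.q ≈ᶠ k *ᶠ (embed A/k *ᶠ embed Bᴾ)
  q≈ = from-yes (J.q ≟ᶠ (k *ᶠ (embed A/k *ᶠ embed Bᴾ)))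

  k↝0 : k ↝ 0ℚ
  k↝0 = embed↝ kᴾ

  A↝0 : J.A ↝ 0ℚ
  A↝0 = ↝-resp {embed (0ℚ ∷ A/k)} {J.A} (sym A≈) (embed↝ (0ℚ ∷ A/k))

  B↝64 : J.B ↝ ι (+ 64)
  B↝64 = ↝-resp {embed Bᴾ} {J.B} (sym B≈) (embed↝ Bᴾ)

  q-nonsquare : ∀ x → ¬ x *ᶠ x ≈ᶠ J.q
  q-nonsquare x e = RationalPlace.uniformizer*unit-nonsquare place {k} {embed A/k *ᶠ embed Bᴾ}
    k↝0 (λ {x} {z} → embed-cancel kᴾ≉0 x z) k-divides (↝-* (embed↝ A/k) (embed↝ Bᴾ)) (λ ()) x
    (ℚ⟨k⟩.≈ᶠ-trans {x *ᶠ x} {J.q} {k *ᶠ (embed A/k *ᶠ embed Bᴾ)} e q≈)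

  Bᴾ-top : Top Bᴾ 4 (ℚ.- ι (+ 60))
  Bᴾ-top = top ≡.refl λ { (suc (suc (suc (suc (suc _))))) _ → ≡.refl
    ; 1 (s≤s ()) ; 2 (s≤s (s≤s ())) ; 3 (s≤s (s≤s (s≤s ()))) ; 4 (s≤s (s≤s (s≤s (s≤s ())))) }

  B-nonsquare : ∀ x → ¬ J.B *ᶠ (x *ᶠ x) ≈ᶠ ℚ⟨k⟩.1ᶠ
  B-nonsquare x e = negative-leading⇒nonsquare {x = ι (+ 60)} Bᴾ-top (λ ()) ≡.refl x
    (ℚ⟨k⟩.≈ᶠ-trans {embed Bᴾ *ᶠ (x *ᶠ x)} {J.B *ᶠ (x *ᶠ x)} {ℚ⟨k⟩.1ᶠ}
      (ℚ⟨k⟩.*ᶠ-cong {embed Bᴾ} {J.B} {x *ᶠ x} {x *ᶠ x} (sym B≈) refl) e)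

  -- The square of e = 8 evaluates to 64, so `B↝64` has the type demanded of B.
  open TorsionBound ℚ⟨k⟩-field _#?_ E q-nonsquare place (ι (+ 8)) (λ ()) using (module Multiples)

  torsion⇒u≈0 : ∀ P → IsTorsion E⟨ℚ⟨k⟩⟩ P → J.Nonsquare.uₚ q-nonsquare P ≈ᶠ ℚ⟨k⟩.0ᶠ
  torsion⇒u≈0 P (suc n , _ , nP≈O) = Multiples.torsion⇒u≈0 A↝0 B↝64 P B-nonsquare n nP≈O

theorem4p1 : Σ[ T ∈ IsSubgroup E⟨ℚ⟨k⟩⟩ (IsTorsion E⟨ℚ⟨k⟩⟩) ] ∃[ φ ] IsGroupIsomorphism (subgroup E⟨ℚ⟨k⟩⟩ T) ℤ/2×ℤ/2 φ
theorem4p1 = isSubgroup torsion⇒u≈0 , signs torsion⇒u≈0 , isGroupIsomorphism torsion⇒u≈0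
  where
  open CurveAtZero using (q-nonsquare; torsion⇒u≈0)
  open TorsionSubgroup ℚ⟨k⟩-field _#?_ E q-nonsquare
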